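{- For every finite graph $H$ and every $\Delta\in\mathbb{N}$, there exists $c\in\mathbb{N}$ such that every finite graph with maximum degree at most $\Delta$ that does not contain $H$ as an induced minor admits a colouring of its vertices with $3$ colours in which every monochromatic connected component has at most $c$ vertices. (That is, this class has clustered chromatic number at most $3$.)
   Context: $H$ is an induced minor of $G$ if $H$ can be obtained from an induced subgraph of $G$ by contracting edges. A colouring need not be proper; a monochromatic component is a connected component of the subgraph induced by the vertices of one colour. -}

module Defs where

open import Data.Nat using (ℕ; suc; _≤_)
open import Data.Fin using (Fin)
open import Data.Bool using (Bool; true; false)
open import Data.List using (length; filterᵇ; allFin)
open import Data.Maybe using (Maybe; just)
open import Data.Product using (Σ; ∃; _×_; _,_)
open import Relation.Binary.PropositionalEquality using (_≡_; _≢_)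
open import Relation.Nullary using (¬_)
open import Function using (_⇔_)
open import Function.Definitions using (Injective)

record Graph : Set where
  field
    n      : ℕ
    adj    : Fin n → Fin n → Bool
    sym    : ∀ u v → adj u v ≡ adj v u
    irrefl : ∀ u → adj u u ≡ false
open Graph public

V : Graph → Set
V G = Fin (n G)

deg : (G : Graph) → V G → ℕ
deg G u = length (filterᵇ (adj G u) (allFin (n G)))

MaxDegree≤ : Graph → ℕ → Set
MaxDegree≤ G Δ = ∀ u → deg G u ≤ Δ

data Reach (G : Graph) (P : V G → Set) (u : V G) : V G → Set where
  here : P u → Reach G P u u
  step : ∀ {w v} → Reach G P u w → adj G w v ≡ true → P v → Reach G P u v

-- An induced-minor model of H in G: each vertex of G is assigned to at most one
-- branch set (Maybe), branch sets are nonempty and induce connected subgraphs,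
-- and distinct x, y are adjacent in H iff some edge of G joins B x and B y.
record InducedMinorModel (H G : Graph) : Set where
  field
    branch    : V G → Maybe (V H)
    nonempty  : ∀ x → ∃ λ v → branch v ≡ just x
    connected : ∀ x u v → branch u ≡ just x → branch v ≡ just x →
                Reach G (λ w → branch w ≡ just x) u v
    edges     : ∀ x y → x ≢ y →
                (adj H x y ≡ true ⇔
                  (∃ λ u → ∃ λ v → branch u ≡ just x × branch v ≡ just y × adj G u v ≡ true))

IsInducedMinor : Graph → Graph → Set
IsInducedMinor H G = InducedMinorModel H G

-- Under the (not necessarily proper) colouring col, every monochromatic
-- component has at most c vertices: no c+1 distinct vertices lie in the
-- monochromatic component of any vertex u.
ClusteredBy : (G : Graph) {k : ℕ} → (V G → Fin k) → ℕ → Set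
ClusteredBy G col c =
  ∀ (u : V G) (f : Fin (suc c) → V G) → Injective _≡_ _≡_ f →
  ¬ (∀ i → Reach G (λ w → col w ≡ col u) u (f i))

{-# OPTIONS --safe #-}
-- Layer a component of G by distance from a root. Any bounded number of consecutive layers
-- (a window) has small balanced separators, so by a tree-partition recursion it has a
-- 2-colouring with bounded clusters, even if vertices at distance at most D count as
-- adjacent. Such colourings of every sixth layer and of the layers in between combine to a
-- 3-colouring: in every sixth layer one colour is used up to small gaps, and the gaps are
-- shielded from the remaining two colours.
--
-- Suppose that a large set in a window has no small separator. The search paths from it to the
-- root contain many connected, pairwise non-adjacent hubs below the window, and any two hubs
-- are joined by many pairwise non-adjacent paths in the window. If one path per pair of
-- hubs can be chosen without contacts between them, we find H. Otherwise, by Ramsey, all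
-- paths of some large family touch all paths of another one. The contacts are again joined to
-- the root below the window, and the resulting pieces each touch many rows or many columns:
-- a dense bipartite graph whose edges can be deleted one by one, so that Mader's theorem
-- provides H as an induced minor.
module Submission where

open import Defs renaming (sym to adj-sym; irrefl to adj-irrefl; n to order)
open import Data.Nat using (ℕ; zero; suc; _+_; _*_; _∸_; _^_; _≤_; _<_; z≤n; s≤s; _≤?_; _<?_; _/_; _%_)
open import Data.Nat.Properties hiding (_≟_)
open import Data.Nat using () renaming (_≟_ to _≟ℕ_)
open import Data.Nat.DivMod using (m≡m%n+[m/n]*n; m%n<n)
open import Data.Fin using (Fin; punchOut; inject≤) renaming (zero to fzero; suc to fsuc)
open import Data.Fin.Properties using (_≟_; punchOut-injective; <⇒notInjective)
import Data.Fin.Properties as Finₚ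
open import Data.Fin using () renaming (_<_ to _<ᶠ_)
open import Data.Bool using (Bool; true; false; not; if_then_else_; _∧_)
open import Data.Nat.Tactic.RingSolver using (solve-∀)
import Data.Bool.Properties as Boolₚ
open import Data.List using (List; []; _∷_; _++_; length; map; filter; filterᵇ; concatMap; allFin; lookup; take; tabulate; deduplicate; cartesianProduct)
open import Data.List.Properties using (length-++; length-map; length-filter; length-take; length-tabulate; length-deduplicate; filter-all)
open import Data.List.Relation.Unary.Any using (Any; here; there; index; any?)
open import Data.List.Relation.Unary.Any.Properties using (lookup-index)
open import Data.List.Relation.Unary.All using (All; []; _∷_; all?)
import Data.List.Relation.Unary.All as All
import Data.List.Relation.Unary.All.Properties as Allₚ
open import Data.List.Relation.Unary.AllPairs using (AllPairs; []; _∷_)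
import Data.List.Relation.Unary.AllPairs.Properties as AllPairsₚ
open import Data.List.Relation.Unary.Unique.Propositional using (Unique)
import Data.List.Relation.Unary.Unique.Propositional.Properties as Uniqueₚ
open import Data.List.Relation.Unary.Unique.DecPropositional.Properties using (deduplicate-!)
open import Data.List.Membership.Propositional using (_∈_; _∉_; find; lose)
open import Data.List.Membership.Propositional.Properties
import Data.List.Membership.DecPropositional as DecMem
open import Data.Maybe using (Maybe; just; nothing)
open import Data.Product using (Σ; ∃; ∃₂; _×_; _,_; proj₁; proj₂)
import Data.Product.Properties as Prodₚ
open import Data.Sum using (_⊎_; inj₁; inj₂; [_,_]′)
import Data.Sum.Properties as Sumₚ
open import Data.Empty using (⊥; ⊥-elim)
open import Data.Unit using (⊤; tt)
open import Function using (_∘_; id; mk⇔; Equivalence)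
open import Function.Definitions using (Injective)
open import Relation.Binary.PropositionalEquality using (_≡_; _≢_; refl; sym; trans; cong; cong₂; subst; subst₂)
open import Relation.Binary.Definitions using (DecidableEquality; Tri; tri<; tri≈; tri>)
open import Relation.Nullary using (¬_; Dec; yes; no; does; ¬?; _×-dec_; _⊎-dec_)
open import Relation.Nullary.Decidable using (decidable-stable; dec-true; dec-false)
open import Relation.Unary using (Decidable)

-- The obstacle is that an induced minor also forbids contacts. Inside the window bounded degree
-- removes them: pairwise non-adjacent paths cost only a constant factor in Menger's theorem, and
-- far-apart vertices are found by thinning. The layering removes the others: hubs consist of tree
-- paths in layers below the window, separated from the linking paths by a layer in which only stems
-- occur, so that every contact is known.
--
-- Colouring alternate blocks of layers from disjoint palettes would need four colours. Here one of
-- the two colours of every sixth layer is shared with the layers in between. Its clusters, the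
-- gaps, have bounded diameter, so a run of vertices beside them is short; the layers in between are
-- coloured for a distance larger than that diameter, which absorbs these runs. This is why vertices
-- at distance at most `D` must count as adjacent, with `D` depending on an earlier cluster bound.

infix 4 _⊆_

-- Lists: counting and thinning

_⊆_ : {A : Set} → List A → List A → Set
xs ⊆ ys = ∀ {x} → x ∈ xs → x ∈ ys

remove : {A : Set} {x : A} {ys : List A} → x ∈ ys →
  ∃ λ zs → length ys ≡ suc (length zs) × (∀ {z} → z ∈ ys → z ≢ x → z ∈ zs)
remove {x = x} x∈ with ∈-∃++ x∈
... | as , bs , refl = as ++ bs , len as , mem
  where
  len : ∀ as → length (as ++ x ∷ bs) ≡ suc (length (as ++ bs))
  len []       = refl
  len (_ ∷ as) = cong suc (len as)
  mem : ∀ {z} → z ∈ as ++ x ∷ bs → z ≢ x → z ∈ as ++ bs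
  mem z∈ z≢x with ∈-++⁻ as z∈
  ... | inj₁ p         = ∈-++⁺ˡ p
  ... | inj₂ (here q)  = ⊥-elim (z≢x q)
  ... | inj₂ (there p) = ∈-++⁺ʳ as p

-- Pigeonhole along a relation: with `R i v` read as "`v` lies in the `i`-th set", pairwise disjoint
-- sets that all meet `ys` number at most `length ys`. Most counting below has this form.
inj-length : {A B : Set} (R : A → B → Set) {xs : List A} {ys : List B} → Unique xs →
  (∀ {x} → x ∈ xs → ∃ λ y → y ∈ ys × R x y) →
  (∀ {x x′ y} → x ∈ xs → x′ ∈ xs → R x y → R x′ y → x ≡ x′) →
  length xs ≤ length ys
inj-length R {[]}     uq       w inj = z≤n
inj-length R {x ∷ xs} {ys} (x∉ ∷ uq) w inj with w (here refl)
... | y , y∈ , r with remove y∈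
... | zs , eq , mem = subst (suc (length xs) ≤_) (sym eq) (s≤s (inj-length R uq w′ λ p q → inj (there p) (there q)))
  where
  w′ : ∀ {x′} → x′ ∈ xs → ∃ λ y′ → y′ ∈ zs × R x′ y′
  w′ x′∈ with w (there x′∈)
  ... | y′ , y′∈ , r′ = y′ , mem y′∈ (λ { refl → All.lookup x∉ x′∈ (inj (here refl) (there x′∈) r r′) }) , r′

uniq-length : {A : Set} {xs ys : List A} → Unique xs → xs ⊆ ys → length xs ≤ length ys
uniq-length uq sub = inj-length _≡_ uq (λ p → _ , sub p , refl) λ _ _ p q → trans p (sym q)

filter-split : {A : Set} {P : A → Set} (P? : Decidable P) (xs : List A) →
  length xs ≡ length (filter P? xs) + length (filter (¬? ∘ P?) xs)
filter-split P? [] = refl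
filter-split P? (x ∷ xs) with P? x
... | yes _ = cong suc (filter-split P? xs)
... | no  _ = trans (cong suc (filter-split P? xs)) (sym (+-suc _ _))

length-concatMap-≤ : {A B : Set} (f : A → List B) (b : ℕ) (xs : List A) →
  (∀ {x} → x ∈ xs → length (f x) ≤ b) → length (concatMap f xs) ≤ length xs * b
length-concatMap-≤ f b []       h = z≤n
length-concatMap-≤ f b (x ∷ xs) h = subst (_≤ b + length xs * b) (sym (length-++ (f x)))
  (+-mono-≤ (h (here refl)) (length-concatMap-≤ f b xs (h ∘ there)))

∈-concatMap : {A B : Set} (f : A → List B) {xs : List A} {x : A} {y : B} → x ∈ xs → y ∈ f x → y ∈ concatMap f xs
∈-concatMap f x∈ y∈ = ∈-concatMap⁺ f (lose x∈ y∈)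

∈-concatMap⁻′ : {A B : Set} (f : A → List B) (xs : List A) {y : B} → y ∈ concatMap f xs → ∃ λ x → x ∈ xs × y ∈ f x
∈-concatMap⁻′ f xs y∈ = find (∈-concatMap⁻ f {xs = xs} y∈)

take-⊆ : {A : Set} (k : ℕ) {xs : List A} → take k xs ⊆ xs
take-⊆ (suc k) {_ ∷ _} (here p)  = here p
take-⊆ (suc k) {_ ∷ _} (there p) = there (take-⊆ k p)

length-take-≤ : {A : Set} (k : ℕ) {xs : List A} → k ≤ length xs → length (take k xs) ≡ k
length-take-≤ k {xs} le = trans (length-take k xs) (m≤n⇒m⊓n≡m le)

-- Greedy choice: keeping `x` discards the at most `b` elements near it. The price `suc b` per
-- element also guarantees that the list is nonempty as long as something is to be chosen.
thin : {A : Set} (Near : A → A → Set) (near? : ∀ x y → Dec (Near x y)) (nears : A → List A) (b : ℕ) →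
  (∀ x → length (nears x) ≤ b) → (∀ {x y} → Near x y → y ∈ nears x) →
  ∀ N {xs} → Unique xs → N * suc b ≤ length xs →
  ∃ λ ys → ys ⊆ xs × AllPairs (λ x y → ¬ Near x y) ys × length ys ≡ N
thin Near near? nears b len mem zero uq le = [] , (λ ()) , [] , refl
thin Near near? nears b len mem (suc N) {x ∷ xs} uq le = x ∷ ys , sub , All.tabulate far ∷ ap , cong suc eq
  where
  rest = filter (¬? ∘ near? x) (x ∷ xs)
  small : length (filter (near? x) (x ∷ xs)) ≤ b
  small = ≤-trans (uniq-length (Uniqueₚ.filter⁺ (near? x) uq) (λ p → mem (proj₂ (∈-filter⁻ (near? x) {xs = x ∷ xs} p)))) (len x)
  big : N * suc b ≤ length rest
  big = +-cancelˡ-≤ b _ _ (≤-trans (n≤1+n _) (≤-trans le (≤-trans (≤-reflexive (filter-split (near? x) (x ∷ xs)))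
          (+-monoˡ-≤ (length rest) small))))
  rec = thin Near near? nears b len mem N (Uniqueₚ.filter⁺ (¬? ∘ near? x) uq) big
  ys = proj₁ rec
  ap = proj₁ (proj₂ (proj₂ rec))
  eq = proj₂ (proj₂ (proj₂ rec))
  ys⊆ : ys ⊆ rest
  ys⊆ = proj₁ (proj₂ rec)
  sub : x ∷ ys ⊆ x ∷ xs
  sub (here p)  = here p
  sub (there p) = proj₁ (∈-filter⁻ (¬? ∘ near? x) {xs = x ∷ xs} (ys⊆ p))
  far : ∀ {y} → y ∈ ys → ¬ Near x y
  far p = proj₂ (∈-filter⁻ (¬? ∘ near? x) {xs = x ∷ xs} (ys⊆ p))

∈-allPairs : {A : Set} {R : A → A → Set} {xs : List A} → (∀ {x y} → R x y → R y x) → AllPairs R xs →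
  ∀ {x y} → x ∈ xs → y ∈ xs → x ≢ y → R x y
∈-allPairs s (a ∷ ap) (here refl) (here refl) ne = ⊥-elim (ne refl)
∈-allPairs s (a ∷ ap) (here refl) (there q)   ne = All.lookup a q
∈-allPairs s (a ∷ ap) (there p)   (here refl) ne = s (All.lookup a p)
∈-allPairs s (a ∷ ap) (there p)   (there q)   ne = ∈-allPairs s ap p q ne

injective⇒surjective : ∀ {k} (f : Fin k → Fin k) → Injective _≡_ _≡_ f → ∀ p → ∃ λ i → f i ≡ p
injective⇒surjective {suc k} f inj p with Finₚ.any? (λ i → f i ≟ p)
... | yes w = w
... | no ¬w = ⊥-elim (<⇒notInjective {f = g} ≤-refl λ {x} {y} e → inj (punchOut-injective {i = p} (ne x) (ne y) e))
  where
  ne : ∀ i → p ≢ f i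
  ne i e = ¬w (i , sym e)
  g : Fin (suc k) → Fin k
  g i = punchOut (ne i)

-- Menger's theorem

module Walks {A : Set} where

  data Walk (E : List (A × A)) : A → A → Set where
    stop : ∀ a → Walk E a a
    go   : ∀ a {b c} → (a , b) ∈ E → Walk E b c → Walk E a c

  verts : ∀ {E a b} → Walk E a b → List A
  verts (stop a)   = a ∷ []
  verts (go a _ w) = a ∷ verts w

  source∈ : ∀ {E a b} (w : Walk E a b) → a ∈ verts w
  source∈ (stop a)   = here refl
  source∈ (go a _ w) = here refl

  target∈ : ∀ {E a b} (w : Walk E a b) → b ∈ verts w
  target∈ (stop a)   = here refl
  target∈ (go a _ w) = there (target∈ w)

  _++ʷ_ : ∀ {E a b c} → Walk E a b → Walk E b c → Walk E a c
  stop _   ++ʷ w′ = w′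
  go a e w ++ʷ w′ = go a e (w ++ʷ w′)

  verts-++ : ∀ {E a b c} (w : Walk E a b) (w′ : Walk E b c) {v} → v ∈ verts (w ++ʷ w′) → v ∈ verts w ⊎ v ∈ verts w′
  verts-++ (stop _)   w′ p         = inj₂ p
  verts-++ (go a e w) w′ (here p)  = inj₁ (here p)
  verts-++ (go a e w) w′ (there p) with verts-++ w w′ p
  ... | inj₁ q = inj₁ (there q)
  ... | inj₂ q = inj₂ q

  weaken : ∀ {E E′ a b} → E ⊆ E′ → Walk E a b → Walk E′ a b
  weaken s (stop a)   = stop a
  weaken s (go a e w) = go a (s e) (weaken s w)

  verts-weaken : ∀ {E E′ a b} (s : E ⊆ E′) (w : Walk E a b) → verts (weaken s w) ≡ verts w
  verts-weaken s (stop a)   = refl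
  verts-weaken s (go a e w) = cong (a ∷_) (verts-weaken s w)

  prefix : ∀ {E a b v} (w : Walk E a b) → v ∈ verts w → Σ (Walk E a v) λ w′ → verts w′ ⊆ verts w
  prefix (stop a)   (here refl) = stop a , id
  prefix (go a e w) (here refl) = stop a , λ { (here p) → here p }
  prefix (go a e w) (there p) with prefix w p
  ... | w′ , s = go a e w′ , λ { (here q) → here q ; (there q) → there (s q) }

  suffix : ∀ {E a b v} (w : Walk E a b) → v ∈ verts w → Σ (Walk E v b) λ w′ → verts w′ ⊆ verts w
  suffix w@(stop a)   (here refl) = w , id
  suffix w@(go _ _ _) (here refl) = w , id
  suffix (go a e w)   (there p) with suffix w p
  ... | w′ , s = w′ , there ∘ s

  Hits : List (A × A) → List A → List A → List A → Set
  Hits E S T Z = ∀ {a b} → a ∈ S → b ∈ T → (w : Walk E a b) → ∃ λ z → z ∈ verts w × z ∈ Z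

  record Linkage (E : List (A × A)) (S T : List A) (k : ℕ) : Set where
    field
      src dst : Fin k → A
      path    : ∀ i → Walk E (src i) (dst i)
      src∈    : ∀ i → src i ∈ S
      dst∈    : ∀ i → dst i ∈ T
      disj    : ∀ {i j v} → v ∈ verts (path i) → v ∈ verts (path j) → i ≡ j

  module _ {E : List (A × A)} {x y : A} where

    -- Cutting a walk before its first use of the new edge leaves an old walk to `x`; `lastUse` is
    -- the mirror image. This is how a separator found in `E` is shown to separate after the edge
    -- has been added.
    firstUse : ∀ {a b} (w : Walk ((x , y) ∷ E) a b) →
      (Σ (Walk E a b) λ w′ → verts w′ ⊆ verts w) ⊎ (Σ (Walk E a x) λ w′ → verts w′ ⊆ verts w)
    firstUse (stop a)               = inj₁ (stop a , id)
    firstUse (go a (here refl) w)   = inj₂ (stop a , λ { (here p) → here p })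
    firstUse (go a (there e) w) with firstUse w
    ... | inj₁ (w′ , s) = inj₁ (go a e w′ , λ { (here p) → here p ; (there p) → there (s p) })
    ... | inj₂ (w′ , s) = inj₂ (go a e w′ , λ { (here p) → here p ; (there p) → there (s p) })

    lastUse : ∀ {a b} (w : Walk ((x , y) ∷ E) a b) →
      (Σ (Walk E a b) λ w′ → verts w′ ⊆ verts w) ⊎ (Σ (Walk E y b) λ w′ → verts w′ ⊆ verts w)
    lastUse (stop a)   = inj₁ (stop a , id)
    lastUse (go a e w) with lastUse w
    lastUse (go a e w)           | inj₂ (w′ , s) = inj₂ (w′ , there ∘ s)
    lastUse (go a (here refl) w) | inj₁ (w′ , s) = inj₂ (w′ , there ∘ s)
    lastUse (go a (there e) w)   | inj₁ (w′ , s) =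
      inj₁ (go a e w′ , λ { (here p) → here p ; (there p) → there (s p) })

open Walks

module Menger {A : Set} (_≟ᴬ_ : DecidableEquality A) where

  open DecMem _≟ᴬ_ using (_∈?_)

  -- The last clause carries the content: every vertex before the end `t` is reached by a walk that
  -- avoids `T` altogether. In this form crossings of two linkages can be excluded.
  FirstHit : List (A × A) → List A → A → A → List A → Set
  FirstHit E T a t vs = Σ (Walk E a t) λ w → verts w ⊆ vs ×
    (∀ {v} → v ∈ verts w → v ≡ t ⊎ Σ (Walk E a v) λ w′ → ∀ {u} → u ∈ verts w′ → u ∉ T)

  firstHit : ∀ {E a b} T (w : Walk E a b) → b ∈ T → ∃ λ t → t ∈ T × FirstHit E T a t (verts w)
  firstHit T (stop a) b∈ = a , b∈ , stop a , id , λ { (here p) → inj₁ p }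
  firstHit T (go a e w) b∈ with a ∈? T
  ... | yes a∈ = a , a∈ , stop a , (λ { (here p) → here p }) , λ { (here p) → inj₁ p }
  ... | no a∉ with firstHit T w b∈
  ... | t , t∈ , w′ , s , f = t , t∈ , go a e w′ , (λ { (here p) → here p ; (there p) → there (s p) }) , f′
    where
    f′ : ∀ {v} → v ∈ a ∷ verts w′ → v ≡ t ⊎ Σ (Walk _ a v) λ w″ → ∀ {u} → u ∈ verts w″ → u ∉ T
    f′ (here refl) = inj₂ (stop a , λ { (here refl) → a∉ })
    f′ (there p) with f p
    ... | inj₁ q        = inj₁ q
    ... | inj₂ (w″ , g) = inj₂ (go a e w″ , λ { (here refl) → a∉ ; (there q) → g q })

  LastHit : List (A × A) → List A → A → A → List A → Set
  LastHit E T s b vs = Σ (Walk E s b) λ w → verts w ⊆ vs ×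
    (∀ {v} → v ∈ verts w → v ≡ s ⊎ Σ (Walk E v b) λ w′ → ∀ {u} → u ∈ verts w′ → u ∉ T)

  lastHit : ∀ {E a b} T (w : Walk E a b) →
    (∃ λ s → s ∈ T × LastHit E T s b (verts w)) ⊎ (∀ {u} → u ∈ verts w → u ∉ T)
  lastHit T (stop a) with a ∈? T
  ... | yes a∈ = inj₁ (a , a∈ , stop a , id , λ { (here p) → inj₁ p })
  ... | no a∉  = inj₂ λ { (here refl) → a∉ }
  lastHit T (go a e w) with lastHit T w
  ... | inj₁ (s , s∈ , w′ , sub , f) = inj₁ (s , s∈ , w′ , there ∘ sub , f)
  ... | inj₂ f with a ∈? T
  ... | no a∉  = inj₂ λ { (here refl) → a∉ ; (there p) → f p }
  ... | yes a∈ = inj₁ (a , a∈ , go a e w , id , λ { (here p) → inj₁ p ; (there p) →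
                    inj₂ (proj₁ (suffix w p) , f ∘ proj₂ (suffix w p)) })

  -- By counting, k disjoint paths ending in the k-set T meet T in their ends only.
  module Ends {k : ℕ} {T : List A} (len : length T ≡ k) (vs : Fin k → List A) (end : Fin k → A)
              (end∈ : ∀ i → end i ∈ T) (end∈vs : ∀ i → end i ∈ vs i)
              (dj : ∀ {i j v} → v ∈ vs i → v ∈ vs j → i ≡ j) where

    pos : Fin k → Fin k
    pos i = subst Fin len (index (end∈ i))

    at : Fin k → A
    at p = lookup T (subst Fin (sym len) p)

    subst-inv : ∀ {m} (e : m ≡ k) (p : Fin m) → subst Fin (sym e) (subst Fin e p) ≡ p
    subst-inv refl p = refl

    at-pos : ∀ i → at (pos i) ≡ end i
    at-pos i = trans (cong (lookup T) (subst-inv len (index (end∈ i)))) (sym (lookup-index (end∈ i)))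

    pos-inj : Injective _≡_ _≡_ pos
    pos-inj {i} {j} e = dj (end∈vs i) (subst (_∈ vs j) (trans (sym (at-pos j)) (trans (cong at (sym e)) (at-pos i))) (end∈vs j))

    who : Fin k → Fin k
    who p = proj₁ (injective⇒surjective pos pos-inj p)

    pos-who : ∀ p → pos (who p) ≡ p
    pos-who p = proj₂ (injective⇒surjective pos pos-inj p)

    end-who : ∀ p → end (who p) ≡ at p
    end-who p = trans (sym (at-pos (who p))) (cong at (pos-who p))

    who-inj : ∀ {p q} → who p ≡ who q → p ≡ q
    who-inj {p} {q} e = trans (sym (pos-who p)) (trans (cong pos e) (pos-who q))

    at-inj : ∀ {p q} → at p ≡ at q → p ≡ q
    at-inj {p} {q} e = who-inj (dj (end∈vs (who p))
      (subst (_∈ vs (who q)) (trans (end-who q) (trans (sym e) (sym (end-who p)))) (end∈vs (who q))))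

    unique-end : ∀ {i v} → v ∈ vs i → v ∈ T → v ≡ end i
    unique-end {i} {v} v∈ v∈T = trans v≡ (cong end (sym i≡))
      where
      p = subst Fin len (index v∈T)
      v≡ : v ≡ end (who p)
      v≡ = trans (lookup-index v∈T) (trans (cong (lookup T) (sym (subst-inv len (index v∈T)))) (sym (end-who p)))
      i≡ : i ≡ who p
      i≡ = dj v∈ (subst (_∈ vs (who p)) (sym v≡) (end∈vs (who p)))

  -- `P` ends in all of `x ∷ Z` and `Q` starts in all of `y ∷ Z`, by counting. Position 0 is joined
  -- through the new edge from `x` to `y`, position `p + 1` at the common vertex `lookup Z p`.
  module Combine {E : List (A × A)} {S T Z : List A} {x y : A}
                 (sep : Hits E S T Z)
                 (P : Linkage E S (x ∷ Z) (suc (length Z))) (Q : Linkage E (y ∷ Z) T (suc (length Z))) where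
    private
      module P = Linkage P
      module Q = Linkage Q
      module PE = Ends refl (verts ∘ P.path) P.dst P.dst∈ (target∈ ∘ P.path) P.disj
      module QE = Ends refl (verts ∘ Q.path) Q.src Q.src∈ (source∈ ∘ Q.path) Q.disj
      K = suc (length Z)

    abstract
     left : ∀ p → FirstHit E (x ∷ Z) (P.src (PE.who p)) (PE.at p) (verts (P.path (PE.who p)))
     left p with firstHit (x ∷ Z) (P.path (PE.who p)) (P.dst∈ (PE.who p))
     ... | t , t∈ , w , s , f with trans (PE.unique-end (s (target∈ w)) t∈) (PE.end-who p)
     ... | refl = w , s , f

     right : ∀ p → LastHit E (y ∷ Z) (QE.at p) (Q.dst (QE.who p)) (verts (Q.path (QE.who p)))
     right p with lastHit (y ∷ Z) (Q.path (QE.who p))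
     ... | inj₂ f = ⊥-elim (f (source∈ _) (Q.src∈ _))
     ... | inj₁ (t , t∈ , w , s , f) with trans (QE.unique-end (s (source∈ w)) t∈) (QE.end-who p)
     ... | refl = w , s , f

    noCross : ∀ {a b v} → a ∈ S → b ∈ T → (w : Walk E a v) (w′ : Walk E v b) →
      (∀ {u} → u ∈ verts w → u ∉ Z) → (∀ {u} → u ∈ verts w′ → u ∉ Z) → ⊥
    noCross a∈ b∈ w w′ f f′ with sep a∈ b∈ (w ++ʷ w′)
    ... | z , z∈ , z∈Z with verts-++ w w′ z∈
    ... | inj₁ q = f q z∈Z
    ... | inj₂ q = f′ q z∈Z

    x∉Z : x ∉ Z
    x∉Z x∈ with PE.at-inj {fzero} {fsuc (index x∈)} (lookup-index x∈)
    ... | ()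

    y∉Z : y ∉ Z
    y∉Z y∈ with QE.at-inj {fzero} {fsuc (index y∈)} (lookup-index y∈)
    ... | ()

    Lw : ∀ p → Walk E (P.src (PE.who p)) (PE.at p)
    Lw p = proj₁ (left p)
    Rw : ∀ p → Walk E (QE.at p) (Q.dst (QE.who p))
    Rw p = proj₁ (right p)

    OnLeft : Fin K → A → Set
    OnLeft p v = v ≡ PE.at p ⊎ Σ (Walk E (P.src (PE.who p)) v) λ w → ∀ {u} → u ∈ verts w → u ∉ x ∷ Z

    OnRight : Fin K → A → Set
    OnRight p v = v ≡ QE.at p ⊎ Σ (Walk E v (Q.dst (QE.who p))) λ w → ∀ {u} → u ∈ verts w → u ∉ y ∷ Z

    leftZ′ : ∀ {u} → OnLeft fzero u → u ∉ Z
    leftZ′ (inj₁ refl)    = x∉Z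
    leftZ′ (inj₂ (w , f)) = f (target∈ w) ∘ there

    leftZ : ∀ {u} → u ∈ verts (Lw fzero) → u ∉ Z
    leftZ p = leftZ′ (proj₂ (proj₂ (left fzero)) p)

    rightZ′ : ∀ {u} → OnRight fzero u → u ∉ Z
    rightZ′ (inj₁ refl)    = y∉Z
    rightZ′ (inj₂ (w , f)) = f (source∈ w) ∘ there

    rightZ : ∀ {u} → u ∈ verts (Rw fzero) → u ∉ Z
    rightZ p = rightZ′ (proj₂ (proj₂ (right fzero)) p)

    -- Vertices of the left paths before their ends are reached from `S` without meeting `Z`, and
    -- those of the right paths after their starts reach `T` without meeting `Z`. Since `Z`
    -- separates, paths at different positions stay apart.
    cross′ : ∀ p q {v} → OnLeft p v → OnRight q v → p ≡ q
    cross′ fzero    fzero    _ _ = refl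
    cross′ (fsuc p) (fsuc q) (inj₁ e) (inj₁ e′) = PE.at-inj {fsuc p} {fsuc q} (trans (sym e) e′)
    cross′ fzero    (fsuc q) (inj₁ refl) (inj₁ e) = ⊥-elim (x∉Z (subst (_∈ Z) (sym e) (∈-lookup q)))
    cross′ (fsuc p) fzero    (inj₁ e) (inj₁ refl) = ⊥-elim (y∉Z (subst (_∈ Z) (sym e) (∈-lookup p)))
    cross′ (fsuc p) q        (inj₁ refl) (inj₂ (w , f)) = ⊥-elim (f (source∈ w) (there (∈-lookup p)))
    cross′ fzero    q        (inj₁ refl) (inj₂ (w , f)) =
      ⊥-elim (noCross (P.src∈ _) (Q.dst∈ _) (Lw fzero) w leftZ (λ u∈ → f u∈ ∘ there))
    cross′ p        (fsuc q) (inj₂ (w , f)) (inj₁ refl) = ⊥-elim (f (target∈ w) (there (∈-lookup q)))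
    cross′ p        fzero    (inj₂ (w , f)) (inj₁ refl) =
      ⊥-elim (noCross (P.src∈ _) (Q.dst∈ _) w (Rw fzero) (λ u∈ → f u∈ ∘ there) rightZ)
    cross′ p        q        (inj₂ (w , f)) (inj₂ (w′ , f′)) =
      ⊥-elim (noCross (P.src∈ _) (Q.dst∈ _) w w′ (λ u∈ → f u∈ ∘ there) (λ u∈ → f′ u∈ ∘ there))

    cross : ∀ p q {v} → v ∈ verts (Lw p) → v ∈ verts (Rw q) → p ≡ q
    cross p q v∈ v∈′ = cross′ p q (proj₂ (proj₂ (left p)) v∈) (proj₂ (proj₂ (right q)) v∈′)

    join : ∀ p → Σ (Walk ((x , y) ∷ E) (P.src (PE.who p)) (Q.dst (QE.who p))) λ w →
      ∀ {v} → v ∈ verts w → v ∈ verts (Lw p) ⊎ v ∈ verts (Rw p)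
    join fzero = weaken there (Lw fzero) ++ʷ go x (here refl) (weaken there (Rw fzero)) , f
      where
      f : ∀ {v} → v ∈ verts (weaken there (Lw fzero) ++ʷ go x (here refl) (weaken there (Rw fzero))) →
          v ∈ verts (Lw fzero) ⊎ v ∈ verts (Rw fzero)
      f p with verts-++ (weaken there (Lw fzero)) _ p
      ... | inj₁ q           = inj₁ (subst (_ ∈_) (verts-weaken there (Lw fzero)) q)
      ... | inj₂ (here refl) = inj₁ (target∈ (Lw fzero))
      ... | inj₂ (there q)   = inj₂ (subst (_ ∈_) (verts-weaken there (Rw fzero)) q)
    join (fsuc p) = weaken there (Lw (fsuc p)) ++ʷ weaken there (Rw (fsuc p)) , f
      where
      f : ∀ {v} → v ∈ verts (weaken there (Lw (fsuc p)) ++ʷ weaken there (Rw (fsuc p))) →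
          v ∈ verts (Lw (fsuc p)) ⊎ v ∈ verts (Rw (fsuc p))
      f q with verts-++ (weaken there (Lw (fsuc p))) _ q
      ... | inj₁ r = inj₁ (subst (_ ∈_) (verts-weaken there (Lw (fsuc p))) r)
      ... | inj₂ r = inj₂ (subst (_ ∈_) (verts-weaken there (Rw (fsuc p))) r)

    combined : Linkage ((x , y) ∷ E) S T K
    combined = record
      { src = P.src ∘ PE.who ; dst = Q.dst ∘ QE.who ; path = proj₁ ∘ join
      ; src∈ = P.src∈ ∘ PE.who ; dst∈ = Q.dst∈ ∘ QE.who ; disj = dj }
      where
      dj : ∀ {i j v} → v ∈ verts (proj₁ (join i)) → v ∈ verts (proj₁ (join j)) → i ≡ j
      dj {i} {j} v∈ v∈′ with proj₂ (join i) v∈ | proj₂ (join j) v∈′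
      ... | inj₁ p | inj₁ q = PE.who-inj (P.disj (proj₁ (proj₂ (left i)) p) (proj₁ (proj₂ (left j)) q))
      ... | inj₂ p | inj₂ q = QE.who-inj (Q.disj (proj₁ (proj₂ (right i)) p) (proj₁ (proj₂ (right j)) q))
      ... | inj₁ p | inj₂ q = cross i j p q
      ... | inj₂ p | inj₁ q = sym (cross j i q p)

  weakenLinkage : ∀ {E E′} {S T : List A} {k} → E ⊆ E′ → Linkage E S T k → Linkage E′ S T k
  weakenLinkage {E} {E′} s L = record
    { src = src ; dst = dst ; path = weaken s ∘ path ; src∈ = src∈ ; dst∈ = dst∈
    ; disj = λ {i} {j} p q → disj (subst (_ ∈_) (verts-weaken s (path i)) p) (subst (_ ∈_) (verts-weaken s (path j)) q) }
    where
    open Linkage L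

  lookup-inj : ∀ {xs : List A} → Unique xs → ∀ i j → lookup xs i ≡ lookup xs j → i ≡ j
  lookup-inj (a ∷ u) fzero    fzero    e = refl
  lookup-inj (a ∷ u) fzero    (fsuc j) e = ⊥-elim (All.lookup a (∈-lookup j) e)
  lookup-inj (a ∷ u) (fsuc i) fzero    e = ⊥-elim (All.lookup a (∈-lookup i) (sym e))
  lookup-inj (a ∷ u) (fsuc i) (fsuc j) e = cong fsuc (lookup-inj u i j e)

  mengerBase : ∀ S T k → Linkage [] S T k ⊎ (∃ λ Z → length Z < k × Hits [] S T Z)
  mengerBase S T k = decide (k ≤? length both)
    where
    both = deduplicate _≟ᴬ_ (filter (_∈? T) S)
    decide : Dec (k ≤ length both) → Linkage [] S T k ⊎ (∃ λ Z → length Z < k × Hits [] S T Z)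
    decide (no k≰) = inj₂ (both , ≰⇒> k≰ ,
      λ { a∈ b∈ (stop a) → a , here refl , ∈-deduplicate⁺ _≟ᴬ_ (∈-filter⁺ (_∈? T) a∈ b∈) })
    decide (yes k≤) = inj₁ record
      { src = f ; dst = f ; path = λ i → stop (f i) ; src∈ = proj₁ ∘ f∈ ; dst∈ = proj₂ ∘ f∈
      ; disj = λ { (here p) (here q) → f-inj (trans (sym p) q) } }
      where
      f : Fin k → A
      f i = lookup both (inject≤ i k≤)
      f∈ : ∀ i → f i ∈ S × f i ∈ T
      f∈ i = ∈-filter⁻ (_∈? T) {xs = S} (∈-deduplicate⁻ _≟ᴬ_ (filter (_∈? T) S) (∈-lookup {xs = both} (inject≤ i k≤)))
      f-inj : ∀ {i j} → f i ≡ f j → i ≡ j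
      f-inj {i} {j} e = Finₚ.inject≤-injective k≤ k≤ i j (lookup-inj (deduplicate-! _≟ᴬ_ (filter (_∈? T) S)) _ _ e)

  -- Göring's induction on the number of edges.
  menger : ∀ E S T k → Linkage E S T k ⊎ (∃ λ Z → length Z < k × Hits E S T Z)
  menger [] S T k = mengerBase S T k
  menger ((x , y) ∷ E) S T k with menger E S T k
  ... | inj₁ L = inj₁ (weakenLinkage there L)
  ... | inj₂ (Z , Z<k , sep) with suc (length Z) <? k
  ... | yes lt = inj₂ (x ∷ Z , lt , hit)
    where
    hit : Hits ((x , y) ∷ E) S T (x ∷ Z)
    hit a∈ b∈ w with firstUse w
    ... | inj₂ (w′ , s) = x , s (target∈ w′) , here refl
    ... | inj₁ (w′ , s) with sep a∈ b∈ w′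
    ... | z , p , q = z , s p , there q
  ... | no ¬lt with ≤-antisym Z<k (≮⇒≥ ¬lt)
  -- Now `k` is `suc (length Z)`. Every walk has an old initial part reaching `x ∷ Z` and an old
  -- final part leaving from `y ∷ Z`; so fewer than `k` vertices that separate `S` from `x ∷ Z`, or
  -- `y ∷ Z` from `T`, in `E` are the separator sought.
  ... | refl with menger E S (x ∷ Z) (suc (length Z))
  ... | inj₂ (Z₁ , Z₁< , sep₁) = inj₂ (Z₁ , Z₁< , hit)
    where
    hit : Hits ((x , y) ∷ E) S T Z₁
    hit a∈ b∈ w with firstUse w
    hit a∈ b∈ w | inj₂ (w′ , s) with sep₁ a∈ (here refl) w′
    ... | z , p , q = z , s p , q
    hit a∈ b∈ w | inj₁ (w′ , s) with sep a∈ b∈ w′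
    ... | z , p , q with prefix w′ p
    ... | w″ , s′ with sep₁ a∈ (there q) w″
    ... | z′ , p′ , q′ = z′ , s (s′ p′) , q′
  ... | inj₁ P with menger E (y ∷ Z) T (suc (length Z))
  ... | inj₁ Q = inj₁ (Combine.combined sep P Q)
  ... | inj₂ (Z₂ , Z₂< , sep₂) = inj₂ (Z₂ , Z₂< , hit)
    where
    hit : Hits ((x , y) ∷ E) S T Z₂
    hit a∈ b∈ w with lastUse w
    hit a∈ b∈ w | inj₂ (w′ , s) with sep₂ (here refl) b∈ w′
    ... | z , p , q = z , s p , q
    hit a∈ b∈ w | inj₁ (w′ , s) with sep a∈ b∈ w′
    ... | z , p , q with suffix w′ p
    ... | w″ , s′ with sep₂ (there q) b∈ w″
    ... | z′ , p′ , q′ = z′ , s (s′ p′) , q′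

-- Components, balls and connected vertex sets

module Components {A : Set} (_≟ᴬ_ : DecidableEquality A) where

  -- Union-find along the list: the edge from `x` to `y` sends the class of `x` to the
  -- representative of `y`. Connectedness thus becomes a decidable equality of representatives.
  comp : List (A × A) → A → A
  comp []            v = v
  comp ((x , y) ∷ F) v with comp F v ≟ᴬ comp F x
  ... | yes _ = comp F y
  ... | no  _ = comp F v

  comp-cong : ∀ e F {u v} → comp F u ≡ comp F v → comp (e ∷ F) u ≡ comp (e ∷ F) v
  comp-cong (x , y) F {u} {v} eq with comp F u ≟ᴬ comp F x | comp F v ≟ᴬ comp F x
  ... | yes _ | yes _ = refl
  ... | no _  | no _  = eq
  ... | yes p | no ¬q = ⊥-elim (¬q (trans (sym eq) p))
  ... | no ¬p | yes q = ⊥-elim (¬p (trans eq q))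

  comp-edge : ∀ {F u v} → (u , v) ∈ F → comp F u ≡ comp F v
  comp-edge {e ∷ F} (there p) = comp-cong e F (comp-edge p)
  comp-edge {(x , y) ∷ F} (here refl) with comp F x ≟ᴬ comp F x | comp F y ≟ᴬ comp F x
  ... | yes _ | yes _ = refl
  ... | yes _ | no _  = refl
  ... | no ¬p | _     = ⊥-elim (¬p refl)

  comp-walk : ∀ {E} → (∀ {u v} → (u , v) ∈ E → (v , u) ∈ E) → ∀ F → F ⊆ E → ∀ {u v} → comp F u ≡ comp F v → Walk E u v
  comp-walk s [] sub refl = stop _
  comp-walk s ((x , y) ∷ F) sub {u} {v} eq with comp F u ≟ᴬ comp F x | comp F v ≟ᴬ comp F x
  ... | yes p | yes q = comp-walk s F (sub ∘ there) (trans p (sym q))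
  ... | no _  | no _  = comp-walk s F (sub ∘ there) eq
  ... | yes p | no _  = comp-walk s F (sub ∘ there) p ++ʷ go x (sub (here refl)) (comp-walk s F (sub ∘ there) eq)
  ... | no _  | yes q = comp-walk s F (sub ∘ there) eq ++ʷ go y (s (sub (here refl))) (comp-walk s F (sub ∘ there) (sym q))

module Sets (G : Graph) where

  infix 4 _~_ _~?_

  -- Equal or adjacent: branch sets of an induced minor must be disjoint and have no edges between
  -- them unless prescribed, and with this relation `Touch` treats both conditions at once.
  _~_ : V G → V G → Set
  u ~ v = u ≡ v ⊎ adj G u v ≡ true

  _~?_ : ∀ u v → Dec (u ~ v)
  u ~? v = (u ≟ v) ⊎-dec (adj G u v Boolₚ.≟ true)

  adj-symm : ∀ {u v} → adj G u v ≡ true → adj G v u ≡ true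
  adj-symm {u} {v} e = trans (adj-sym G v u) e

  adj-≢ : ∀ {u v} → adj G u v ≡ true → u ≢ v
  adj-≢ {u} e refl with trans (sym e) (adj-irrefl G u)
  ... | ()

  ~-sym : ∀ {u v} → u ~ v → v ~ u
  ~-sym (inj₁ p) = inj₁ (sym p)
  ~-sym (inj₂ p) = inj₂ (adj-symm p)

  infix 4 _∈?_
  _∈?_ : ∀ (v : V G) vs → Dec (v ∈ vs)
  _∈?_ = DecMem._∈?_ _≟_

  nb nb⁺ : V G → List (V G)
  nb u = filterᵇ (adj G u) (allFin (order G))
  nb⁺ u = u ∷ nb u

  ∈-nb⁺ : ∀ {u v} → u ~ v → v ∈ nb⁺ u
  ∈-nb⁺ (inj₁ refl) = here refl
  ∈-nb⁺ {u} {v} (inj₂ e) = there (∈-filter⁺ (Boolₚ.T? ∘ adj G u) (∈-allFin v) (Equivalence.from Boolₚ.T-≡ e))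

  ∈-nb⁺⁻ : ∀ {u v} → v ∈ nb⁺ u → u ~ v
  ∈-nb⁺⁻ (here p) = inj₁ (sym p)
  ∈-nb⁺⁻ {u} (there p) = inj₂ (Equivalence.to Boolₚ.T-≡ (proj₂ (∈-filter⁻ (Boolₚ.T? ∘ adj G u) {xs = allFin (order G)} p)))

  abstract
    ball : ℕ → V G → List (V G)
    ball zero    u = u ∷ []
    ball (suc k) u = concatMap nb⁺ (ball k u)

    ball-0 : ∀ {u} → u ∈ ball 0 u
    ball-0 = here refl

    ball-0⁻ : ∀ {u v} → v ∈ ball 0 u → v ≡ u
    ball-0⁻ (here p) = p

    ball-step : ∀ k {u v w} → v ∈ ball k u → v ~ w → w ∈ ball (suc k) u
    ball-step k v∈ e = ∈-concatMap nb⁺ v∈ (∈-nb⁺ e)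

    ball-step⁻ : ∀ k {u w} → w ∈ ball (suc k) u → ∃ λ v → v ∈ ball k u × v ~ w
    ball-step⁻ k {u} w∈ with ∈-concatMap⁻′ nb⁺ (ball k u) w∈
    ... | v , v∈ , e = v , v∈ , ∈-nb⁺⁻ e

    ball-length : ∀ b → (∀ u → length (nb⁺ u) ≤ b) → ∀ k u → length (ball k u) ≤ b ^ k
    ball-length b h zero    u = ≤-refl
    ball-length b h (suc k) u = ≤-trans (length-concatMap-≤ nb⁺ b (ball k u) (λ _ → h _))
      (≤-trans (*-monoˡ-≤ b (ball-length b h k u)) (≤-reflexive (*-comm (b ^ k) b)))

  ball-refl : ∀ k {u} → u ∈ ball k u
  ball-refl zero    = ball-0
  ball-refl (suc k) = ball-step k (ball-refl k) (inj₁ refl)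

  ball-trans : ∀ j k {u v w} → v ∈ ball j u → w ∈ ball k v → w ∈ ball (k + j) u
  ball-trans j zero    v∈ w∈ = subst (_∈ ball j _) (sym (ball-0⁻ w∈)) v∈
  ball-trans j (suc k) v∈ w∈ with ball-step⁻ k w∈
  ... | w′ , w′∈ , e = ball-step (k + j) (ball-trans j k v∈ w′∈) e

  ball-mono : ∀ {j k u v} → j ≤ k → v ∈ ball j u → v ∈ ball k u
  ball-mono {j} {k} {u} {v} le v∈ = subst (λ m → v ∈ ball m u) (m∸n+n≡m le) (ball-trans j (k ∸ j) v∈ (ball-refl (k ∸ j)))

  ball-1 : ∀ {u v} → u ~ v → v ∈ ball 1 u
  ball-1 = ball-step 0 ball-0

  ball-sym : ∀ k {u v} → v ∈ ball k u → u ∈ ball k v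
  ball-sym zero    v∈ = subst (_∈ ball 0 _) (ball-0⁻ v∈) ball-0
  ball-sym (suc k) {u} {v} v∈ with ball-step⁻ k v∈
  ... | v′ , v′∈ , e = subst (λ m → u ∈ ball m v) (+-comm k 1) (ball-trans 1 k (ball-1 (~-sym e)) (ball-sym k v′∈))

  module _ {P : V G → Set} where

    reach-start : ∀ {u v} → Reach G P u v → P u
    reach-start (here p)     = p
    reach-start (step r _ _) = reach-start r

    reach-end : ∀ {u v} → Reach G P u v → P v
    reach-end (here p)     = p
    reach-end (step _ _ p) = p

    reach-trans : ∀ {u v w} → Reach G P u v → Reach G P v w → Reach G P u w
    reach-trans r (here _)     = r
    reach-trans r (step s e p) = step (reach-trans r s) e p

    reach-edge : ∀ {u v} → P u → P v → u ~ v → Reach G P u v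
    reach-edge p q (inj₁ refl) = here p
    reach-edge p q (inj₂ e)    = step (here p) e q

    reach-sym : ∀ {u v} → Reach G P u v → Reach G P v u
    reach-sym (here p)     = here p
    reach-sym (step r e p) = reach-trans (reach-edge p (reach-end r) (inj₂ (adj-symm e))) (reach-sym r)

  reach-mono : ∀ {P Q : V G → Set} → (∀ {v} → P v → Q v) → ∀ {u v} → Reach G P u v → Reach G Q u v
  reach-mono f (here p)     = here (f p)
  reach-mono f (step r e p) = step (reach-mono f r) e (f p)

  Conn : List (V G) → Set
  Conn B = ∀ {u v} → u ∈ B → v ∈ B → Reach G (_∈ B) u v

  Touch : List (V G) → List (V G) → Set
  Touch A B = ∃₂ λ u v → u ∈ A × v ∈ B × u ~ v

  touch? : ∀ A B → Dec (Touch A B)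
  touch? A B with any? (λ u → any? (λ v → u ~? v) B) A
  ... | yes p with find p
  ... | u , u∈ , q with find q
  ... | v , v∈ , e = yes (u , v , u∈ , v∈ , e)
  touch? A B | no ¬p = no λ { (u , v , u∈ , v∈ , e) → ¬p (lose u∈ (lose v∈ e)) }

  touch-sym : ∀ {A B} → Touch A B → Touch B A
  touch-sym (u , v , u∈ , v∈ , e) = v , u , v∈ , u∈ , ~-sym e

  touch-mono : ∀ {A A′ B B′} → A ⊆ A′ → B ⊆ B′ → Touch A B → Touch A′ B′
  touch-mono f g (u , v , u∈ , v∈ , e) = u , v , f u∈ , g v∈ , e

  conn-++ : ∀ {A B} → Conn A → Conn B → Touch A B → Conn (A ++ B)
  conn-++ {A} {B} cA cB (a , b , a∈ , b∈ , e) p q = reach-trans (toA p) (reach-sym (toA q))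
    where
    toA : ∀ {u} → u ∈ A ++ B → Reach G (_∈ A ++ B) u a
    toA p with ∈-++⁻ A p
    ... | inj₁ u∈ = reach-mono ∈-++⁺ˡ (cA u∈ a∈)
    ... | inj₂ u∈ = reach-trans (reach-mono (∈-++⁺ʳ A) (cB u∈ b∈)) (reach-edge (∈-++⁺ʳ A b∈) (∈-++⁺ˡ a∈) (~-sym e))

  conn-star : {I : Set} {A : List (V G)} (f : I → List (V G)) (is : List I) → Conn A →
    (∀ {i} → i ∈ is → Conn (f i)) → (∀ {i} → i ∈ is → Touch A (f i)) → Conn (A ++ concatMap f is)
  conn-star {A = A} f is cA cf t {u} {v} p q with find-base p | find-base q
    where
    find-base : ∀ {u} → u ∈ A ++ concatMap f is → ∃ λ a → a ∈ A × Reach G (_∈ A ++ concatMap f is) u a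
    find-base {u} p with ∈-++⁻ A p
    ... | inj₁ u∈ = u , u∈ , here p
    ... | inj₂ u∈ with ∈-concatMap⁻′ f is u∈
    ... | i , i∈ , u∈f with t i∈
    ... | a , b , a∈ , b∈ , e = a , a∈ , reach-trans (reach-mono emb (cf i∈ u∈f b∈)) (reach-edge (emb b∈) (∈-++⁺ˡ a∈) (~-sym e))
      where
      emb : ∀ {w} → w ∈ f i → w ∈ A ++ concatMap f is
      emb w∈ = ∈-++⁺ʳ A (∈-concatMap f i∈ w∈)
  ... | a , a∈ , r | b , b∈ , s = reach-trans r (reach-trans (reach-mono ∈-++⁺ˡ (cA a∈ b∈)) (reach-sym s))

  abstract
    edges : List (V G) → List (V G × V G)
    edges U = filter (λ (u , v) → adj G u v Boolₚ.≟ true) (cartesianProduct U U)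

    ∈-edges : ∀ {U u v} → u ∈ U → v ∈ U → adj G u v ≡ true → (u , v) ∈ edges U
    ∈-edges u∈ v∈ e = ∈-filter⁺ (λ (u , v) → adj G u v Boolₚ.≟ true) (∈-cartesianProduct⁺ u∈ v∈) e

    ∈-edges⁻ : ∀ {U u v} → (u , v) ∈ edges U → u ∈ U × v ∈ U × adj G u v ≡ true
    ∈-edges⁻ {U} p with ∈-filter⁻ (λ (u , v) → adj G u v Boolₚ.≟ true) {xs = cartesianProduct U U} p
    ... | q , e with ∈-cartesianProduct⁻ U U q
    ... | u∈ , v∈ = u∈ , v∈ , e

  edges-sym : ∀ {U u v} → (u , v) ∈ edges U → (v , u) ∈ edges U
  edges-sym p with ∈-edges⁻ p
  ... | u∈ , v∈ , e = ∈-edges v∈ u∈ (adj-symm e)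

  verts-⊆ : ∀ {U a b} (w : Walk (edges U) a b) → a ∈ U → verts w ⊆ U
  verts-⊆ (stop a)   a∈ (here refl) = a∈
  verts-⊆ (go a e w) a∈ (here refl) = a∈
  verts-⊆ (go a e w) a∈ (there p)   = verts-⊆ w (proj₁ (proj₂ (∈-edges⁻ e))) p

  walk-reach : ∀ {U a b} (w : Walk (edges U) a b) → ∀ {v} → v ∈ verts w → Reach G (_∈ verts w) a v
  walk-reach (stop a)   (here refl) = here (here refl)
  walk-reach (go a e w) (here refl) = here (here refl)
  walk-reach (go a e w) (there p)   = reach-trans
    (reach-edge (here refl) (there (source∈ w)) (inj₂ (proj₂ (proj₂ (∈-edges⁻ e)))))
    (reach-mono there (walk-reach w p))

  walk-conn : ∀ {U a b} (w : Walk (edges U) a b) → Conn (verts w)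
  walk-conn w p q = reach-trans (reach-sym (walk-reach w p)) (walk-reach w q)

  reach-walk : ∀ {U a b} → Reach G (_∈ U) a b → Walk (edges U) a b
  reach-walk (here _) = stop _
  reach-walk (step r e p) = reach-walk r ++ʷ go _ (∈-edges (reach-end r) p e) (stop _)

abstract
  ballBound : ℕ → ℕ → ℕ
  ballBound Δ k = suc Δ ^ k

module Degree (G : Graph) (Δ : ℕ) (deg≤ : MaxDegree≤ G Δ) where
  open Sets G

  nb⁺-≤ : ∀ u → length (nb⁺ u) ≤ suc Δ
  nb⁺-≤ u = s≤s (deg≤ u)

  abstract
    ball-≤ : ∀ k u → length (ball k u) ≤ ballBound Δ k
    ball-≤ = ball-length (suc Δ) nb⁺-≤

-- Linkages of pairwise non-adjacent paths

module CleanMenger (G : Graph) (Δ : ℕ) (deg≤ : MaxDegree≤ G Δ) where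
  open Sets G
  open Degree G Δ deg≤

  Induced : ∀ {U a b} → Walk (edges U) a b → Set
  Induced (stop a)       = ⊤
  Induced (go a {b} e w) = a ∉ verts w × (∀ {v} → v ∈ verts w → adj G a v ≡ true → v ≡ b) × Induced w

  no-loop : ∀ {a} → adj G a a ≡ true → ⊥
  no-loop e = adj-≢ e refl

  induced-suffix : ∀ {U a b v} (w : Walk (edges U) a b) → Induced w → v ∈ verts w →
    Σ (Walk (edges U) v b) λ w′ → Induced w′ × verts w′ ⊆ verts w
  induced-suffix w@(stop a)   iw (here refl) = w , iw , id
  induced-suffix w@(go _ _ _) iw (here refl) = w , iw , id
  induced-suffix (go a e w) (_ , _ , iw) (there p) with induced-suffix w iw p
  ... | w′ , iw′ , s = w′ , iw′ , there ∘ s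

  lastNeighbour : ∀ {U c b} a (w : Walk (edges U) c b) → Induced w →
    (∀ {v} → v ∈ verts w → adj G a v ≢ true) ⊎
    (∃ λ v → adj G a v ≡ true × Σ (Walk (edges U) v b) λ w′ → Induced w′ × verts w′ ⊆ verts w ×
      (∀ {u} → u ∈ verts w′ → adj G a u ≡ true → u ≡ v))
  lastNeighbour a (stop c) iw with adj G a c Boolₚ.≟ true
  ... | yes e = inj₂ (c , e , stop c , tt , id , λ { (here p) _ → p })
  ... | no ¬e = inj₁ λ { (here refl) → ¬e }
  lastNeighbour a (go c e w) iw@(_ , _ , iw′) with lastNeighbour a w iw′
  ... | inj₂ (v , e′ , w′ , i , s , f) = inj₂ (v , e′ , w′ , i , there ∘ s , f)
  ... | inj₁ none with adj G a c Boolₚ.≟ true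
  ... | yes e′ = inj₂ (c , e′ , go c e w , iw , id , λ { (here p) _ → p ; (there p) q → ⊥-elim (none p q) })
  ... | no ¬e′ = inj₁ λ { (here refl) → ¬e′ ; (there p) → none p }

  -- Shortcut from `a` to its last neighbour on the remainder, already made induced; no vertex after
  -- that one is adjacent to `a`.
  induce : ∀ {U a b} (w : Walk (edges U) a b) → Σ (Walk (edges U) a b) λ w′ → Induced w′ × verts w′ ⊆ verts w
  induce (stop a) = stop a , tt , id
  induce {U} (go a {c} e w) with induce w
  ... | w′ , iw′ , s with a ∈? verts w′
  ... | yes a∈ with induced-suffix w′ iw′ a∈
  ... | w″ , iw″ , s′ = w″ , iw″ , there ∘ s ∘ s′
  induce {U} (go a {c} e w) | w′ , iw′ , s | no a∉ with lastNeighbour a w′ iw′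
  ... | inj₁ none = ⊥-elim (none (source∈ w′) (proj₂ (proj₂ (∈-edges⁻ e))))
  ... | inj₂ (v , e′ , w″ , iw″ , s′ , f) =
    go a (∈-edges (proj₁ (∈-edges⁻ e)) (verts-⊆ w (proj₁ (proj₂ (∈-edges⁻ e))) (s (s′ (source∈ w″)))) e′) w″ ,
    (a∉ ∘ s′ , f , iw″) , λ { (here p) → here p ; (there p) → there (s (s′ p)) }

  TwoNeighbours : List (V G) → V G → Set
  TwoNeighbours W v = ∃₂ λ p q → ∀ {x} → x ∈ W → adj G v x ≡ true → x ≡ p ⊎ x ≡ q

  induced-source : ∀ {U a b} (w : Walk (edges U) a b) → Induced w →
    ∃ λ p → ∀ {x} → x ∈ verts w → adj G a x ≡ true → x ≡ p
  induced-source (stop a) _ = a , λ { (here p) _ → p }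
  induced-source (go a {b} e w) (_ , f , _) = b , λ { (here refl) q → ⊥-elim (no-loop q) ; (there p) q → f p q }

  induced-two : ∀ {U a b v} (w : Walk (edges U) a b) → Induced w → v ∈ verts w → TwoNeighbours (verts w) v
  induced-two (stop a) _ (here refl) = a , a , λ { (here p) _ → inj₁ p }
  induced-two w@(go a e w′) iw (here refl) with induced-source w iw
  ... | p , f = p , p , λ x∈ q → inj₁ (f x∈ q)
  induced-two {v = v} (go a {b} e w) (_ , f , iw) (there v∈) with v ≟ b
  ... | yes refl with induced-source w iw
  ... | p , g = a , p , λ { (here r) _ → inj₁ r ; (there r) q → inj₂ (g r q) }
  induced-two (go a e w) (_ , f , iw) (there v∈) | no v≢b with induced-two w iw v∈
  ... | p , q , g = p , q , λ { (here refl) r → ⊥-elim (v≢b (f v∈ (adj-symm r))) ; (there x∈) r → g x∈ r }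

  -- Once `TwoNeighbours` holds, the two neighbours on the path are all neighbours of an inner
  -- vertex, and none is left for another path.
  interior : ∀ {U a b v} (w : Walk (edges U) a b) → Induced w → v ∈ verts w →
    v ≡ a ⊎ v ≡ b ⊎ (∃₂ λ p q → p ∈ verts w × q ∈ verts w × p ≢ q × adj G v p ≡ true × adj G v q ≡ true)
  interior (stop a) _ (here p) = inj₁ p
  interior (go a e w) _ (here p) = inj₁ p
  interior (go a e w) (a∉ , _ , iw) (there v∈) with interior w iw v∈
  ... | inj₂ (inj₁ p) = inj₂ (inj₁ p)
  ... | inj₂ (inj₂ (p , q , p∈ , q∈ , r)) = inj₂ (inj₂ (p , q , there p∈ , there q∈ , r))
  interior (go a e (stop c)) _ (there v∈) | inj₁ p = inj₂ (inj₁ p)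
  interior (go a e (go c e′ w)) (a∉ , _ , _) (there v∈) | inj₁ refl =
    inj₂ (inj₂ (a , _ , here refl , there (there (source∈ w)) , (λ { refl → a∉ (there (source∈ w)) }) ,
      adj-symm (proj₂ (proj₂ (∈-edges⁻ e))) , proj₂ (proj₂ (∈-edges⁻ e′))))

  restrict : ∀ {U U′ a b} (w : Walk (edges U) a b) → verts w ⊆ U′ → Σ (Walk (edges U′) a b) λ w′ → verts w′ ≡ verts w
  restrict (stop a) s = stop a , refl
  restrict (go a e w) s with restrict w (s ∘ there)
  ... | w′ , eq = go a (∈-edges (s (here refl)) (s (there (source∈ w))) (proj₂ (proj₂ (∈-edges⁻ e)))) w′ , cong (a ∷_) eq

  edgeWalk : ∀ {U a b} → a ∈ U → b ∈ U → a ~ b → Σ (Walk (edges U) a b) λ w → ∀ {u} → u ∈ verts w → u ≡ a ⊎ u ≡ b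
  edgeWalk a∈ b∈ (inj₁ refl) = stop _ , λ { (here p) → inj₁ p }
  edgeWalk a∈ b∈ (inj₂ e) = go _ (∈-edges a∈ b∈ e) (stop _) , λ { (here p) → inj₁ p ; (there (here p)) → inj₂ p }

  -- A trivial walk over `edges U` may sit at any vertex, so membership of the sources in `U` is
  -- recorded separately.
  record LinkageIn (U A B : List (V G)) (k : ℕ) : Set where
    field
      linkage : Linkage (edges U) A B k
    open Linkage linkage public
    field
      src∈U : ∀ i → src i ∈ U

  -- Contracting the stars N[v], v ∈ I, costs a factor Δ + 1 in Menger's theorem. Lifting
  -- the paths back to induced paths leaves all neighbours of v ∈ I on one of them, so that
  -- v has at most two; once this holds for all v, distinct paths are not adjacent.
  module Contract (U I : List (V G)) (far : ∀ {u v v′} → v ∈ I → v′ ∈ I → u ~ v → u ~ v′ → v ≡ v′) where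

    Centre : V G → V G → Set
    Centre u v = v ∈ I × v ∈ U × u ~ v

    centre? : ∀ u → (∃ λ v → Centre u v) ⊎ (∀ {v} → ¬ Centre u v)
    centre? u with any? (λ v → (v ∈? U) ×-dec (u ~? v)) I
    ... | yes p with find p
    ... | v , v∈I , v∈U , e = inj₁ (v , v∈I , v∈U , e)
    centre? u | no ¬p = inj₂ λ (v∈I , v∈U , e) → ¬p (lose v∈I (v∈U , e))

    cell : V G → V G
    cell u with centre? u
    ... | inj₁ (v , _) = v
    ... | inj₂ _       = u

    cell-spec : ∀ u → Centre u (cell u) ⊎ (cell u ≡ u × ∀ {v} → ¬ Centre u v)
    cell-spec u with centre? u
    ... | inj₁ (v , c) = inj₁ c
    ... | inj₂ none    = inj₂ (refl , none)

    cell-centre : ∀ {u v} → Centre u v → cell u ≡ v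
    cell-centre {u} c@(v∈I , _ , e) with cell-spec u
    ... | inj₁ (c∈I , _ , e′) = far c∈I v∈I e′ e
    ... | inj₂ (_ , none)     = ⊥-elim (none c)

    ~cell : ∀ u → u ~ cell u
    ~cell u with cell-spec u
    ... | inj₁ (_ , _ , e) = e
    ... | inj₂ (e , _)     = inj₁ (sym e)

    E′ : List (V G × V G)
    E′ = map (λ (u , v) → cell u , cell v) (edges U)

    mapWalk : ∀ {a b} (w : Walk (edges U) a b) → Σ (Walk E′ (cell a) (cell b)) λ w′ →
      ∀ {z} → z ∈ verts w′ → ∃ λ u → u ∈ verts w × z ≡ cell u
    mapWalk (stop a) = stop _ , λ { (here p) → a , here refl , p }
    mapWalk (go a e w) with mapWalk w
    ... | w′ , f = go _ (∈-map⁺ _ e) w′ , λ { (here p) → a , here refl , p ;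
                     (there p) → let u , u∈ , eq = f p in u , there u∈ , eq }

    -- A cell is a single vertex or part of a star, whose centre joins any two of its vertices.
    intra : ∀ {a b} → a ∈ U → b ∈ U → cell a ≡ cell b → Σ (Walk (edges U) a b) λ w → ∀ {u} → u ∈ verts w → cell u ≡ cell a
    intra {a} {b} a∈ b∈ eq with cell-spec a | cell-spec b
    ... | inj₁ (c∈I , c∈U , e) | _ with edgeWalk a∈ c∈U e | edgeWalk c∈U b∈ (~-sym (subst (b ~_) (sym eq) (~cell b)))
    ... | w , f | w′ , f′ = w ++ʷ w′ , g
      where
      centre-eq : cell (cell a) ≡ cell a
      centre-eq = cell-centre (c∈I , c∈U , inj₁ refl)
      h : ∀ {u} → u ≡ a ⊎ u ≡ cell a ⊎ u ≡ b → cell u ≡ cell a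
      h (inj₁ refl)        = refl
      h (inj₂ (inj₁ refl)) = centre-eq
      h (inj₂ (inj₂ refl)) = sym eq
      g : ∀ {u} → u ∈ verts (w ++ʷ w′) → cell u ≡ cell a
      g p with verts-++ w w′ p
      g p | inj₁ q with f q
      ... | inj₁ r = h (inj₁ r)
      ... | inj₂ r = h (inj₂ (inj₁ r))
      g p | inj₂ q with f′ q
      ... | inj₁ r = h (inj₂ (inj₁ r))
      ... | inj₂ r = h (inj₂ (inj₂ r))
    intra {a} {b} a∈ b∈ eq | inj₂ (ea , none) | inj₁ (c∈I , c∈U , e) =
      ⊥-elim (none (c∈I , c∈U , inj₁ (trans (sym ea) eq)))
    intra {a} {b} a∈ b∈ eq | inj₂ (ea , _) | inj₂ (eb , _) with trans (sym ea) (trans eq eb)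
    ... | refl = stop a , λ { (here refl) → refl }

    liftWalk : ∀ {x y a b} (q : Walk E′ x y) → a ∈ U → cell a ≡ x → b ∈ U → cell b ≡ y →
      Σ (Walk (edges U) a b) λ w → ∀ {u} → u ∈ verts w → cell u ∈ verts q
    liftWalk (stop x) a∈ refl b∈ eb with intra a∈ b∈ (sym eb)
    ... | w , f = w , λ p → here (f p)
    liftWalk (go x e q) a∈ refl b∈ eb with ∈-map⁻ _ e
    ... | (u , u′) , e∈ , refl′ with cong proj₁ refl′ | cong proj₂ refl′
    ... | p₁ | refl with ∈-edges⁻ e∈
    ... | u∈ , u′∈ , _ with intra a∈ u∈ p₁ | liftWalk q u′∈ refl b∈ eb
    ... | w , f | w′ , f′ = w ++ʷ go u e∈ w′ , g
      where
      g : ∀ {v} → v ∈ verts (w ++ʷ go u e∈ w′) → cell v ∈ x ∷ verts q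
      g p with verts-++ w (go u e∈ w′) p
      ... | inj₁ r           = here (f r)
      ... | inj₂ (here refl) = here (sym p₁)
      ... | inj₂ (there r)   = there (f′ r)

  open Menger (_≟_ {order G})

  module Step {U I A B : List (V G)} (far : ∀ {u v v′} → v ∈ I → v′ ∈ I → u ~ v → u ~ v′ → v ≡ v′)
              {K : ℕ} (L : LinkageIn U A B K) (k : ℕ) (k≤ : k * suc Δ ≤ K) where
    open Contract U I far
    private
      module L = LinkageIn L
      S′ = map cell (filter (_∈? U) A)
      T′ = map cell (filter (_∈? U) B)

    -- A vertex whose cell is named `z` lies in the closed neighbourhood of `z`. Hence fewer than
    -- `k` cells meet fewer than `k * suc Δ` disjoint paths, whereas all `K` paths of `L` would have
    -- to be hit.
    noSep : ∀ {Z} → length Z < k → Hits E′ S′ T′ Z → ⊥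
    noSep {Z} lt hits = <⇒≱ bound (subst (_≤ length (concatMap nb⁺ Z)) (length-tabulate {n = K} id)
      (inj-length (λ i u → u ∈ verts (L.path i)) (Uniqueₚ.allFin⁺ K) (λ {i} _ → wit i) λ _ _ p q → L.disj p q))
      where
      wit : ∀ i → ∃ λ u → u ∈ concatMap nb⁺ Z × u ∈ verts (L.path i)
      wit i with mapWalk (L.path i)
      ... | w′ , f with hits (∈-map⁺ cell (∈-filter⁺ (_∈? U) (L.src∈ i) (L.src∈U i)))
                             (∈-map⁺ cell (∈-filter⁺ (_∈? U) (L.dst∈ i) (verts-⊆ (L.path i) (L.src∈U i) (target∈ _)))) w′
      ... | z , z∈w , z∈Z with f z∈w
      ... | u , u∈ , refl = u , ∈-concatMap nb⁺ z∈Z (∈-nb⁺ (~-sym (~cell u))) , u∈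
      bound : length (concatMap nb⁺ Z) < K
      bound = ≤-trans (s≤s (length-concatMap-≤ nb⁺ (suc Δ) Z (λ _ → nb⁺-≤ _)))
        (≤-trans (s≤s (m≤n+m _ Δ)) (≤-trans (*-monoˡ-≤ (suc Δ) lt) k≤))

    module Lifted (Q : Linkage E′ S′ T′ k) where
      private module Q = Linkage Q

      ends : ∀ {x} A → x ∈ map cell (filter (_∈? U) A) → ∃ λ a → a ∈ A × a ∈ U × cell a ≡ x
      ends A p with ∈-map⁻ cell p
      ... | a , a∈ , eq with ∈-filter⁻ (_∈? U) {xs = A} a∈
      ... | a∈A , a∈U = a , a∈A , a∈U , sym eq

      a : Fin k → V G
      a i = proj₁ (ends A (Q.src∈ i))
      b : Fin k → V G
      b i = proj₁ (ends B (Q.dst∈ i))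

      abstract
        induced : ∀ i → Σ (Walk (edges U) (a i) (b i)) λ w → Induced w × (∀ {u} → u ∈ verts w → cell u ∈ verts (Q.path i))
        induced i with liftWalk (Q.path i) (proj₁ (proj₂ (proj₂ (ends A (Q.src∈ i))))) (proj₂ (proj₂ (proj₂ (ends A (Q.src∈ i)))))
                                           (proj₁ (proj₂ (proj₂ (ends B (Q.dst∈ i))))) (proj₂ (proj₂ (proj₂ (ends B (Q.dst∈ i)))))
        ... | w , f with induce w
        ... | w′ , iw , s = w′ , iw , f ∘ s

      vs : Fin k → List (V G)
      vs i = verts (proj₁ (induced i))

      U′ : List (V G)
      U′ = concatMap vs (allFin k)

      vs⊆ : ∀ i → vs i ⊆ U′
      vs⊆ i = ∈-concatMap vs (∈-allFin i)

      disj′ : ∀ {i j v} → v ∈ vs i → v ∈ vs j → i ≡ j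
      disj′ {i} {j} p q = Q.disj (proj₂ (proj₂ (induced i)) p) (proj₂ (proj₂ (induced j)) q)

      U′⊆U : U′ ⊆ U
      U′⊆U p with ∈-concatMap⁻′ vs (allFin k) p
      ... | i , _ , q = verts-⊆ (proj₁ (induced i)) (proj₁ (proj₂ (proj₂ (ends A (Q.src∈ i))))) q

      inU′ : ∀ i → Σ (Walk (edges U′) (a i) (b i)) λ w → verts w ≡ vs i
      inU′ i = restrict (proj₁ (induced i)) (vs⊆ i)

      lifted : LinkageIn U′ A B k
      lifted = record
        { linkage = record
          { src = a ; dst = b ; path = proj₁ ∘ inU′
          ; src∈ = λ i → proj₁ (proj₂ (ends A (Q.src∈ i))) ; dst∈ = λ i → proj₁ (proj₂ (ends B (Q.dst∈ i)))
          ; disj = λ {i} {j} p q → disj′ (subst (_ ∈_) (proj₂ (inU′ i)) p) (subst (_ ∈_) (proj₂ (inU′ j)) q) }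
        ; src∈U = λ i → vs⊆ i (source∈ _) }

      two : ∀ {v} → v ∈ I → v ∈ U′ → TwoNeighbours U′ v
      two {v} v∈I v∈U′ with ∈-concatMap⁻′ vs (allFin k) v∈U′
      ... | i , _ , v∈i with induced-two (proj₁ (induced i)) (proj₁ (proj₂ (induced i))) v∈i
      ... | p , q , f = p , q , λ x∈ e → f (same x∈ e) e
        where
        same : ∀ {x} → x ∈ U′ → adj G v x ≡ true → x ∈ vs i
        same {x} x∈ e with ∈-concatMap⁻′ vs (allFin k) x∈
        ... | j , _ , x∈j with Q.disj (proj₂ (proj₂ (induced i)) v∈i)
                 (subst (_∈ verts (Q.path j)) (trans (cell-centre (v∈I , U′⊆U v∈U′ , inj₂ (adj-symm e)))
                   (sym (cell-centre (v∈I , U′⊆U v∈U′ , inj₁ refl)))) (proj₂ (proj₂ (induced j)) x∈j))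
        ... | refl = x∈j

    result : ∃ λ U′ → U′ ⊆ U × LinkageIn U′ A B k × (∀ {v} → v ∈ I → v ∈ U′ → TwoNeighbours U′ v)
    result with menger E′ S′ T′ k
    ... | inj₂ (Z , lt , hits) = ⊥-elim (noSep lt hits)
    ... | inj₁ Q = U′ , U′⊆U , lifted , two
      where
      open Lifted Q

  Far : List (V G) → Set
  Far I = ∀ {u v v′} → v ∈ I → v′ ∈ I → u ~ v → u ~ v′ → v ≡ v′

  -- The vertex set only shrinks from round to round, so the two-neighbour property of earlier
  -- classes survives; each class costs one factor `suc Δ`.
  steps : ∀ Is {U A B K} → All Far Is → LinkageIn U A B K → ∀ k → k * suc Δ ^ length Is ≤ K →
    ∃ λ U′ → U′ ⊆ U × LinkageIn U′ A B k × (∀ {I v} → I ∈ Is → v ∈ I → v ∈ U′ → TwoNeighbours U′ v)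
  steps [] [] L k le = _ , id , truncate , λ ()
    where
    open LinkageIn L
    k≤ : k ≤ _
    k≤ = ≤-trans (≤-reflexive (sym (*-identityʳ k))) le
    truncate = record
      { linkage = record { src = src ∘ (λ i → inject≤ i k≤) ; dst = dst ∘ (λ i → inject≤ i k≤) ; path = λ i → path (inject≤ i k≤)
                         ; src∈ = λ _ → src∈ _ ; dst∈ = λ _ → dst∈ _
                         ; disj = λ {i} {j} p q → Finₚ.inject≤-injective k≤ k≤ i j (disj p q) }
      ; src∈U = λ _ → src∈U _ }
  steps (I ∷ Is) {U} (f ∷ fs) L k le
    with Step.result {U} {I} f L (k * suc Δ ^ length Is) (≤-trans (≤-reflexive (trans (*-assoc k _ _) (cong (k *_) (*-comm (suc Δ ^ length Is) (suc Δ))))) le)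
  ... | U₁ , s₁ , L₁ , two₁ with steps Is fs L₁ k ≤-refl
  ... | U₂ , s₂ , L₂ , two₂ = U₂ , s₁ ∘ s₂ , L₂ , λ { (here refl) v∈I v∈ →
          let p , q , g = two₁ v∈I (s₂ v∈) in p , q , λ x∈ e → g (s₂ x∈) e ; (there I∈) → two₂ I∈ }

  -- One more than the bound for a ball of radius 2: a greedy colouring of the square of `G` always
  -- finds a class without vertices at distance at most 2.
  colours : ℕ
  colours = suc (ballBound Δ 2)

  record Classes (xs : List (V G)) : Set where
    field
      cls  : Fin colours → List (V G)
      cov  : ∀ {x} → x ∈ xs → ∃ λ i → x ∈ cls i
      sub  : ∀ i → cls i ⊆ xs
      dis  : ∀ {i j x} → x ∈ cls i → x ∈ cls j → i ≡ j
      apart : ∀ {i x y} → x ∈ cls i → y ∈ cls i → y ∈ ball 2 x → x ≡ y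

  classes : ∀ xs → Unique xs → Classes xs
  classes [] _ = record { cls = λ _ → [] ; cov = λ () ; sub = λ _ () ; dis = λ () ; apart = λ () }
  classes (x ∷ xs) (x∉ ∷ uq) = extend (Finₚ.any? λ i → ¬? (any? (_∈? ball 2 x) (cls i)))
    where
    open Classes (classes xs uq)
    extend : Dec (∃ λ i → ¬ Any (_∈ ball 2 x) (cls i)) → Classes (x ∷ xs)
    extend (no none) = ⊥-elim (<⇒≱ ≤-refl (≤-trans
      (subst (_≤ length (ball 2 x)) (length-tabulate {n = colours} id)
        (inj-length (λ i v → v ∈ cls i) (Uniqueₚ.allFin⁺ colours) (λ {i} _ → wit i) λ _ _ → dis)) (ball-≤ 2 x)))
      where
      wit : ∀ i → ∃ λ v → v ∈ ball 2 x × v ∈ cls i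
      wit i with any? (_∈? ball 2 x) (cls i)
      ... | yes p = let v , v∈ , b = find p in v , b , v∈
      ... | no ¬p = ⊥-elim (none (i , ¬p))
    extend (yes (i , free)) = record { cls = cls′ ; cov = cov′ ; sub = sub′ ; dis = dis′ ; apart = λ {j} → apart′ {j} }
      where
      cls′ : Fin colours → List (V G)
      cls′ j with j ≟ i
      ... | yes _ = x ∷ cls j
      ... | no  _ = cls j
      there′ : ∀ {j y} → y ∈ cls j → y ∈ cls′ j
      there′ {j} p with j ≟ i
      ... | yes _ = there p
      ... | no  _ = p
      cases : ∀ {j y} → y ∈ cls′ j → (y ≡ x × j ≡ i) ⊎ y ∈ cls j
      cases {j} p with j ≟ i
      cases (here q)  | yes e = inj₁ (q , e)
      cases (there q) | yes _ = inj₂ q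
      cases p         | no  _ = inj₂ p
      here′ : x ∈ cls′ i
      here′ with i ≟ i
      ... | yes _ = here refl
      ... | no ¬p = ⊥-elim (¬p refl)
      cov′ : ∀ {y} → y ∈ x ∷ xs → ∃ λ j → y ∈ cls′ j
      cov′ (here refl) = i , here′
      cov′ (there p)   = let j , q = cov p in j , there′ q
      sub′ : ∀ j → cls′ j ⊆ x ∷ xs
      sub′ j p with cases {j} p
      ... | inj₁ (q , _) = here q
      ... | inj₂ q       = there (sub j q)
      new : ∀ {j} → x ∉ cls j
      new {j} p = All.lookup x∉ (sub j p) refl
      dis′ : ∀ {j j′ y} → y ∈ cls′ j → y ∈ cls′ j′ → j ≡ j′
      dis′ {j} {j′} p q with cases {j} p | cases {j′} q
      ... | inj₁ (_ , e) | inj₁ (_ , e′) = trans e (sym e′)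
      ... | inj₁ (refl , _) | inj₂ r = ⊥-elim (new r)
      ... | inj₂ r | inj₁ (refl , _) = ⊥-elim (new r)
      ... | inj₂ r | inj₂ r′ = dis r r′
      apart′ : ∀ {j y z} → y ∈ cls′ j → z ∈ cls′ j → z ∈ ball 2 y → y ≡ z
      apart′ {j} p q b with cases {j} p | cases {j} q
      ... | inj₁ (refl , _) | inj₁ (refl , _) = refl
      ... | inj₁ (refl , refl) | inj₂ r = ⊥-elim (free (lose r b))
      ... | inj₂ r | inj₁ (refl , refl) = ⊥-elim (free (lose r (ball-sym 2 b)))
      ... | inj₂ r | inj₂ r′ = apart r r′ b

  record CleanLinkage (U A B : List (V G)) (k : ℕ) : Set where
    field
      src dst : Fin k → V G
      path    : ∀ i → Walk (edges U) (src i) (dst i)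
      src∈    : ∀ i → src i ∈ A
      dst∈    : ∀ i → dst i ∈ B
      clean   : ∀ {i j} → Touch (verts (path i)) (verts (path j)) → i ≡ j

  module Final {U U′ A B : List (V G)} {k : ℕ} (U′⊆U : U′ ⊆ U)
               (indep : ∀ {a a′} → a ∈ A ++ B → a′ ∈ A ++ B → adj G a a′ ≢ true)
               (L : LinkageIn U′ A B k) (two : ∀ {v} → v ∈ U′ → TwoNeighbours U′ v) where
    open LinkageIn L

    abstract
      ind : ∀ i → Σ (Walk (edges U′) (src i) (dst i)) λ w → Induced w × verts w ⊆ verts (path i)
      ind i = induce (path i)

    vs : Fin k → List (V G)
    vs i = verts (proj₁ (ind i))

    vs⊆ : ∀ {i} → vs i ⊆ U′
    vs⊆ {i} p = verts-⊆ (path i) (src∈U i) (proj₂ (proj₂ (ind i)) p)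

    final : ∀ i → Σ (Walk (edges U) (src i) (dst i)) λ w → verts w ≡ vs i
    final i = restrict (proj₁ (ind i)) (U′⊆U ∘ vs⊆)

    disj′ : ∀ {i j v} → v ∈ vs i → v ∈ vs j → i ≡ j
    disj′ {i} {j} p q = disj (proj₂ (proj₂ (ind i)) p) (proj₂ (proj₂ (ind j)) q)

    Inner : Fin k → V G → Set
    Inner i v = ∃₂ λ p q → p ∈ vs i × q ∈ vs i × p ≢ q × adj G v p ≡ true × adj G v q ≡ true

    -- An inner vertex `v` has two neighbours on its own path and at most two in `U′`, so `x` is one
    -- of those two. This leaves only contacts between endpoints, which `indep` excludes.
    third : ∀ {i j v x} → v ∈ vs i → x ∈ vs j → adj G v x ≡ true → Inner i v → i ≡ j
    third {i} {j} {v} {x} v∈ x∈ e (p , q , p∈ , q∈ , p≢q , ep , eq) with two (vs⊆ v∈)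
    ... | s , t , f with f (vs⊆ x∈) e | f (vs⊆ p∈) ep | f (vs⊆ q∈) eq
    ... | inj₁ refl | inj₁ refl | _         = disj′ p∈ x∈
    ... | inj₂ refl | inj₂ refl | _         = disj′ p∈ x∈
    ... | inj₁ refl | inj₂ refl | inj₁ refl = disj′ q∈ x∈
    ... | inj₁ refl | inj₂ refl | inj₂ refl = ⊥-elim (p≢q refl)
    ... | inj₂ refl | inj₁ refl | inj₁ refl = ⊥-elim (p≢q refl)
    ... | inj₂ refl | inj₁ refl | inj₂ refl = disj′ q∈ x∈

    endpoint : ∀ i {v} → v ≡ src i ⊎ v ≡ dst i → v ∈ A ++ B
    endpoint i (inj₁ refl) = ∈-++⁺ˡ (src∈ i)
    endpoint i (inj₂ refl) = ∈-++⁺ʳ A (dst∈ i)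

    kind : ∀ i {v} → v ∈ vs i → v ∈ A ++ B ⊎ Inner i v
    kind i v∈ with interior (proj₁ (ind i)) (proj₁ (proj₂ (ind i))) v∈
    ... | inj₁ p        = inj₁ (endpoint i (inj₁ p))
    ... | inj₂ (inj₁ p) = inj₁ (endpoint i (inj₂ p))
    ... | inj₂ (inj₂ r) = inj₂ r

    clean′ : ∀ {i j u v} → u ∈ vs i → v ∈ vs j → u ~ v → i ≡ j
    clean′ u∈ v∈ (inj₁ refl) = disj′ u∈ v∈
    clean′ {i} {j} u∈ v∈ (inj₂ e) with kind i u∈ | kind j v∈
    ... | inj₂ r | _      = third u∈ v∈ e r
    ... | inj₁ _ | inj₂ r = sym (third v∈ u∈ (adj-symm e) r)
    ... | inj₁ p | inj₁ q = ⊥-elim (indep p q e)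

    cleaned : CleanLinkage U A B k
    cleaned = record
      { src = src ; dst = dst ; path = λ i → proj₁ (final i) ; src∈ = src∈ ; dst∈ = dst∈
      ; clean = λ {i} {j} (u , v , u∈ , v∈ , e) →
          clean′ (subst (u ∈_) (proj₂ (final i)) u∈) (subst (v ∈_) (proj₂ (final j)) v∈) e }

  abstract
    far-classes : ∃ λ Is → length Is ≡ colours × All Far Is × (∀ v → ∃ λ I → I ∈ Is × v ∈ I)
    far-classes = tabulate cls , length-tabulate cls ,
      Allₚ.tabulate⁺ (λ i p q e e′ → apart {i} p q (ball-trans 1 1 (ball-1 (~-sym e)) (ball-1 e′))) ,
      λ v → let i , p = cov (∈-allFin v) in cls i , ∈-tabulate⁺ {f = cls} i , p
      where
      open Classes (classes (allFin (order G)) (Uniqueₚ.allFin⁺ _))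

  cleanMenger : ∀ {U A B} → A ⊆ U → (∀ {a a′} → a ∈ A ++ B → a′ ∈ A ++ B → adj G a a′ ≢ true) → ∀ k →
    CleanLinkage U A B k ⊎ (∃ λ Z → length Z < k * suc Δ ^ colours × Hits (edges U) A B Z)
  cleanMenger {U} {A} {B} A⊆U indep k with menger (edges U) A B (k * suc Δ ^ colours)
  ... | inj₂ sep = inj₂ sep
  ... | inj₁ L₀ = inj₁ (finish (steps (proj₁ far-classes) (proj₁ (proj₂ (proj₂ far-classes)))
                     (record { linkage = L₀ ; src∈U = A⊆U ∘ Linkage.src∈ L₀ }) k
                     (≤-reflexive (cong (λ m → k * suc Δ ^ m) (proj₁ (proj₂ far-classes))))))
    where
    finish : (∃ λ U′ → U′ ⊆ U × LinkageIn U′ A B k ×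
               (∀ {I v} → I ∈ proj₁ far-classes → v ∈ I → v ∈ U′ → TwoNeighbours U′ v)) → CleanLinkage U A B k
    finish (U′ , sub , L , two) = Final.cleaned sub indep L λ {v} →
      let I , I∈ , v∈I = proj₂ (proj₂ (proj₂ far-classes)) v in two I∈ v∈I

-- Pieces of breadth-first search trees

least : {P : ℕ → Set} → (∀ k → Dec (P k)) → ∀ k → P k → ∃ λ m → P m × (∀ {j} → j < m → ¬ P j)
least P? zero p = zero , p , λ ()
least P? (suc k) p with P? zero
... | yes q = zero , q , λ ()
... | no ¬q with least (P? ∘ suc) k p
... | m , q , below = suc m , q , λ { {zero} _ → ¬q ; {suc j} (s≤s lt) → below lt }

jump : {P : ℕ → Set} → (∀ k → Dec (P k)) → ∀ k → ¬ P 0 → P k → ∃ λ m → m < k × ¬ P m × P (suc m)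
jump P? zero    ¬p p = ⊥-elim (¬p p)
jump P? (suc k) ¬p p with P? k
... | no ¬q = k , ≤-refl , ¬q , p
... | yes q with jump P? k ¬p q
... | m , lt , r = m , m≤n⇒m≤1+n lt , r

nonempty : {A : Set} (xs : List A) → 1 ≤ length xs → ∃ (_∈ xs)
nonempty (x ∷ _) _ = x , here refl

-- Everything about pieces, windows and the final colouring uses the component of `r` through these
-- layer properties; `par` picks one edge towards the root and so fixes a search tree.
record BFS (G : Graph) (r : V G) : Set₁ where
  open Sets G
  field
    In       : V G → Set
    In?      : ∀ v → Dec (In v)
    lay      : V G → ℕ
    par      : V G → V G
    in-root  : In r
    in-adj   : ∀ {u v} → In u → u ~ v → In v
    in-ball  : ∀ {v} → In v → v ∈ ball (lay v) r
    lay-zero : ∀ {v} → In v → lay v ≡ 0 → v ≡ r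
    lay-adj  : ∀ {u v} → In u → u ~ v → lay v ≤ suc (lay u)
    par-spec : ∀ {v k} → In v → lay v ≡ suc k → adj G (par v) v ≡ true × In (par v) × lay (par v) ≡ k

abstract
  bfs : ∀ G r → BFS G r
  bfs G r = record
    { In = In ; In? = λ v → comp E v ≟ comp E r ; lay = lay ; par = par ; in-root = refl ; in-adj = in-adj
    ; in-ball = λ i → proj₁ (lay-spec i) ; lay-zero = lay-zero ; lay-adj = lay-adj ; par-spec = par-spec }
    where
    open Sets G
    open Components (_≟_ {order G})
    E : List (V G × V G)
    E = edges (allFin (order G))
    In : V G → Set
    In v = comp E v ≡ comp E r
    in-adj : ∀ {u v} → In u → u ~ v → In v
    in-adj i (inj₁ refl) = i
    in-adj i (inj₂ e) = trans (sym (comp-edge (∈-edges (∈-allFin _) (∈-allFin _) e))) i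
    walk-ball : ∀ {a b} (w : Walk E a b) → ∃ λ k → b ∈ ball k a
    walk-ball (stop a) = 0 , ball-0
    walk-ball (go a e w) with walk-ball w
    ... | k , b∈ = k + 1 , ball-trans 1 k (ball-1 (inj₂ (proj₂ (proj₂ (∈-edges⁻ e))))) b∈
    Least : V G → ℕ → Set
    Least v m = v ∈ ball m r × (∀ {j} → j < m → v ∉ ball j r)
    find-layer : ∀ v → In v → ∃ (Least v)
    find-layer v i with walk-ball (comp-walk edges-sym E id (sym i))
    ... | k , v∈ = least (λ k → v ∈? ball k r) k v∈
    lay : V G → ℕ
    lay v with comp E v ≟ comp E r
    ... | yes i = proj₁ (find-layer v i)
    ... | no _  = 0
    lay-spec : ∀ {v} → In v → Least v (lay v)
    lay-spec {v} i with comp E v ≟ comp E r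
    ... | yes i′ = proj₂ (find-layer v i′)
    ... | no ¬i  = ⊥-elim (¬i i)
    lay-≤ : ∀ {v k} → In v → v ∈ ball k r → lay v ≤ k
    lay-≤ i v∈ = ≮⇒≥ λ lt → proj₂ (lay-spec i) lt v∈
    lay-adj : ∀ {u v} → In u → u ~ v → lay v ≤ suc (lay u)
    lay-adj {u} i e = lay-≤ (in-adj i e) (ball-step (lay u) {u = r} (proj₁ (lay-spec i)) e)
    lay-zero : ∀ {v} → In v → lay v ≡ 0 → v ≡ r
    lay-zero {v} i e = ball-0⁻ (subst (λ m → v ∈ ball m r) e (proj₁ (lay-spec i)))
    Parent : V G → V G → Set
    Parent v u = adj G u v ≡ true × In u × suc (lay u) ≡ lay v
    parent : ∀ {v k} → In v → lay v ≡ suc k → ∃ (Parent v)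
    parent {v} {k} i e with ball-step⁻ k (subst (λ m → v ∈ ball m r) e (proj₁ (lay-spec i)))
    ... | u , u∈ , inj₁ refl = ⊥-elim (proj₂ (lay-spec i) (subst (k <_) (sym e) ≤-refl) u∈)
    ... | u , u∈ , inj₂ a = u , a , iu , trans (cong suc (≤-antisym (lay-≤ iu u∈) (≤-pred (subst (_≤ suc (lay u)) e (lay-adj iu (inj₂ a)))))) (sym e)
      where
      iu : In u
      iu = in-adj i (inj₂ (adj-symm a))
    parent? : ∀ v u → Dec (Parent v u)
    parent? v u = (adj G u v Boolₚ.≟ true) ×-dec ((comp E u ≟ comp E r) ×-dec (suc (lay u) ≟ℕ lay v))
    par : V G → V G
    par v with Finₚ.any? (parent? v)
    ... | yes (u , _) = u
    ... | no _        = v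
    par-spec : ∀ {v k} → In v → lay v ≡ suc k → adj G (par v) v ≡ true × In (par v) × lay (par v) ≡ k
    par-spec {v} i e with Finₚ.any? (parent? v)
    ... | yes (u , a , iu , l) = a , iu , suc-injective (trans l e)
    ... | no none              = ⊥-elim (none (parent i e))

module Teeth {G : Graph} {r : V G} (B : BFS G r) where
  open Sets G
  open BFS B

  up : ℕ → V G → V G
  up zero    v = v
  up (suc t) v = up t (par v)

  chain : ℕ → V G → List (V G)
  chain zero    v = v ∷ []
  chain (suc m) v = v ∷ chain m (par v)

  parent : ∀ {v m} → In v → suc m ≤ lay v → adj G (par v) v ≡ true × In (par v) × suc (lay (par v)) ≡ lay v
  parent {v} i le with lay v in eq
  parent {v} i (s≤s le) | suc k with par-spec i eq
  ... | a , ip , e = a , ip , cong suc e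

  parent-≤ : ∀ {v m} → In v → suc m ≤ lay v → m ≤ lay (par v)
  parent-≤ {v} {m} i le = ≤-pred (subst (suc m ≤_) (sym (proj₂ (proj₂ (parent {v} i le)))) le)

  chain-spec : ∀ m {x v} → In x → m ≤ lay x → v ∈ chain m x → ∃ λ t → t ≤ m × v ≡ up t x
  chain-spec zero    i le (here p) = 0 , z≤n , p
  chain-spec (suc m) i le (here p) = 0 , z≤n , p
  chain-spec (suc m) i le (there p) with chain-spec m (proj₁ (proj₂ (parent i le))) (parent-≤ i le) p
  ... | t , t≤ , e = suc t , s≤s t≤ , e

  up-∈ : ∀ {t m x} → t ≤ m → up t x ∈ chain m x
  up-∈ {zero}  {zero}  _ = here refl
  up-∈ {zero}  {suc m} _ = here refl
  up-∈ {suc t} {suc m} (s≤s le) = there (up-∈ le)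

  up-in : ∀ t {x} → In x → t ≤ lay x → In (up t x)
  up-in zero    i le = i
  up-in (suc t) i le = up-in t (proj₁ (proj₂ (parent i le))) (parent-≤ i le)

  up-lay : ∀ t {x} → In x → t ≤ lay x → t + lay (up t x) ≡ lay x
  up-lay zero    i le = refl
  up-lay (suc t) i le = trans (cong suc (up-lay t (proj₁ (proj₂ (parent i le))) (parent-≤ i le))) (proj₂ (proj₂ (parent i le)))

  up-+ : ∀ s t x → up (s + t) x ≡ up t (up s x)
  up-+ zero    t x = refl
  up-+ (suc s) t x = up-+ s t (par x)

  chain-mono : ∀ {m m′ x} → m ≤ m′ → chain m x ⊆ chain m′ x
  chain-mono {zero}  {zero}   _        p         = p
  chain-mono {zero}  {suc m′} _        (here p)  = here p
  chain-mono {suc m} {suc m′} (s≤s le) (here p)  = here p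
  chain-mono {suc m} {suc m′} (s≤s le) (there p) = there (chain-mono le p)

  chain-conn : ∀ m {x} → In x → m ≤ lay x → Conn (chain m x)
  chain-conn m i le p q = reach-trans (reach-sym (from m i le p)) (from m i le q)
    where
    from : ∀ m {x v} → In x → m ≤ lay x → v ∈ chain m x → Reach G (_∈ chain m x) x v
    from zero    i le (here refl) = here (here refl)
    from (suc m) i le (here refl) = here (here refl)
    from (suc m) {x} i le (there p) = reach-trans
      (reach-edge (here refl) (there (up-∈ {0} {m} z≤n)) (inj₂ (adj-symm (proj₁ (parent i le)))))
      (reach-mono there (from m (proj₁ (proj₂ (parent i le))) (parent-≤ i le) p))

  up-ball : ∀ t {x} → In x → t ≤ lay x → up t x ∈ ball t x
  up-ball zero    i le = ball-0
  up-ball (suc t) {x} i le = subst (λ m → up t (par x) ∈ ball m x) (+-comm t 1)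
    (ball-trans 1 t (ball-1 (inj₂ (adj-symm (proj₁ (parent i le))))) (up-ball t (proj₁ (proj₂ (parent i le))) (parent-≤ i le)))

module Pieces {G : Graph} (Δ : ℕ) (deg≤ : MaxDegree≤ G Δ) {r : V G} (B : BFS G r) {I : Set}
              (start : I → V G) (ℓ₀ : ℕ) (in-start : ∀ i → BFS.In B (start i)) (lay-start : ∀ i → BFS.lay B (start i) ≡ ℓ₀)
              (apart : ∀ {i j} → Sets._~_ G (start i) (start j) → i ≡ j) where
  open Sets G
  open Degree G Δ deg≤
  open BFS B
  open Teeth B

  tooth : ℕ → I → List (V G)
  tooth m i = chain m (start i)

  full : I → List (V G)
  full = tooth ℓ₀

  Meet : ℕ → I → I → Set
  Meet m i j = Touch (tooth m i) (tooth m j)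

  meets : ℕ → List I → I → List I
  meets m is i = filter (λ j → touch? (tooth m i) (tooth m j)) is

  le-start : ∀ {m} i → m ≤ ℓ₀ → m ≤ lay (start i)
  le-start i le = subst (_ ≤_) (sym (lay-start i)) le

  -- `ids` lists starts at which connectors may be attached. By `inside` the body is confined to
  -- teeth, hence to layers up to `ℓ₀`, and within layer `ℓ₀` to starts (`low`, `top`).
  record Piece (d : ℕ) : Set where
    field
      ids    : List I
      uniq   : Unique ids
      size   : length ids ≡ d
      body   : List (V G)
      conn   : Conn body
      ids∈   : ∀ {i} → i ∈ ids → start i ∈ body
      inside : ∀ {v} → v ∈ body → ∃ λ i → v ∈ full i

    low : ∀ {v} → v ∈ body → lay v ≤ ℓ₀
    low v∈ with inside v∈
    ... | i , p with chain-spec ℓ₀ (in-start i) (le-start i ≤-refl) p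
    ... | t , t≤ , refl = subst (lay (up t (start i)) ≤_) (trans (up-lay t (in-start i) (le-start i t≤)) (lay-start i)) (m≤n+m _ t)

    top : ∀ {v} → v ∈ body → lay v ≡ ℓ₀ → ∃ λ i → v ≡ start i
    top v∈ e with inside v∈
    ... | i , p with chain-spec ℓ₀ (in-start i) (le-start i ≤-refl) p
    ... | zero  , t≤ , refl = i , refl
    ... | suc t , t≤ , refl = ⊥-elim (m≢1+n+m ℓ₀ (sym (trans (cong (λ l → suc t + l) (sym e))
            (trans (up-lay (suc t) (in-start i) (le-start i t≤)) (lay-start i)))))

  open Piece

  NonTouching : ∀ {d} → Piece d → Piece d → Set
  NonTouching p q = ¬ Touch (body p) (body q)

  -- Let m + 1 be the first depth at which some tooth x meets d teeth: x and these teeth form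
  -- a piece. At depth m every tooth meets fewer than d teeth, so only boundedly many teeth
  -- touch the piece; these are discarded.
  module Locate (d₀ : ℕ) (is : List I) (uq : Unique is) (d≤ : suc (suc d₀) ≤ length is) where
    private d = suc (suc d₀)

    Big : ℕ → Set
    Big m = Any (λ i → d ≤ length (meets m is i)) is

    big? : ∀ m → Dec (Big m)
    big? m = any? (λ i → d ≤? length (meets m is i)) is

    -- At depth 0 the teeth are single, pairwise non-adjacent starts, each meeting only itself; this
    -- is where the size `d` being at least 2 enters.
    ¬big-0 : ¬ Big 0
    ¬big-0 b with find b
    ... | i , _ , le = <⇒≱ {1} (s≤s (s≤s z≤n)) (≤-trans le
            (uniq-length {ys = i ∷ []} (Uniqueₚ.filter⁺ (λ j → touch? (tooth 0 i) (tooth 0 j)) uq) only))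
      where
      only : meets 0 is i ⊆ i ∷ []
      only p with proj₂ (∈-filter⁻ (λ j → touch? (tooth 0 i) (tooth 0 j)) {xs = is} p)
      ... | _ , _ , here refl , here refl , e = here (sym (apart e))

    root∈ : ∀ i → r ∈ full i
    root∈ i = subst (_∈ full i) (lay-zero (up-in ℓ₀ (in-start i) le)
      (+-cancelˡ-≡ ℓ₀ _ 0 (trans (up-lay ℓ₀ (in-start i) le) (trans (lay-start i) (sym (+-identityʳ ℓ₀)))))) (up-∈ ≤-refl)
      where le = le-start i ≤-refl

    big-ℓ₀ : Big ℓ₀
    big-ℓ₀ = lose (proj₂ some) (subst (d ≤_) (sym (cong length (filter-all (λ j → touch? (full i) (full j)) {is}
      (All.tabulate λ {j} _ → r , r , root∈ i , root∈ j , inj₁ refl)))) d≤)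
      where
      some : ∃ (_∈ is)
      some = nonempty is (≤-trans (s≤s z≤n) d≤)
      i = proj₁ some

    Located : ℕ → I → Set
    Located m x = m < ℓ₀ × (∀ {i} → i ∈ is → length (meets m is i) ≤ d) × x ∈ is × d ≤ length (meets (suc m) is x)

    locate : ∃₂ Located
    locate with jump big? ℓ₀ ¬big-0 big-ℓ₀
    ... | m , m< , ¬big , big with find big
    ... | x , x∈ , le = m , x , m< , (λ i∈ → ≰⇒≥ λ le → ¬big (lose i∈ le)) , x∈ , le

  module Extract (d₀ : ℕ) (is : List I) (uq : Unique is) (m : ℕ) (x : I) (m< : m < ℓ₀)
                 (few : ∀ {i} → i ∈ is → length (meets m is i) ≤ suc (suc d₀)) (x∈ : x ∈ is)
                 (big : suc (suc d₀) ≤ length (meets (suc m) is x)) where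
    private d = suc (suc d₀)

    m≤ : m ≤ ℓ₀
    m≤ = ≤-trans (n≤1+n m) m<

    chosen : List I
    chosen = take d (meets (suc m) is x)

    chosen-spec : ∀ {i} → i ∈ chosen → i ∈ is × Meet (suc m) x i
    chosen-spec p = ∈-filter⁻ (λ j → touch? (tooth (suc m) x) (tooth (suc m) j)) {xs = is} (take-⊆ d p)

    K : List (V G)
    K = tooth (suc m) x ++ concatMap (tooth (suc m)) chosen

    K-origin : ∀ {v} → v ∈ K → ∃ λ y → y ∈ x ∷ chosen × v ∈ tooth (suc m) y
    K-origin p with ∈-++⁻ (tooth (suc m) x) p
    ... | inj₁ q = x , here refl , q
    ... | inj₂ q with ∈-concatMap⁻′ (tooth (suc m)) chosen q
    ... | y , y∈ , r = y , there y∈ , r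

    origin∈ : ∀ {y} → y ∈ x ∷ chosen → y ∈ is
    origin∈ (here refl) = x∈
    origin∈ (there p)   = proj₁ (chosen-spec p)

    piece : Piece d
    piece = record
      { ids = chosen
      ; uniq = Uniqueₚ.take⁺ d (Uniqueₚ.filter⁺ (λ j → touch? (tooth (suc m) x) (tooth (suc m) j)) uq)
      ; size = length-take-≤ d {meets (suc m) is x} big
      ; body = K
      ; conn = conn-star (tooth (suc m)) chosen (chain-conn (suc m) (in-start x) (le-start x m<))
                 (λ {i} _ → chain-conn (suc m) (in-start i) (le-start i m<)) (proj₂ ∘ chosen-spec)
      ; ids∈ = λ i∈ → ∈-++⁺ʳ (tooth (suc m) x) (∈-concatMap (tooth (suc m)) i∈ (here refl))
      ; inside = λ p → let y , _ , q = K-origin p in y , chain-mono m< q }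

    K-inside : ∀ {v} → v ∈ K → ∃ λ i → i ∈ is × v ∈ full i
    K-inside p with K-origin p
    ... | y , y∈ , q = y , origin∈ y∈ , chain-mono m< q

    kill? : ∀ j → Dec (Touch K (full j))
    kill? j = touch? K (full j)

    at : V G → List I
    at p = filter (λ j → up m (start j) ≟ p) is

    -- Any two teeth that have `p` at depth `m` meet there, so `few` applies to one of them.
    at-≤ : ∀ p → length (at p) ≤ d
    at-≤ p with at p in eq
    ... | [] = z≤n
    ... | j ∷ js = ≤-trans (subst (λ l → length l ≤ length (meets m is j)) eq
            (uniq-length (Uniqueₚ.filter⁺ (λ j → up m (start j) ≟ p) uq) sub)) (few (proj₁ j∈))
      where
      mem : ∀ {i} → i ∈ at p → i ∈ is × up m (start i) ≡ p
      mem = ∈-filter⁻ (λ j → up m (start j) ≟ p) {xs = is}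
      j∈ = mem (subst (j ∈_) (sym eq) (here refl))
      sub : at p ⊆ meets m is j
      sub q = ∈-filter⁺ (λ i → touch? (tooth m j) (tooth m i)) (proj₁ (mem q))
        (_ , _ , up-∈ ≤-refl , up-∈ ≤-refl , inj₁ (trans (proj₂ j∈) (sym (proj₂ (mem q)))))

    -- Layers of adjacent vertices differ by at most one. So a contact of a full tooth with
    -- `tooth (suc m) y` lies within depth `m` on both sides, or else close to depth `m`; then the
    -- two vertices at depth `m` are at distance at most 4: one step up, one across, two back.
    suspects : I → List I
    suspects y = meets m is y ++ concatMap at (ball 4 (up m (start y)))

    suspects-≤ : ∀ {y} → y ∈ is → length (suspects y) ≤ d + ballBound Δ 4 * d
    suspects-≤ {y} y∈ = subst (_≤ d + ballBound Δ 4 * d) (sym (length-++ (meets m is y)))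
      (+-mono-≤ (few y∈) (≤-trans (length-concatMap-≤ at d (ball 4 (up m (start y))) (λ _ → at-≤ _)) (*-monoˡ-≤ d (ball-≤ 4 _))))

    lay-up : ∀ {t} i → t ≤ ℓ₀ → t + lay (up t (start i)) ≡ ℓ₀
    lay-up {t} i le = trans (up-lay t (in-start i) (le-start i le)) (lay-start i)

    close : ∀ {s t} i j → s ≤ ℓ₀ → t ≤ ℓ₀ → up s (start i) ~ up t (start j) → t ≤ suc s
    close {s} {t} i j s≤ t≤ e = +-cancelʳ-≤ (lay (up t (start j))) t (suc s)
      (subst (_≤ suc s + lay (up t (start j))) (trans (lay-up i s≤) (sym (lay-up j t≤)))
        (subst (s + lay (up s (start i)) ≤_) (+-suc s _)
          (+-monoʳ-≤ s (lay-adj (up-in t (in-start j) (le-start j t≤)) (~-sym e)))))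

    suspect : ∀ {y j} → y ∈ is → j ∈ is → Touch (tooth (suc m) y) (full j) → j ∈ suspects y
    suspect {y} {j} y∈ j∈ (u , v , u∈ , v∈ , e)
      with chain-spec (suc m) (in-start y) (le-start y m<) u∈ | chain-spec ℓ₀ (in-start j) (le-start j ≤-refl) v∈
    ... | s , s≤ , refl | t , t≤ , refl with s ≤? m | t ≤? m
    ... | yes s≤m | yes t≤m = ∈-++⁺ˡ (∈-filter⁺ (λ i → touch? (tooth m y) (tooth m i)) j∈ (u , v , up-∈ s≤m , up-∈ t≤m , e))
    ... | yes s≤m | no t≰m = ∈-++⁺ʳ (meets m is y) (∈-concatMap at near (∈-filter⁺ (λ j → up m (start j) ≟ up m (start j′)) j∈ refl))
      where
      j′ = j
      s<ℓ = ≤-trans s≤m m≤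
      t≡ : t ≡ suc m
      t≡ = ≤-antisym (≤-trans (close y j s<ℓ t≤ e) (s≤s s≤m)) (≰⇒> t≰m)
      s≡ : s ≡ m
      s≡ = ≤-antisym s≤m (≤-pred (subst (_≤ suc s) t≡ (close y j s<ℓ t≤ e)))
      p∈ : up (suc m) (start j) ∈ ball 1 (up m (start j))
      p∈ = subst (_∈ ball 1 (up m (start j))) (trans (sym (up-+ m 1 (start j))) (cong (λ k → up k (start j)) (+-comm m 1)))
             (up-ball 1 (up-in m (in-start j) (le-start j m≤)) (+-cancelˡ-≤ m 1 _ (subst₂ _≤_ (+-comm 1 m) (sym (lay-up j m≤)) m<)))
      near : up m (start j) ∈ ball 4 (up m (start y))
      near = ball-mono {2} (s≤s (s≤s z≤n)) (ball-trans 1 1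
               (ball-1 (subst₂ (λ a b → up a (start y) ~ up b (start j)) s≡ t≡ e)) (ball-sym 1 p∈))
    ... | no s≰m | _ = ∈-++⁺ʳ (meets m is y) (∈-concatMap at near (∈-filter⁺ (λ j → up m (start j) ≟ up m (start j′)) j∈ refl))
      where
      j′ = j
      s≡ : s ≡ suc m
      s≡ = ≤-antisym s≤ (≰⇒> s≰m)
      t≤ms : t ≤ suc (suc m)
      t≤ms = subst (λ k → t ≤ suc k) s≡ (close y j (≤-trans s≤ m<) t≤ e)
      m≤t : m ≤ t
      m≤t = ≤-pred (subst (_≤ suc t) s≡ (close j y t≤ (≤-trans s≤ m<) (~-sym e)))
      upward : ∀ {k} i → k ≤ ℓ₀ → m ≤ k → up k (start i) ∈ ball (k ∸ m) (up m (start i))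
      upward {k} i k≤ m≤k = subst (_∈ ball (k ∸ m) (up m (start i)))
        (trans (sym (up-+ m (k ∸ m) (start i))) (cong (λ l → up l (start i)) (m+[n∸m]≡n m≤k)))
        (up-ball (k ∸ m) (up-in m (in-start i) (le-start i m≤))
          (+-cancelˡ-≤ m _ _ (subst₂ _≤_ (sym (m+[n∸m]≡n m≤k)) (sym (lay-up i m≤)) k≤)))
      one : suc m ∸ m ≤ 1
      one = ≤-reflexive (m+n∸n≡m 1 m)
      two : t ∸ m ≤ 2
      two = ≤-trans (∸-monoˡ-≤ m t≤ms) (≤-reflexive (m+n∸n≡m 2 m))
      near : up m (start j) ∈ ball 4 (up m (start y))
      near = ball-trans 2 2 (ball-trans 1 1 (ball-mono one (upward y m< (n≤1+n m)))
               (ball-1 (subst (λ a → up a (start y) ~ v) s≡ e))) (ball-sym 2 (ball-mono two (upward j t≤ m≤t)))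

    killed-≤ : length (filter kill? is) ≤ suc d * (d + ballBound Δ 4 * d)
    killed-≤ = ≤-trans (uniq-length (Uniqueₚ.filter⁺ kill? uq) sub)
      (subst (λ l → length (concatMap suspects (x ∷ chosen)) ≤ suc l * (d + ballBound Δ 4 * d)) (length-take-≤ d {meets (suc m) is x} big)
        (length-concatMap-≤ suspects _ (x ∷ chosen) (suspects-≤ ∘ origin∈)))
      where
      sub : filter kill? is ⊆ concatMap suspects (x ∷ chosen)
      sub {j} p with ∈-filter⁻ kill? {xs = is} p
      ... | j∈ , u , v , u∈ , v∈ , e with K-origin u∈
      ... | y , y∈ , u∈y = ∈-concatMap suspects y∈ (suspect (origin∈ y∈) j∈ (u , v , u∈y , v∈ , e))

  pieceCost : ℕ → ℕ
  pieceCost d = suc d * (d + ballBound Δ 4 * d)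

  Inside : List I → ∀ {d} → Piece d → Set
  Inside is p = ∀ {v} → v ∈ body p → ∃ λ i → i ∈ is × v ∈ full i

  Extraction : ∀ d → List I → Set
  Extraction d is = Σ (Piece d) λ p → ∃ λ rest → rest ⊆ is × Unique rest × length is ≤ pieceCost d + length rest ×
    Inside is p × (∀ {j} → j ∈ rest → ¬ Touch (body p) (full j))

  abstract
    extract : ∀ d₀ is → Unique is → suc (suc d₀) ≤ length is → Extraction (suc (suc d₀)) is
    extract d₀ is uq d≤ = fromLocated (Locate.locate d₀ is uq d≤)
      where
      fromLocated : ∃₂ (Locate.Located d₀ is uq d≤) → Extraction (suc (suc d₀)) is
      fromLocated (m , x , m< , few , x∈ , big) =
        E.piece , filter (¬? ∘ E.kill?) is , (λ p → proj₁ (∈-filter⁻ (¬? ∘ E.kill?) {xs = is} p)) , Uniqueₚ.filter⁺ (¬? ∘ E.kill?) uq ,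
        ≤-trans (≤-reflexive (filter-split E.kill? is)) (+-monoˡ-≤ _ E.killed-≤) ,
        E.K-inside , λ j∈ → proj₂ (∈-filter⁻ (¬? ∘ E.kill?) {xs = is} j∈)
        where
        module E = Extract d₀ is uq m x m< few x∈ big

  -- Each extraction discards at most `pieceCost` teeth, and the last summand leaves enough teeth
  -- for every extraction to start. Later pieces lie in full teeth of the survivors, none of which
  -- touches an earlier piece.
  pieces : ∀ d₀ M is → Unique is → M * pieceCost (suc (suc d₀)) + suc (suc d₀) ≤ length is →
    ∃ λ ps → length ps ≡ M × AllPairs NonTouching ps × All (Inside is {suc (suc d₀)}) ps
  pieces d₀ zero    is uq le = [] , refl , [] , []
  pieces d₀ (suc M) is uq le = continue (extract d₀ is uq (≤-trans (m≤n+m _ (suc M * pieceCost (suc (suc d₀)))) le))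
    where
    continue : Extraction (suc (suc d₀)) is →
      ∃ λ ps → length ps ≡ suc M × AllPairs NonTouching ps × All (Inside is {suc (suc d₀)}) ps
    continue (p , rest , sub , uq′ , len , ins , far) = p ∷ proj₁ rec , cong suc (proj₁ (proj₂ rec)) ,
      All.map (λ {q} → far′ {q}) (proj₂ (proj₂ (proj₂ rec))) ∷ proj₁ (proj₂ (proj₂ rec)) ,
      ins ∷ All.map (λ {q} → widen {q}) (proj₂ (proj₂ (proj₂ rec)))
      where
      widen : ∀ {q : Piece (suc (suc d₀))} → Inside rest q → Inside is q
      widen f v∈ = let i , i∈ , q = f v∈ in i , sub i∈ , q
      rec = pieces d₀ M rest uq′ (+-cancelˡ-≤ (pieceCost (suc (suc d₀))) _ _
        (≤-trans (≤-reflexive (sym (+-assoc (pieceCost (suc (suc d₀))) _ _))) (≤-trans le len)))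
      far′ : ∀ {q : Piece (suc (suc d₀))} → Inside rest q → NonTouching p q
      far′ f (u , v , u∈ , v∈ , e) with f v∈
      ... | i , i∈ , v∈i = far i∈ (u , v , u∈ , v∈i , e)

-- Induced minors from clean subdivisions

module BranchSets (H G : Graph) where
  open Sets G

  model : (B : V H → List (V G)) → (∀ x → ∃ (_∈ B x)) → (∀ x → Conn (B x)) →
    (∀ {x y v} → v ∈ B x → v ∈ B y → x ≡ y) →
    (∀ {x y} → adj H x y ≡ true → ∃₂ λ u v → u ∈ B x × v ∈ B y × adj G u v ≡ true) →
    (∀ {x y u v} → x ≢ y → u ∈ B x → v ∈ B y → adj G u v ≡ true → adj H x y ≡ true) →
    InducedMinorModel H G
  model B ne cn dj fw bw = record
    { branch = branch
    ; nonempty = λ x → proj₁ (ne x) , intro (proj₂ (ne x))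
    ; connected = λ x u v p q → reach-mono intro (cn x (elim p) (elim q))
    ; edges = λ x y x≢y → mk⇔
        (λ e → let u , v , p , q , a = fw e in u , v , intro p , intro q , a)
        (λ (u , v , p , q , a) → bw x≢y (elim p) (elim q) a) }
    where
    branch : V G → Maybe (V H)
    branch v with Finₚ.any? (λ x → v ∈? B x)
    ... | yes (x , _) = just x
    ... | no _        = nothing
    intro : ∀ {x v} → v ∈ B x → branch v ≡ just x
    intro {x} {v} p with Finₚ.any? (λ x → v ∈? B x)
    ... | yes (y , q) = cong just (dj q p)
    ... | no none     = ⊥-elim (none (x , p))
    elim : ∀ {x v} → branch v ≡ just x → v ∈ B x
    elim {x} {v} e with Finₚ.any? (λ x → v ∈? B x)
    elim refl | yes (x , q) = q

SamePair : {A : Set} → A → A → A → A → Set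
SamePair x y x′ y′ = (x ≡ x′ × y ≡ y′) ⊎ (x ≡ y′ × y ≡ x′)

-- A subdivided graph realised without superfluous contacts: since every edge of Q
-- has its own connector, minors of Q turn into induced minors of G.
module CleanStructures (G : Graph) {Ix : Set} (_≟ⁱ_ : DecidableEquality Ix) where
  open Sets G

  record Edge (Al : Ix → Set) (Q : Ix → Ix → Bool) (x y : Ix) : Set where
    constructor edge
    field
      left  : Al x
      right : Al y
      ne    : x ≢ y
      join  : Q x y ≡ true

  -- `Al` selects the indices in use and `Q` the edges of the abstract graph. All conditions are
  -- demanded only there, so discarding vertices (`shrink`) is free.
  record Clean (Al : Ix → Set) (Q : Ix → Ix → Bool) : Set where
    field
      hub      : Ix → List (V G)
      con      : Ix → Ix → List (V G)
      hub-pt   : ∀ {x} → Al x → ∃ (_∈ hub x)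
      hub-conn : ∀ {x} → Al x → Conn (hub x)
      hub-far  : ∀ {x y} → Al x → Al y → Touch (hub x) (hub y) → x ≡ y
      con-conn : ∀ {x y} → Edge Al Q x y → Conn (con x y)
      con-l    : ∀ {x y} → Edge Al Q x y → Touch (con x y) (hub x)
      con-r    : ∀ {x y} → Edge Al Q x y → Touch (con x y) (hub y)
      con-out  : ∀ {x y z v} → Edge Al Q x y → Al z → v ∈ con x y → v ∉ hub z
      con-hub  : ∀ {x y z} → Edge Al Q x y → Al z → Touch (con x y) (hub z) → z ≡ x ⊎ z ≡ y
      con-con  : ∀ {x y x′ y′} → Edge Al Q x y → Edge Al Q x′ y′ → Touch (con x y) (con x′ y′) → SamePair x y x′ y′

  shrink : ∀ {Al Al′ Q} → (∀ {x} → Al′ x → Al x) → Clean Al Q → Clean Al′ Q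
  shrink {Al} {Al′} {Q} f C = record
    { hub = hub ; con = con ; hub-pt = hub-pt ∘ f ; hub-conn = hub-conn ∘ f ; hub-far = λ p q → hub-far (f p) (f q)
    ; con-conn = con-conn ∘ g ; con-l = con-l ∘ g ; con-r = con-r ∘ g ; con-out = λ e z → con-out (g e) (f z)
    ; con-hub = λ e z → con-hub (g e) (f z) ; con-con = λ e e′ → con-con (g e) (g e′) }
    where
    open Clean C
    g : ∀ {x y} → Edge Al′ Q x y → Edge Al Q x y
    g (edge l r n j) = edge (f l) (f r) n j

  module _ (H : Graph) {Al : Ix → Set} {Q : Ix → Ix → Bool} (C : Clean Al Q) (f : V H → Ix)
           (f-inj : ∀ {x y} → f x ≡ f y → x ≡ y) (f-al : ∀ x → Al (f x))
           (f-Q : ∀ {x y} → x ≢ y → Q (f x) (f y) ≡ true) where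
    open Clean C
    open BranchSets H G

    private
      Up : V H → V H → Set
      Up x y = x <ᶠ y × adj H x y ≡ true
      up? : ∀ x y → Dec (Up x y)
      up? x y = (x Finₚ.<? y) ×-dec (adj H x y Boolₚ.≟ true)
      ups : V H → List (V H)
      ups x = filter (up? x) (allFin (order H))
      B : V H → List (V G)
      B x = hub (f x) ++ concatMap (λ y → con (f x) (f y)) (ups x)
      ups⁻ : ∀ {x y} → y ∈ ups x → Up x y
      ups⁻ {x} p = proj₂ (∈-filter⁻ (up? x) {xs = allFin (order H)} p)
      E : ∀ {x y} → x ≢ y → Edge Al Q (f x) (f y)
      E ne = edge (f-al _) (f-al _) (ne ∘ f-inj) (f-Q ne)
      up-≢ : ∀ {x y} → Up x y → x ≢ y
      up-≢ (lt , _) = Finₚ.<⇒≢ lt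
      data Part (x : V H) (v : V G) : Set where
        inHub : v ∈ hub (f x) → Part x v
        inCon : ∀ y → Up x y → v ∈ con (f x) (f y) → Part x v
      part : ∀ {x v} → v ∈ B x → Part x v
      part {x} p with ∈-++⁻ (hub (f x)) p
      ... | inj₁ q = inHub q
      ... | inj₂ q with ∈-concatMap⁻′ (λ y → con (f x) (f y)) (ups x) q
      ... | y , y∈ , r = inCon y (ups⁻ y∈) r
      hub∈ : ∀ {x v} → v ∈ hub (f x) → v ∈ B x
      hub∈ = ∈-++⁺ˡ
      con∈ : ∀ {x y v} → Up x y → v ∈ con (f x) (f y) → v ∈ B x
      con∈ {x} {y} u p = ∈-++⁺ʳ (hub (f x)) (∈-concatMap (λ y → con (f x) (f y)) (∈-filter⁺ (up? x) (∈-allFin y) u) p)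

      meet : ∀ {x y u v} → x ≢ y → Part x u → Part y v → u ~ v → adj H x y ≡ true × u ≢ v
      meet ne (inHub p) (inHub q) e = ⊥-elim (ne (f-inj (hub-far (f-al _) (f-al _) (_ , _ , p , q , e))))
      meet {x} {y} ne (inHub p) (inCon z uz q) e with con-hub (E (up-≢ uz)) (f-al x) (_ , _ , q , p , ~-sym e)
      ... | inj₁ r = ⊥-elim (ne (f-inj r))
      ... | inj₂ r with f-inj r
      ... | refl = trans (adj-sym H x y) (proj₂ uz) , λ { refl → con-out (E (up-≢ uz)) (f-al x) q p }
      meet {x} {y} ne (inCon z uz p) (inHub q) e with con-hub (E (up-≢ uz)) (f-al y) (_ , _ , p , q , e)
      ... | inj₁ r = ⊥-elim (ne (sym (f-inj r)))
      ... | inj₂ r with f-inj r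
      ... | refl = proj₂ uz , λ { refl → con-out (E (up-≢ uz)) (f-al y) p q }
      meet {x} {y} ne (inCon z uz p) (inCon z′ uz′ q) e with con-con (E (up-≢ uz)) (E (up-≢ uz′)) (_ , _ , p , q , e)
      ... | inj₁ (r , _) = ⊥-elim (ne (f-inj r))
      ... | inj₂ (r , s) with f-inj r | f-inj s
      ... | refl | refl = ⊥-elim (Finₚ.<-asym (proj₁ uz) (proj₁ uz′))

      forward : ∀ {x y} → Up x y → ∃₂ λ u v → u ∈ B x × v ∈ B y × adj G u v ≡ true
      forward {x} {y} uxy with con-r (E (up-≢ uxy))
      ... | u , v , p , q , inj₂ a = u , v , con∈ uxy p , hub∈ q , a
      ... | u , v , p , q , inj₁ refl = ⊥-elim (con-out (E (up-≢ uxy)) (f-al y) p q)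

    -- The connector of an edge `xy` of `H` with `x` before `y` goes into the branch set of `x`, and
    -- connectors of non-edges are left out. The only contacts between branch sets are then those of
    -- a connector with the hub at its far end.
    complete⇒model : InducedMinorModel H G
    complete⇒model = model B
      (λ x → proj₁ (hub-pt (f-al x)) , hub∈ (proj₂ (hub-pt (f-al x))))
      (λ x → conn-star (λ y → con (f x) (f y)) (ups x) (hub-conn (f-al x))
               (λ y∈ → con-conn (E (up-≢ (ups⁻ y∈)))) (λ y∈ → touch-sym (con-l (E (up-≢ (ups⁻ y∈))))))
      dj fw (λ ne p q a → proj₁ (meet ne (part p) (part q) (inj₂ a)))
      where
      dj : ∀ {x y v} → v ∈ B x → v ∈ B y → x ≡ y
      dj {x} {y} p q with x ≟ y
      ... | yes e = e
      ... | no ne = ⊥-elim (proj₂ (meet ne (part p) (part q) (inj₁ refl)) refl)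
      fw : ∀ {x y} → adj H x y ≡ true → ∃₂ λ u v → u ∈ B x × v ∈ B y × adj G u v ≡ true
      fw {x} {y} a with Finₚ.<-cmp x y
      ... | tri< lt _ _ = forward (lt , a)
      ... | tri≈ _ refl _ = ⊥-elim (Sets.adj-≢ H a refl)
      ... | tri> _ _ gt with forward (gt , Sets.adj-symm H a)
      ... | u , v , p , q , b = v , u , q , p , adj-symm b

  module Contraction {Al : Ix → Set} {Q : Ix → Ix → Bool} (C : Clean Al Q)
                     (Q-sym : ∀ x y → Q x y ≡ Q y x) {u v : Ix} (e₀ : Edge Al Q u v) where
    open Clean C
    open Edge e₀

    π : Ix → Ix
    π z with z ≟ⁱ v
    ... | yes _ = u
    ... | no  _ = z

    π-v : π v ≡ u
    π-v with v ≟ⁱ v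
    ... | yes _ = refl
    ... | no ¬p = ⊥-elim (¬p refl)

    π-id : ∀ {z} → z ≢ v → π z ≡ z
    π-id {z} ne with z ≟ⁱ v
    ... | yes p = ⊥-elim (ne p)
    ... | no _  = refl

    -- The old edge whose connector realises an edge of the contracted graph. If a vertex was joined
    -- to both `u` and `v`, the connector at `u` is kept and the one at `v` is forgotten, so no
    -- parallel connectors arise.
    ends : Ix → Ix → Ix × Ix
    ends x y with x ≟ⁱ u | y ≟ⁱ u
    ... | yes _ | _     = (if Q u y then u else v) , y
    ... | no  _ | yes _ = x , (if Q x u then u else v)
    ... | no  _ | no  _ = x , y

    _∨ᵇ_ : Bool → Bool → Bool
    true  ∨ᵇ _ = true
    false ∨ᵇ b = b

    Q′ : Ix → Ix → Bool
    Q′ x y with x ≟ⁱ y | x ≟ⁱ u | y ≟ⁱ u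
    ... | yes _ | _     | _     = false
    ... | no  _ | yes _ | _     = Q u y ∨ᵇ Q v y
    ... | no  _ | no  _ | yes _ = Q x u ∨ᵇ Q x v
    ... | no  _ | no  _ | no  _ = Q x y

    Al′ : Ix → Set
    Al′ z = Al z × z ≢ v

    hub′ : Ix → List (V G)
    hub′ z with z ≟ⁱ u
    ... | yes _ = (hub u ++ con u v) ++ hub v
    ... | no  _ = hub z

    con′ : Ix → Ix → List (V G)
    con′ x y = con (proj₁ (ends x y)) (proj₂ (ends x y))

    u≢v = ne

    origin : ∀ {x y} → Edge Al′ Q′ x y →
      Edge Al Q (proj₁ (ends x y)) (proj₂ (ends x y)) × π (proj₁ (ends x y)) ≡ x × π (proj₂ (ends x y)) ≡ y
    origin {x} {y} (edge (ax , x≢v) (ay , y≢v) x≢y q) with x ≟ⁱ y | x ≟ⁱ u | y ≟ⁱ u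
    ... | yes p | _ | _ = ⊥-elim (x≢y p)
    ... | no _ | yes refl | _ with Q x y in eq
    ...   | true  = edge ax ay x≢y eq , π-id x≢v , π-id y≢v
    ...   | false = edge right ay (y≢v ∘ sym) q , π-v , π-id y≢v
    origin {x} {y} (edge (ax , x≢v) (ay , y≢v) x≢y q) | no _ | no _ | yes refl with Q x y in eq
    ...   | true  = edge ax ay x≢y eq , π-id x≢v , π-id y≢v
    ...   | false = edge ax right x≢v q , π-id x≢v , π-v
    origin {x} {y} (edge (ax , x≢v) (ay , y≢v) x≢y q) | no _ | no _ | no _ = edge ax ay x≢y q , π-id x≢v , π-id y≢v

    data Part (z : Ix) (w : V G) : Set where
      old : ∀ {z₀} → Al z₀ → π z₀ ≡ z → w ∈ hub z₀ → Part z w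
      new : z ≡ u → w ∈ con u v → Part z w

    part : ∀ {z w} → Al′ z → w ∈ hub′ z → Part z w
    part {z} (az , z≢v) p with z ≟ⁱ u
    ... | no _ = old az (π-id z≢v) p
    ... | yes refl with ∈-++⁻ (hub z ++ con z v) p
    ...   | inj₂ q = old right π-v q
    ...   | inj₁ q with ∈-++⁻ (hub z) q
    ...     | inj₁ r = old az (π-id z≢v) r
    ...     | inj₂ r = new refl r

    hub⊆ : ∀ {z₀ z} → Al z₀ → π z₀ ≡ z → hub z₀ ⊆ hub′ z
    hub⊆ {z₀} {z} a refl p with z₀ ≟ⁱ v
    hub⊆ {z₀} a refl p | yes refl with u ≟ⁱ u
    ... | yes _ = ∈-++⁺ʳ (hub u ++ con u v) p
    ... | no ¬p = ⊥-elim (¬p refl)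
    hub⊆ {z₀} a refl p | no _ with z₀ ≟ⁱ u
    ... | yes refl = ∈-++⁺ˡ (∈-++⁺ˡ p)
    ... | no _     = p

    private
      not-e₀ : ∀ {x y x₀ y₀} → x ≢ y → π x₀ ≡ x → π y₀ ≡ y → ¬ SamePair x₀ y₀ u v
      not-e₀ x≢y refl refl (inj₁ (refl , refl)) = x≢y (trans (π-id u≢v) (sym π-v))
      not-e₀ x≢y refl refl (inj₂ (refl , refl)) = x≢y (trans π-v (sym (π-id u≢v)))

    contract : Clean Al′ Q′
    contract = record
      { hub = hub′ ; con = con′
      ; hub-pt = λ { {x} (ax , x≢v) → let w , p = hub-pt ax in w , hub⊆ ax (π-id x≢v) p }
      ; hub-conn = hc
      ; hub-far = λ ax ay (w , w′ , p , p′ , e) → far (part ax p) (part ay p′) e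
      ; con-conn = λ e → con-conn (proj₁ (origin e))
      ; con-l = λ e → let e₁ , p , _ = origin e in touch-mono id (hub⊆ (Edge.left e₁) p) (con-l e₁)
      ; con-r = λ e → let e₁ , _ , p = origin e in touch-mono id (hub⊆ (Edge.right e₁) p) (con-r e₁)
      ; con-out = λ e az p q → out e p (part az q)
      ; con-hub = λ e az (w , w′ , p , p′ , t) → ch e p (part az p′) t
      ; con-con = λ e e′ t → cc e e′ t }
      where
      hc : ∀ {x} → Al′ x → Conn (hub′ x)
      hc {x} (ax , _) with x ≟ⁱ u
      ... | no _ = hub-conn ax
      ... | yes refl = conn-++ (conn-++ (hub-conn left) (con-conn e₀) (touch-sym (con-l e₀))) (hub-conn right)
                         (touch-mono (∈-++⁺ʳ (hub u)) id (con-r e₀))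
      far : ∀ {x y w w′} → Part x w → Part y w′ → w ~ w′ → x ≡ y
      far (old a refl p) (old a′ refl p′) t = cong π (hub-far a a′ (_ , _ , p , p′ , t))
      far (new refl p) (new refl p′) t = refl
      far (old a refl p) (new refl p′) t with con-hub e₀ a (_ , _ , p′ , p , ~-sym t)
      ... | inj₁ refl = π-id u≢v
      ... | inj₂ refl = π-v
      far (new refl p) (old a refl p′) t with con-hub e₀ a (_ , _ , p , p′ , t)
      ... | inj₁ refl = sym (π-id u≢v)
      ... | inj₂ refl = sym π-v
      out : ∀ {x y z w} → Edge Al′ Q′ x y → w ∈ con′ x y → Part z w → ⊥
      out e p (old a _ q) = con-out (proj₁ (origin e)) a p q
      out e p (new refl q) with origin e
      ... | e₁ , r , s = not-e₀ (Edge.ne e) r s (con-con e₁ e₀ (_ , _ , p , q , inj₁ refl))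
      ch : ∀ {x y z w w′} → Edge Al′ Q′ x y → w ∈ con′ x y → Part z w′ → w ~ w′ → z ≡ x ⊎ z ≡ y
      ch e p (old a refl q) t with origin e
      ... | e₁ , r , s with con-hub e₁ a (_ , _ , p , q , t)
      ... | inj₁ m = inj₁ (trans (cong π m) r)
      ... | inj₂ m = inj₂ (trans (cong π m) s)
      ch e p (new refl q) t with origin e
      ... | e₁ , r , s = ⊥-elim (not-e₀ (Edge.ne e) r s (con-con e₁ e₀ (_ , _ , p , q , t)))
      cc : ∀ {x y x′ y′} → Edge Al′ Q′ x y → Edge Al′ Q′ x′ y′ → Touch (con′ x y) (con′ x′ y′) → SamePair x y x′ y′
      cc e e′ t with origin e | origin e′
      ... | e₁ , r , s | e₂ , r′ , s′ with con-con e₁ e₂ t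
      ... | inj₁ (m , m′) = inj₁ (trans (sym r) (trans (cong π m) r′) , trans (sym s) (trans (cong π m′) s′))
      ... | inj₂ (m , m′) = inj₂ (trans (sym r) (trans (cong π m) s′) , trans (sym s) (trans (cong π m′) r′))

    Q′-sym : ∀ x y → Q′ x y ≡ Q′ y x
    Q′-sym x y with x ≟ⁱ y | y ≟ⁱ x | x ≟ⁱ u | y ≟ⁱ u
    ... | yes _ | yes _ | _ | _ = refl
    ... | yes p | no ¬q | _ | _ = ⊥-elim (¬q (sym p))
    ... | no ¬p | yes q | _ | _ = ⊥-elim (¬p (sym q))
    ... | no ¬p | no _ | yes refl | yes refl = ⊥-elim (¬p refl)
    ... | no _ | no _ | yes refl | no _ = cong₂ _∨ᵇ_ (Q-sym u y) (Q-sym v y)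
    ... | no _ | no _ | no _ | yes refl = cong₂ _∨ᵇ_ (Q-sym x u) (Q-sym x v)
    ... | no _ | no _ | no _ | no _ = Q-sym x y

    Q′-irrefl : ∀ x → Q′ x x ≡ false
    Q′-irrefl x with x ≟ⁱ x
    ... | yes _ = refl
    ... | no ¬p = ⊥-elim (¬p refl)

    Q′-u : ∀ {y} → y ≢ u → Q′ u y ≡ Q u y ∨ᵇ Q v y
    Q′-u {y} ne with u ≟ⁱ y | u ≟ⁱ u | y ≟ⁱ u
    ... | yes p | _ | _ = ⊥-elim (ne (sym p))
    ... | no _ | yes _ | _ = refl
    ... | no _ | no ¬p | _ = ⊥-elim (¬p refl)

    Q′-old : ∀ {x y} → x ≢ u → y ≢ u → x ≢ y → Q′ x y ≡ Q x y
    Q′-old {x} {y} nx ny nxy with x ≟ⁱ y | x ≟ⁱ u | y ≟ⁱ u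
    ... | yes p | _ | _ = ⊥-elim (nxy p)
    ... | no _ | yes p | _ = ⊥-elim (nx p)
    ... | no _ | no _ | yes p = ⊥-elim (ny p)
    ... | no _ | no _ | no _ = refl

-- Dense graphs have complete minors

b2n : Bool → ℕ
b2n true  = 1
b2n false = 0

Sm : {A : Set} → (A → ℕ) → List A → ℕ
Sm f []       = 0
Sm f (x ∷ xs) = f x + Sm f xs

Sm-cong : {A : Set} {f g : A → ℕ} (xs : List A) → (∀ {x} → x ∈ xs → f x ≡ g x) → Sm f xs ≡ Sm g xs
Sm-cong []       h = refl
Sm-cong (x ∷ xs) h = cong₂ _+_ (h (here refl)) (Sm-cong xs (h ∘ there))

Sm-+ : {A : Set} (f g : A → ℕ) (xs : List A) → Sm (λ x → f x + g x) xs ≡ Sm f xs + Sm g xs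
Sm-+ f g []       = refl
Sm-+ f g (x ∷ xs) = trans (cong ((f x + g x) +_) (Sm-+ f g xs)) (interchange (f x) (g x) (Sm f xs) (Sm g xs))
  where
  interchange : ∀ a b c d → (a + b) + (c + d) ≡ (a + c) + (b + d)
  interchange = solve-∀

Sm-const-≤ : {A : Set} {f : A → ℕ} (c : ℕ) (xs : List A) → (∀ {x} → x ∈ xs → c ≤ f x) → length xs * c ≤ Sm f xs
Sm-const-≤ c []       h = z≤n
Sm-const-≤ c (x ∷ xs) h = +-mono-≤ (h (here refl)) (Sm-const-≤ c xs (h ∘ there))

Sm-zero : {A : Set} {f : A → ℕ} (xs : List A) → (∀ {x} → x ∈ xs → f x ≡ 0) → Sm f xs ≡ 0
Sm-zero []       h = refl
Sm-zero (x ∷ xs) h = cong₂ _+_ (h (here refl)) (Sm-zero xs (h ∘ there))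

Sm-filter : {A : Set} (p q : A → Bool) (xs : List A) →
  Sm (b2n ∘ q) (filter (λ y → p y Boolₚ.≟ true) xs) ≡ Sm (λ y → b2n (p y ∧ q y)) xs
Sm-filter p q [] = refl
Sm-filter p q (x ∷ xs) with p x
... | true  = cong (b2n (q x) +_) (Sm-filter p q xs)
... | false = Sm-filter p q xs

module Mader (G : Graph) {Ix : Set} (_≟ⁱ_ : DecidableEquality Ix) where
  open CleanStructures G _≟ⁱ_

  del : Ix → List Ix → List Ix
  del v = filter (λ z → ¬? (z ≟ⁱ v))

  del-∈ : ∀ {v xs z} → z ∈ xs → z ≢ v → z ∈ del v xs
  del-∈ {v} = ∈-filter⁺ (λ z → ¬? (z ≟ⁱ v))

  del-∈⁻ : ∀ {v xs z} → z ∈ del v xs → z ∈ xs × z ≢ v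
  del-∈⁻ {v} {xs} = ∈-filter⁻ (λ z → ¬? (z ≟ⁱ v)) {xs = xs}

  Sm-del : ∀ {f v xs} → Unique xs → v ∈ xs → Sm f xs ≡ f v + Sm f (del v xs)
  Sm-del {f} {v} {x ∷ xs} (x∉ ∷ uq) p with x ≟ⁱ v
  ... | yes refl = cong (λ l → f x + Sm f l) (sym (filter-all (λ z → ¬? (z ≟ⁱ x)) (All.map (λ ne e → ne (sym e)) x∉)))
  Sm-del {f} {v} {x ∷ xs} (x∉ ∷ uq) (here p) | no ne = ⊥-elim (ne (sym p))
  Sm-del {f} {v} {x ∷ xs} (x∉ ∷ uq) (there p) | no ne = trans (cong (f x +_) (Sm-del uq p)) (swap (f x) (f v) _)
    where
    swap : ∀ a b c → a + (b + c) ≡ b + (a + c)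
    swap = solve-∀

  length-del : ∀ {v xs} → Unique xs → v ∈ xs → length xs ≡ suc (length (del v xs))
  length-del {v} {xs} uq p = trans (len xs) (trans (Sm-del uq p) (cong suc (sym (len (del v xs)))))
    where
    len : ∀ (xs : List Ix) → length xs ≡ Sm (λ _ → 1) xs
    len []       = refl
    len (x ∷ xs) = cong suc (len xs)

  row : (Ix → Ix → Bool) → List Ix → Ix → ℕ
  row Q al x = Sm (b2n ∘ Q x) al

  degrees : (Ix → Ix → Bool) → List Ix → ℕ
  degrees Q al = Sm (row Q al) al

  common : (Ix → Ix → Bool) → List Ix → Ix → Ix → ℕ
  common Q al u v = Sm (λ y → b2n (Q u y ∧ Q v y)) al

  module Count {Al Q} (C : Clean Al Q) (Q-sym : ∀ x y → Q x y ≡ Q y x) (Q-irr : ∀ x → Q x x ≡ false)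
               {al} (uq : Unique al) {u v} (u∈ : u ∈ al) (v∈ : v ∈ al) (e₀ : Edge Al Q u v) where
    open Contraction C Q-sym e₀
    open Edge e₀ using (ne; join)

    R = del u (del v al)

    R-spec : ∀ {x} → x ∈ R → x ≢ u × x ≢ v
    R-spec p = let q , a = del-∈⁻ {u} {del v al} p in a , proj₂ (del-∈⁻ {v} {al} q)

    split′ : ∀ f → Sm f (del v al) ≡ f u + Sm f R
    split′ f = Sm-del (Uniqueₚ.filter⁺ (λ z → ¬? (z ≟ⁱ v)) uq) (del-∈ u∈ ne)

    split : ∀ f → Sm f al ≡ f v + (f u + Sm f R)
    split f = trans (Sm-del uq v∈) (cong (f v +_) (split′ f))

    or-and : ∀ p q → b2n p + b2n q ≡ b2n (p ∨ᵇ q) + b2n (p ∧ q)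
    or-and true  true  = refl
    or-and true  false = refl
    or-and false true  = refl
    or-and false false = refl

    cm = Sm (λ y → b2n (Q u y ∧ Q v y)) R
    cm-eq : common Q al u v ≡ cm
    cm-eq rewrite split (λ y → b2n (Q u y ∧ Q v y)) | Q-irr v | Q-irr u | Boolₚ.∧-zeroʳ (Q u v) = refl

    J = Sm (b2n ∘ Q′ u) R
    T = Sm (λ x → Sm (b2n ∘ Q x) R) R

    both : Sm (b2n ∘ Q u) R + Sm (b2n ∘ Q v) R ≡ J + cm
    both = trans (sym (Sm-+ (b2n ∘ Q u) (b2n ∘ Q v) R))
      (trans (Sm-cong R (λ {y} y∈ → trans (or-and (Q u y) (Q v y))
                (cong (λ q → b2n q + b2n (Q u y ∧ Q v y)) (sym (Q′-u (proj₁ (R-spec y∈)))))))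
        (Sm-+ (b2n ∘ Q′ u) (λ y → b2n (Q u y ∧ Q v y)) R))

    rows : ∀ x → row Q al x ≡ b2n (Q x v) + (b2n (Q x u) + Sm (b2n ∘ Q x) R)
    rows x = split (b2n ∘ Q x)

    rest : Sm (row Q al) R ≡ (J + cm) + T
    rest = trans (Sm-cong R (λ {x} _ → trans (rows x) (trans (cong₂ (λ p q → b2n p + (b2n q + Sm (b2n ∘ Q x) R)) (Q-sym x v) (Q-sym x u))
               (reorder (b2n (Q v x)) (b2n (Q u x)) _))))
             (trans (Sm-+ (λ x → b2n (Q u x) + b2n (Q v x)) (λ x → Sm (b2n ∘ Q x) R) R)
               (cong (_+ T) (trans (Sm-+ (b2n ∘ Q u) (b2n ∘ Q v) R) both)))
      where
      reorder : ∀ a b c → a + (b + c) ≡ (b + a) + c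
      reorder = solve-∀

    total : degrees Q al ≡ 2 + ((J + cm) + ((J + cm) + T))
    total = trans (split (row Q al)) (trans (cong₂ _+_ (rows v) (cong₂ _+_ (rows u) rest)) eq)
      where
      final : ∀ su sv k → (0 + (1 + sv)) + ((1 + (0 + su)) + k) ≡ 2 + ((su + sv) + k)
      final = solve-∀
      eq : (b2n (Q v v) + (b2n (Q v u) + Sm (b2n ∘ Q v) R)) + ((b2n (Q u v) + (b2n (Q u u) + Sm (b2n ∘ Q u) R)) + ((J + cm) + T))
           ≡ 2 + ((J + cm) + ((J + cm) + T))
      eq rewrite Q-irr v | Q-irr u | Q-sym v u | join =
        trans (final (Sm (b2n ∘ Q u) R) (Sm (b2n ∘ Q v) R) ((J + cm) + T)) (cong (λ z → 2 + (z + ((J + cm) + T))) both)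

    total′ : degrees Q′ (del v al) ≡ J + (J + T)
    total′ = trans (split′ (row Q′ (del v al))) (cong₂ _+_ rowU (trans (Sm-cong R rowX)
               (Sm-+ (b2n ∘ Q′ u) (λ x → Sm (b2n ∘ Q x) R) R)))
      where
      rowU : row Q′ (del v al) u ≡ J
      rowU = trans (split′ (b2n ∘ Q′ u)) (cong (λ q → b2n q + J) (Q′-irrefl u))
      same : ∀ {x y} → x ∈ R → y ∈ R → b2n (Q′ x y) ≡ b2n (Q x y)
      same {x} {y} p q = aux (x ≟ⁱ y)
        where
        aux : Dec (x ≡ y) → b2n (Q′ x y) ≡ b2n (Q x y)
        aux (yes refl) = cong b2n (trans (Q′-irrefl x) (sym (Q-irr x)))
        aux (no nxy)   = cong b2n (Q′-old (proj₁ (R-spec p)) (proj₁ (R-spec q)) nxy)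
      rowX : ∀ {x} → x ∈ R → row Q′ (del v al) x ≡ b2n (Q′ u x) + Sm (b2n ∘ Q x) R
      rowX {x} p = trans (split′ (b2n ∘ Q′ x)) (cong₂ _+_ (cong b2n (Q′-sym x u)) (Sm-cong R (same p)))

    -- Contracting `uv` destroys that edge and merges two edges at every common neighbour; degree
    -- sums count edges twice. Over the remaining vertices `R`, `J` is the degree of the merged
    -- vertex and `T` the degree sum inside `R`.
    loss : degrees Q al ≡ degrees Q′ (del v al) + 2 * suc (common Q al u v)
    loss = trans total (trans (arith J cm T) (sym (cong₂ (λ a b → a + 2 * suc b) total′ cm-eq)))
      where
      arith : ∀ j c t → 2 + ((j + c) + ((j + c) + t)) ≡ (j + (j + t)) + 2 * suc c
      arith = solve-∀

  record Complete (h : ℕ) : Set₁ where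
    field
      {Al}  : Ix → Set
      {Q}   : Ix → Ix → Bool
      cs    : Clean Al Q
      f     : Fin h → Ix
      f-inj : ∀ {i j} → f i ≡ f j → i ≡ j
      f-al  : ∀ i → Al (f i)
      f-Q   : ∀ {i j} → i ≢ j → Q (f i) (f j) ≡ true

  -- Invariant of the search: `ks` holds the clique vertices already won, all of them joined to
  -- `al`, the graph in which the next one is sought.
  record State (ks al : List Ix) (Q : Ix → Ix → Bool) : Set where
    field
      cs    : Clean (λ z → z ∈ ks ⊎ z ∈ al) Q
      sym-Q : ∀ x y → Q x y ≡ Q y x
      irr-Q : ∀ x → Q x x ≡ false
      uqk   : Unique ks
      uqa   : Unique al
      dis   : ∀ {x} → x ∈ ks → x ∉ al
      kk    : ∀ {x y} → x ∈ ks → y ∈ ks → x ≢ y → Q x y ≡ true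
      ka    : ∀ {x y} → x ∈ ks → y ∈ al → Q x y ≡ true

  finish : ∀ {ks al Q} h → State ks al Q → length ks ≡ h → Complete h
  finish {ks} h S refl = record
    { cs = cs ; f = lookup ks ; f-inj = λ {i} {j} → Menger.lookup-inj _≟ⁱ_ uqk i j ; f-al = λ i → inj₁ (∈-lookup i)
    ; f-Q = λ {i} {j} ne → kk (∈-lookup i) (∈-lookup j) (ne ∘ Menger.lookup-inj _≟ⁱ_ uqk i j) }
    where
    open State S

  contractState : ∀ {ks al Q u v} → State ks al Q → u ∈ al → v ∈ al → Q u v ≡ true →
    ∃ λ Q′ → State ks (del v al) Q′ × degrees Q al ≡ degrees Q′ (del v al) + 2 * suc (common Q al u v)
  contractState {ks} {al} {Q} {u} {v} S u∈ v∈ q = Q′ , record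
    { cs = shrink al′ contract ; sym-Q = Q′-sym ; irr-Q = Q′-irrefl ; uqk = uqk ; uqa = Uniqueₚ.filter⁺ (λ z → ¬? (z ≟ⁱ v)) uqa
    ; dis = λ p r → dis p (proj₁ (del-∈⁻ r)) ; kk = λ p r ne → trans (Q′-old (k≢ p u∈) (k≢ r u∈) ne) (kk p r ne)
    ; ka = λ p r → ka′ p (proj₁ (del-∈⁻ r)) } , Count.loss cs sym-Q irr-Q uqa u∈ v∈ e₀
    where
    open State S
    u≢v : u ≢ v
    u≢v refl with trans (sym q) (irr-Q u)
    ... | ()
    e₀ = edge (inj₂ u∈) (inj₂ v∈) u≢v q
    open Contraction cs sym-Q e₀
    k≢ : ∀ {x y} → x ∈ ks → y ∈ al → x ≢ y
    k≢ p r refl = dis p r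
    al′ : ∀ {x} → x ∈ ks ⊎ x ∈ del v al → Al′ x
    al′ (inj₁ p) = inj₁ p , k≢ p v∈
    al′ (inj₂ p) = inj₂ (proj₁ (del-∈⁻ p)) , proj₂ (del-∈⁻ {v} {al} p)
    ka′ : ∀ {x y} → x ∈ ks → y ∈ al → Q′ x y ≡ true
    ka′ {x} {y} p r = aux (y ≟ⁱ u)
      where
      aux : Dec (y ≡ u) → Q′ x y ≡ true
      aux (yes refl) = trans (Q′-sym x y) (trans (Q′-u (k≢ p r)) (cong (_∨ᵇ Q v x) (trans (sym-Q u x) (ka p r))))
      aux (no ne)    = trans (Q′-old (k≢ p u∈) ne (k≢ p r)) (ka p r)

  apexState : ∀ {ks al Q v} → State ks al Q → v ∈ al → State (v ∷ ks) (filter (λ y → Q v y Boolₚ.≟ true) al) Q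
  apexState {ks} {al} {Q} {v} S v∈ = record
    { cs = shrink (λ { (inj₁ (here refl)) → inj₂ v∈ ; (inj₁ (there p)) → inj₁ p ; (inj₂ p) → inj₂ (proj₁ (N p)) }) cs
    ; sym-Q = sym-Q ; irr-Q = irr-Q ; uqk = All.tabulate (λ p → λ { refl → dis p v∈ }) ∷ uqk
    ; uqa = Uniqueₚ.filter⁺ (λ y → Q v y Boolₚ.≟ true) uqa
    ; dis = λ { (here refl) p → contra (proj₂ (N p)) ; (there q) p → dis q (proj₁ (N p)) }
    ; kk = λ { (here refl) (here refl) ne → ⊥-elim (ne refl) ; (here refl) (there q) _ → trans (sym-Q v _) (ka q v∈)
             ; (there p) (here refl) _ → ka p v∈ ; (there p) (there q) → kk p q }
    ; ka = λ { (here refl) p → proj₂ (N p) ; (there q) p → ka q (proj₁ (N p)) } }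
    where
    open State S
    N : ∀ {y} → y ∈ filter (λ y → Q v y Boolₚ.≟ true) al → y ∈ al × Q v y ≡ true
    N = ∈-filter⁻ (λ y → Q v y Boolₚ.≟ true) {xs = al}
    contra : Q v v ≡ true → ⊥
    contra q with trans (sym q) (irr-Q v)
    ... | ()

  -- Average degree at least `2 ^ suc h`, the density from which a complete minor on `h` vertices is
  -- extracted.
  Dense : ℕ → (Ix → Ix → Bool) → List Ix → Set
  Dense h Q al = 1 ≤ length al × 2 * 2 ^ h * length al ≤ degrees Q al

  -- Contract an edge lying in few triangles; if there is none, then the
  -- neighbourhood of any vertex is dense again.
  reduce : ∀ h {ks al Q} → State ks al Q → Dense (suc h) Q al →
    (∃₂ λ al′ Q′ → State ks al′ Q′ × suc (length al′) ≡ length al × Dense (suc h) Q′ al′) ⊎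
    (∃₂ λ v al′ → State (v ∷ ks) al′ Q × Dense h Q al′)
  reduce h {ks} {al} {Q} S (ne , dense) =
    search (any? (λ u → any? (λ v → (Q u v Boolₚ.≟ true) ×-dec (suc (common Q al u v) ≤? 2 ^ suc h)) al) al)
           (any? (λ u → any? (λ v → Q u v Boolₚ.≟ true) al) al)
    where
    open State S
    absurd : true ≢ false
    absurd ()
    Goal = (∃₂ λ al′ Q′ → State ks al′ Q′ × suc (length al′) ≡ length al × Dense (suc h) Q′ al′) ⊎
           (∃₂ λ v al′ → State (v ∷ ks) al′ Q × Dense h Q al′)
    Poor = Any (λ u → Any (λ v → Q u v ≡ true × suc (common Q al u v) ≤ 2 ^ suc h) al) al
    -- One vertex fewer lowers the required degree sum by `2 * 2 ^ suc h`, which is at least what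
    -- the contraction loses.
    poor : ∀ {u v} → u ∈ al → v ∈ al → Q u v ≡ true → suc (common Q al u v) ≤ 2 ^ suc h → Goal
    poor {u} {v} u∈ v∈ e few with contractState S u∈ v∈ e
    ... | Q′ , S′ , loss = inj₁ (del v al , Q′ , S′ , sym len , ne′ , dense′)
      where
      len = length-del uqa v∈
      ne′ : 1 ≤ length (del v al)
      ne′ = ∈-length (del-∈ u∈ λ { refl → ⊥-elim (absurd (trans (sym e) (irr-Q u))) })
      dense′ : 2 * 2 ^ suc h * length (del v al) ≤ degrees Q′ (del v al)
      dense′ = +-cancelʳ-≤ (2 * 2 ^ suc h) _ _ (≤-trans (≤-reflexive (trans (+-comm _ (2 * 2 ^ suc h))
        (trans (sym (*-suc (2 * 2 ^ suc h) _)) (cong (2 * 2 ^ suc h *_) (sym len)))))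
        (≤-trans dense (≤-trans (≤-reflexive loss) (+-monoʳ-≤ (degrees Q′ (del v al)) (*-monoʳ-≤ 2 few)))))
    -- Every edge at `v` lies in at least `2 ^ suc h` triangles, which bounds all degrees inside the
    -- neighbourhood `N` of `v` from below.
    rich : ∀ {v y} → ¬ Poor → v ∈ al → y ∈ al → Q v y ≡ true → Goal
    rich {v} {y} ¬poor v∈ y∈ e = inj₂ (v , N , apexState S v∈ , ∈-length (∈-filter⁺ (λ y → Q v y Boolₚ.≟ true) y∈ e) , dense′)
      where
      N = filter (λ y → Q v y Boolₚ.≟ true) al
      many : ∀ {x} → x ∈ N → 2 ^ suc h ≤ row Q N x
      many {x} x∈ with ∈-filter⁻ (λ y → Q v y Boolₚ.≟ true) {xs = al} x∈
      ... | x∈al , vx = subst (2 ^ suc h ≤_) (sym (Sm-filter (Q v) (Q x) al))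
              (≮⇒≥ λ lt → ¬poor (lose v∈ (lose x∈al (vx , lt))))
      dense′ : 2 * 2 ^ h * length N ≤ degrees Q N
      dense′ = ≤-trans (≤-reflexive (*-comm (2 ^ suc h) (length N))) (Sm-const-≤ (2 ^ suc h) N many)
    search : Dec Poor → Dec (Any (λ u → Any (λ v → Q u v ≡ true) al) al) → Goal
    search (yes p) _ with find p
    ... | u , u∈ , q with find q
    ... | v , v∈ , e , few = poor u∈ v∈ e few
    search (no ¬poor) (yes p) with find p
    ... | v , v∈ , q with find q
    ... | y , y∈ , e = rich ¬poor v∈ y∈ e
    search (no ¬poor) (no none) = ⊥-elim (<⇒≱ (*-mono-≤ {1} (*-mono-≤ {1} {2} (s≤s z≤n) (m^n>0 2 (suc h))) ne)
      (≤-trans dense (≤-reflexive (Sm-zero al λ {x} x∈ → Sm-zero al λ {y} y∈ → zero-b λ q → none (lose x∈ (lose y∈ q))))))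
      where
      zero-b : ∀ {b} → b ≢ true → b2n b ≡ 0
      zero-b {true}  ne = ⊥-elim (ne refl)
      zero-b {false} ne = refl

  -- Induction on the number of clique vertices still missing and, for fixed `h`, on the number of
  -- vertices: passing to a neighbourhood lowers the former, contracting an edge the latter.
  mader : ∀ h n {ks al Q} → length al ≤ n → State ks al Q → Dense h Q al → Complete (h + length ks)
  mader zero    n       le S D        = finish _ S refl
  mader (suc h) zero    le S (ne , _) = ⊥-elim (<⇒≱ ne le)
  mader (suc h) (suc n) {ks} le S D = [
    (λ r → mader (suc h) n (≤-pred (≤-trans (≤-reflexive (proj₁ (proj₂ (proj₂ (proj₂ r))))) le))
             (proj₁ (proj₂ (proj₂ r))) (proj₂ (proj₂ (proj₂ (proj₂ r))))) ,
    (λ r → subst Complete (+-suc h (length ks))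
             (mader h (length (proj₁ (proj₂ r))) ≤-refl (proj₁ (proj₂ (proj₂ r))) (proj₂ (proj₂ (proj₂ r))))) ]′ (reduce h S D)

-- Ramsey arguments

-- For each predicate the larger of the two classes is kept, so the list loses at most half of its
-- members each time.
homogenise : {A : Set} (ps : List (A → Bool)) (xs : List A) → Unique xs →
  ∃ λ ys → ys ⊆ xs × Unique ys × length xs ≤ 2 ^ length ps * length ys ×
    (∀ {p} → p ∈ ps → (∀ {y} → y ∈ ys → p y ≡ true) ⊎ (∀ {y} → y ∈ ys → p y ≡ false))
homogenise []       xs uq = xs , id , uq , ≤-reflexive (sym (+-identityʳ _)) , λ ()
homogenise {A} (p ∷ ps) xs uq = choose (≤-total (length no′) (length yes′))
  where
  p? : ∀ x → Dec (p x ≡ true)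
  p? x = p x Boolₚ.≟ true
  yes′ = filter p? xs
  no′  = filter (¬? ∘ p?) xs
  Goal = ∃ λ ys → ys ⊆ xs × Unique ys × length xs ≤ 2 ^ suc (length ps) * length ys ×
    (∀ {q} → q ∈ p ∷ ps → (∀ {y} → y ∈ ys → q y ≡ true) ⊎ (∀ {y} → y ∈ ys → q y ≡ false))
  half : ∀ {a b c} → length xs ≡ a + b → a ≤ c → b ≤ c → ∀ {ys : List A} → c ≤ 2 ^ length ps * length ys →
    length xs ≤ 2 ^ suc (length ps) * length ys
  half {a} {b} {c} e a≤ b≤ {ys} le = ≤-trans (≤-reflexive e) (≤-trans (+-mono-≤ (≤-trans a≤ le) (≤-trans b≤ le))
    (≤-reflexive (double (2 ^ length ps) (length ys))))
    where
    double : ∀ a b → a * b + a * b ≡ (a + (a + 0)) * b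
    double = solve-∀
  flip-b : ∀ {b} → b ≢ true → b ≡ false
  flip-b {true}  ne = ⊥-elim (ne refl)
  flip-b {false} ne = refl
  choose : length no′ ≤ length yes′ ⊎ length yes′ ≤ length no′ → Goal
  choose (inj₁ le) with homogenise ps yes′ (Uniqueₚ.filter⁺ p? uq)
  ... | ys , sub , u , len , hom = ys , proj₁ ∘ mem , u , half {a = length yes′} (filter-split p? xs) ≤-refl le {ys} len ,
          λ { (here refl) → inj₁ (proj₂ ∘ mem) ; (there q) → hom q }
    where
    mem : ∀ {y} → y ∈ ys → y ∈ xs × p y ≡ true
    mem = ∈-filter⁻ p? {xs = xs} ∘ sub
  choose (inj₂ le) with homogenise ps no′ (Uniqueₚ.filter⁺ (¬? ∘ p?) uq)
  ... | ys , sub , u , len , hom = ys , proj₁ ∘ mem , u , half {a = length yes′} (filter-split p? xs) le ≤-refl {ys} len ,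
          λ { (here refl) → inj₂ (flip-b ∘ proj₂ ∘ mem) ; (there q) → hom q }
    where
    mem : ∀ {y} → y ∈ ys → y ∈ xs × p y ≢ true
    mem = ∈-filter⁻ (¬? ∘ p?) {xs = xs} ∘ sub

module _ {A : Set} {D : A → A → Set} (D? : ∀ x y → Dec (D x y)) where

  double-count : ∀ xs ys → Sm (λ x → length (filter (D? x) ys)) xs ≡ Sm (λ y → length (filter (λ x → D? x y) xs)) ys
  double-count []       ys = sym (Sm-zero ys λ _ → refl)
  double-count (x ∷ xs) ys = trans (cong (length (filter (D? x) ys) +_) (double-count xs ys)) (column ys)
    where
    column : ∀ ys → length (filter (D? x) ys) + Sm (λ y → length (filter (λ x → D? x y) xs)) ys ≡
                    Sm (λ y → length (filter (λ x → D? x y) (x ∷ xs))) ys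
    column [] = refl
    column (y ∷ ys) with D? x y
    ... | yes _ = cong suc (trans (swap (length (filter (D? x) ys)) (length (filter (λ x → D? x y) xs)) (Sm (λ y → length (filter (λ x → D? x y) xs)) ys)) (cong (length (filter (λ x → D? x y) xs) +_) (column ys)))
      where
      swap : ∀ a b c → a + (b + c) ≡ b + (a + c)
      swap = solve-∀
    ... | no _ = trans (swap (length (filter (D? x) ys)) (length (filter (λ x → D? x y) xs)) (Sm (λ y → length (filter (λ x → D? x y) xs)) ys)) (cong (length (filter (λ x → D? x y) xs) +_) (column ys))
      where
      swap : ∀ a b c → a + (b + c) ≡ b + (a + c)
      swap = solve-∀

  Sm-≤-const : ∀ {f : A → ℕ} c xs → (∀ {x} → x ∈ xs → f x ≤ c) → Sm f xs ≤ length xs * c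
  Sm-≤-const c []       h = z≤n
  Sm-≤-const c (x ∷ xs) h = +-mono-≤ (h (here refl)) (Sm-≤-const c xs (h ∘ there))

  few-in : ∀ b xs → 1 ≤ length xs → (∀ {x} → x ∈ xs → length (filter (D? x) xs) ≤ b) →
    ∃ λ y → y ∈ xs × length (filter (λ x → D? x y) xs) ≤ b
  few-in b xs ne out with any? (λ y → length (filter (λ x → D? x y) xs) ≤? b) xs
  ... | yes p = find p
  ... | no ¬p = ⊥-elim (<⇒≱ {length xs * b} {length xs * suc b}
          (subst (length xs * b <_) (sym (*-suc (length xs) b)) (+-monoˡ-≤ (length xs * b) ne))
          (≤-trans (Sm-const-≤ (suc b) xs (λ y∈ → ≰⇒> λ le → ¬p (lose y∈ le)))
            (≤-trans (≤-reflexive (sym (double-count xs xs))) (Sm-≤-const b xs out))))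

  -- If all outdegrees are at most `b`, some indegree is at most `b` by averaging. Choosing such a
  -- vertex costs it, its out-neighbours and its in-neighbours, `2 * b + 1` in all. The outdegree
  -- bound speaks of arbitrary lists so that it passes to sublists.
  independent : (_≟ᴬ_ : DecidableEquality A) → ∀ b n xs → Unique xs →
    (∀ {x} ys → Unique ys → x ∈ xs → (∀ {y} → y ∈ ys → y ∈ xs × D x y) → length ys ≤ b) → n * suc (b + b) ≤ length xs →
    ∃ λ zs → zs ⊆ xs × Unique zs × length zs ≡ n × (∀ {x y} → x ∈ zs → y ∈ zs → D x y → x ≡ y)
  independent _≟ᴬ_ b zero    xs uq out le = [] , (λ ()) , [] , refl , λ ()
  independent _≟ᴬ_ b (suc n) xs uq out le = x ∷ zs , sub , All.tabulate (λ p → λ { refl → proj₁ (proj₂ (keep⁻ (zs⊆ p))) refl }) ∷ uqz ,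
      cong suc len , ind
    where
    outs : ∀ {x} → x ∈ xs → length (filter (D? x) xs) ≤ b
    outs {x} x∈ = out _ (Uniqueₚ.filter⁺ (D? x) uq) x∈ (∈-filter⁻ (D? x) {xs = xs})
    pick = few-in b xs (≤-trans (s≤s z≤n) le) outs
    x = proj₁ pick
    Keep : A → Set
    Keep y = y ≢ x × ¬ D x y × ¬ D y x
    keep? : ∀ y → Dec (Keep y)
    keep? y = ¬? (y ≟ᴬ x) ×-dec (¬? (D? x y) ×-dec ¬? (D? y x))
    rest = filter keep? xs
    keep⁻ : ∀ {y} → y ∈ rest → y ∈ xs × Keep y
    keep⁻ = ∈-filter⁻ keep? {xs = xs}
    lost : length (filter (¬? ∘ keep?) xs) ≤ suc (b + b)
    lost = ≤-trans (uniq-length (Uniqueₚ.filter⁺ (¬? ∘ keep?) uq) cover)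
      (s≤s (subst (_≤ b + b) (sym (length-++ (filter (D? x) xs))) (+-mono-≤ (outs (proj₁ (proj₂ pick))) (proj₂ (proj₂ pick)))))
      where
      cover : filter (¬? ∘ keep?) xs ⊆ x ∷ filter (D? x) xs ++ filter (λ y → D? y x) xs
      cover {y} p with ∈-filter⁻ (¬? ∘ keep?) {xs = xs} p
      ... | y∈ , ¬keep with y ≟ᴬ x | D? x y | D? y x
      ... | yes e | _ | _ = here e
      ... | no _ | yes d | _ = there (∈-++⁺ˡ (∈-filter⁺ (D? x) y∈ d))
      ... | no _ | no _ | yes d = there (∈-++⁺ʳ (filter (D? x) xs) (∈-filter⁺ (λ y → D? y x) y∈ d))
      ... | no a | no c | no d = ⊥-elim (¬keep (a , c , d))
    big : n * suc (b + b) ≤ length rest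
    big = +-cancelˡ-≤ (suc (b + b)) _ _ (≤-trans le (≤-trans (≤-reflexive (trans (filter-split keep? xs) (+-comm (length rest) _)))
      (+-monoˡ-≤ (length rest) lost)))
    rec = independent _≟ᴬ_ b n rest (Uniqueₚ.filter⁺ keep? uq)
            (λ ys u y∈ f → out ys u (proj₁ (keep⁻ y∈)) (λ p → proj₁ (keep⁻ (proj₁ (f p))) , proj₂ (f p))) big
    zs = proj₁ rec
    zs⊆ : zs ⊆ rest
    zs⊆ = proj₁ (proj₂ rec)
    uqz = proj₁ (proj₂ (proj₂ rec))
    len = proj₁ (proj₂ (proj₂ (proj₂ rec)))
    sub : x ∷ zs ⊆ xs
    sub (here refl) = proj₁ (proj₂ pick)
    sub (there p)   = proj₁ (keep⁻ (zs⊆ p))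
    ind : ∀ {y z} → y ∈ x ∷ zs → z ∈ x ∷ zs → D y z → y ≡ z
    ind (here refl) (here refl) d = refl
    ind (here refl) (there q)   d = ⊥-elim (proj₁ (proj₂ (proj₂ (keep⁻ (zs⊆ q)))) d)
    ind (there p)   (here refl) d = ⊥-elim (proj₂ (proj₂ (proj₂ (keep⁻ (zs⊆ p)))) d)
    ind (there p)   (there q)   d = proj₂ (proj₂ (proj₂ (proj₂ rec))) p q d

-- Of the first family `r * n + 1` members are candidates: each of the `r` later families rules out
-- at most `n`, so one survives. Homogenising a later family for all candidates costs the factor
-- `2 ^ suc (r * n)`; what is left must serve the recursion and supply the `n₂` columns of a
-- biclique.
familySize : ℕ → ℕ → ℕ → ℕ
familySize n n₂ zero    = 0
familySize n n₂ (suc r) = suc (r * n) + 2 ^ suc (r * n) * (familySize n n₂ r + n₂)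

module Transversal {A Key : Set} (_≟ᴬ_ : DecidableEquality A) (T : Key → A → Key → A → Set)
                   (T? : ∀ k x k′ y → Dec (T k x k′ y)) (n n₂ : ℕ) where
  open DecMem _≟ᴬ_ using (_∈?_)

  record Biclique : Set where
    field
      k k′   : Key
      rows   : List A
      cols   : List A
      uqr    : Unique rows
      uqc    : Unique cols
      len-r  : length rows ≡ n
      len-c  : length cols ≡ n₂
      meet   : ∀ {x y} → x ∈ rows → y ∈ cols → T k x k′ y

  Sieved : Key → List A → ℕ → List (Key × List A) → Set
  Sieved k X M fs = Biclique ⊎ (∃ λ fs′ → ∃ λ bad → map proj₁ fs′ ≡ map proj₁ fs × length bad ≤ length fs * n ×
      All (λ (_ , ys) → Unique ys × M ≤ length ys) fs′ ×
      (∀ {k′ ys} → (k′ , ys) ∈ fs′ → ∃ λ ys₀ → (k′ , ys₀) ∈ fs × ys ⊆ ys₀) ×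
      (∀ {x} → x ∈ X → x ∉ bad → All (λ (k′ , ys) → ∀ {y} → y ∈ ys → ¬ T k x k′ y) fs′))

  -- After a later family has been homogenised for `X`, every member of `X` meets all of it or none
  -- of it. If `n` members meet all, there is a biclique; otherwise these few are put into `bad`.
  sieve : ∀ k X M → Unique X → ∀ fs → n₂ ≤ M →
    All (λ (_ , ys) → Unique ys × 2 ^ length X * M ≤ length ys) fs → Sieved k X M fs
  sieve k X M uqX [] n₂≤ [] = inj₂ ([] , [] , refl , z≤n , [] , (λ ()) , λ _ _ → [])
  sieve k X M uqX ((k′ , ys) ∷ fs) n₂≤ ((uq , len) ∷ hs) with sieve k X M uqX fs n₂≤ hs
  ... | inj₁ b = inj₁ b
  ... | inj₂ (fs′ , bad , keys , lb , hs′ , sb , ok) with homogenise (map (λ x y → does (T? k x k′ y)) X) ys uq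
  ... | zs , sub , uqz , lz , hom = decide (n ≤? length full)
    where
    full? : ∀ x → Dec (All (λ y → T k x k′ y) zs)
    full? x = all? (λ y → T? k x k′ y) zs
    full = filter full? X
    M≤ : M ≤ length zs
    M≤ = *-cancelˡ-≤ (2 ^ length X) {{m^n≢0 2 (length X)}} (≤-trans len (subst (λ m → length ys ≤ 2 ^ m * length zs) (length-map _ X) lz))
    empty : ∀ {x} → x ∈ X → x ∉ full → ∀ {y} → y ∈ zs → ¬ T k x k′ y
    empty {x} x∈ x∉ {y} y∈ t with hom (∈-map⁺ (λ x y → does (T? k x k′ y)) x∈)
    ... | inj₁ all = x∉ (∈-filter⁺ full? x∈ (All.tabulate λ {z} z∈ → from-does (T? k x k′ z) (all z∈)))
      where
      from-does : ∀ {P : Set} (d : Dec P) → does d ≡ true → P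
      from-does (yes p) _ = p
    ... | inj₂ none with T? k x k′ y | none y∈
    ... | no ¬t | _ = ¬t t
    decide : Dec (n ≤ length full) → Sieved k X M ((k′ , ys) ∷ fs)
    decide (yes le) = inj₁ record
      { k = k ; k′ = k′ ; rows = take n full ; cols = take n₂ zs ; uqr = Uniqueₚ.take⁺ n (Uniqueₚ.filter⁺ full? uqX)
      ; uqc = Uniqueₚ.take⁺ n₂ uqz ; len-r = length-take-≤ n le ; len-c = length-take-≤ n₂ (≤-trans n₂≤ M≤)
      ; meet = λ x∈ y∈ → All.lookup (proj₂ (∈-filter⁻ full? {xs = X} (take-⊆ n x∈))) (take-⊆ n₂ y∈) }
    decide (no n≰) = inj₂ ((k′ , zs) ∷ fs′ , full ++ bad , cong (k′ ∷_) keys ,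
      subst (_≤ n + length fs * n) (sym (length-++ full)) (+-mono-≤ (≰⇒≥ n≰) lb) , (uqz , M≤) ∷ hs′ ,
      (λ { (here refl) → ys , here refl , sub ; (there p) → let ys₀ , q , r = sb p in ys₀ , there q , r }) ,
      λ x∈ x∉ → empty x∈ (x∉ ∘ ∈-++⁺ˡ) ∷ ok x∈ (x∉ ∘ ∈-++⁺ʳ full))

  size : ℕ → ℕ
  size = familySize n n₂

  NonT : Key × A → Key × A → Set
  NonT (k , x) (k′ , y) = ¬ T k x k′ y

  Outcome : List (Key × List A) → Set
  Outcome fs = Biclique ⊎ (∃ λ gs → map proj₁ gs ≡ map proj₁ fs × AllPairs NonT gs ×
    All (λ (k , x) → ∃ λ ys → (k , ys) ∈ fs × x ∈ ys) gs)

  transversal : ∀ r fs → length fs ≡ r → All (λ (_ , ys) → Unique ys × size r ≤ length ys) fs →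
    Outcome fs
  transversal zero    []             e  []  = inj₂ ([] , refl , [] , [])
  transversal (suc r) ((k , X₀) ∷ fs) e ((uq , len) ∷ hs)
    with sieve k X (size r + n₂) (Uniqueₚ.take⁺ N uq) fs (m≤n+m n₂ (size r))
           (All.map (λ (u , l) → u , ≤-trans (≤-reflexive (cong (λ m → 2 ^ m * (size r + n₂)) lenX)) (≤-trans (m≤n+m _ N) l)) hs)
    where
    N = suc (r * n)
    X = take N X₀
    lenX : length X ≡ N
    lenX = length-take-≤ N {X₀} (≤-trans (m≤m+n N _) len)
  ... | inj₁ b = inj₁ b
  ... | inj₂ (fs′ , bad , keys , lb , hs′ , sb , ok) = conclude
    where
    N = suc (r * n)
    X = take N X₀
    lenX : length X ≡ N
    lenX = length-take-≤ N {X₀} (≤-trans (m≤m+n N _) len)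
    pick : ∃ λ x → x ∈ X × x ∉ bad
    pick with any? (λ x → ¬? (x ∈? bad)) X
    ... | yes p = find p
    ... | no ¬p = ⊥-elim (<⇒≱ (s≤s (subst (λ m → length bad ≤ m * n) (suc-injective e) lb)) (≤-trans (≤-reflexive (sym lenX)) (uniq-length (Uniqueₚ.take⁺ N uq)
                    (λ {x} x∈ → decidable-stable (x ∈? bad) λ x∉ → ¬p (lose x∈ x∉)))))
    x = proj₁ pick
    Origin : Key × A → Set
    Origin (k′ , y) = ∃ λ ys → (k′ , ys) ∈ fs′ × y ∈ ys
    conclude : Outcome ((k , X₀) ∷ fs)
    conclude with transversal r fs′ (trans (sym (length-map proj₁ fs′)) (trans (cong length keys) (trans (length-map proj₁ fs) (suc-injective e))))
                        (All.map (λ (u , l) → u , ≤-trans (m≤m+n _ n₂) l) hs′)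
    ... | inj₁ b = inj₁ b
    ... | inj₂ (gs , ks , ap , or) = inj₂ ((k , x) ∷ gs , cong (k ∷_) (trans ks keys) , All.map far or ∷ ap ,
            (X₀ , here refl , take-⊆ N (proj₁ (proj₂ pick))) ∷ All.map up or)
      where
      far : ∀ {g} → Origin g → NonT (k , x) g
      far (ys , p , y∈) = All.lookup (ok (proj₁ (proj₂ pick)) (proj₂ (proj₂ pick))) p y∈
      up : ∀ {g} → Origin g → ∃ λ ys → (proj₁ g , ys) ∈ (k , X₀) ∷ fs × proj₂ g ∈ ys
      up (ys , p , y∈) = let ys₀ , q , r = sb p in ys₀ , there q , r y∈

-- Crossings

Sm-++ : {A : Set} (f : A → ℕ) (xs ys : List A) → Sm f (xs ++ ys) ≡ Sm f xs + Sm f ys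
Sm-++ f []       ys = refl
Sm-++ f (x ∷ xs) ys = trans (cong (f x +_) (Sm-++ f xs ys)) (sym (+-assoc (f x) _ _))

Sm-count : {A : Set} {q : A → Bool} {ds xs : List A} → Unique ds → (∀ {d} → d ∈ ds → d ∈ xs × q d ≡ true) →
  length ds ≤ Sm (b2n ∘ q) xs
Sm-count {q = q} {ds} {xs} uq f = ≤-trans (uniq-length uq (λ d∈ → let p , e = f d∈ in ∈-filter⁺ (λ y → q y Boolₚ.≟ true) p e))
  (≤-reflexive (sym (count xs)))
  where
  count : ∀ xs → Sm (b2n ∘ q) xs ≡ length (filter (λ y → q y Boolₚ.≟ true) xs)
  count [] = refl
  count (x ∷ xs) with q x
  ... | true  = cong suc (count xs)
  ... | false = count xs

-- Paths will lie in layers from `ℓ₀ + 2` on and pieces in layers up to `ℓ₀`, so they never touch;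
-- only the stems, which lead from the spots `z i` down to layer `ℓ₀ + 1`, connect them. All
-- vertices of a stem and its start are within `L` of its spot, so `far` keeps different stems from
-- touching.
module Spots {G : Graph} (Δ : ℕ) (deg≤ : MaxDegree≤ G Δ) {r : V G} (B : BFS G r) {I : Set}
             (z : I → V G) (ℓ₀ L : ℕ) (in-z : ∀ i → BFS.In B (z i)) (lo : ∀ i → suc (suc ℓ₀) ≤ BFS.lay B (z i))
             (hi : ∀ i → BFS.lay B (z i) ≤ L + ℓ₀) (far : ∀ {i j} → z j ∈ Sets.ball G (L + (1 + L)) (z i) → i ≡ j) where
  open Sets G
  open BFS B
  open Teeth B

  depth : I → ℕ
  depth i = lay (z i) ∸ suc ℓ₀

  depth-eq : ∀ i → depth i + suc ℓ₀ ≡ lay (z i)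
  depth-eq i = m∸n+n≡m (≤-trans (n≤1+n _) (lo i))

  depth-≤ : ∀ i → suc (depth i) ≤ lay (z i)
  depth-≤ i = subst (suc (depth i) ≤_) (trans (sym (+-suc (depth i) ℓ₀)) (depth-eq i)) (s≤s (m≤m+n (depth i) ℓ₀))

  depth-L : ∀ i → suc (depth i) ≤ L
  depth-L i = +-cancelʳ-≤ ℓ₀ _ _ (subst (_≤ L + ℓ₀) (trans (sym (depth-eq i)) (+-suc (depth i) ℓ₀)) (hi i))

  start : I → V G
  start i = up (suc (depth i)) (z i)

  foot : I → V G
  foot i = up (depth i) (z i)

  stem : I → List (V G)
  stem i = chain (depth i) (z i)

  in-start : ∀ i → In (start i)
  in-start i = up-in (suc (depth i)) (in-z i) (depth-≤ i)

  lay-start : ∀ i → lay (start i) ≡ ℓ₀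
  lay-start i = +-cancelˡ-≡ (suc (depth i)) _ _ (trans (up-lay (suc (depth i)) (in-z i) (depth-≤ i))
    (trans (sym (depth-eq i)) (+-suc (depth i) ℓ₀)))

  start-ball : ∀ i → start i ∈ ball L (z i)
  start-ball i = ball-mono (depth-L i) (up-ball (suc (depth i)) (in-z i) (depth-≤ i))

  foot~start : ∀ i → foot i ~ start i
  foot~start i = subst (foot i ~_) (sym (trans (cong (λ m → up m (z i)) (+-comm 1 (depth i))) (up-+ (depth i) 1 (z i))))
    (inj₂ (adj-symm (proj₁ (parent (up-in (depth i) (in-z i) d≤) (m+n≤o⇒n≤o 0 le)))))
    where
    d≤ = ≤-trans (n≤1+n _) (depth-≤ i)
    le : 1 ≤ lay (foot i)
    le = +-cancelˡ-≤ (depth i) 1 _ (subst₂ _≤_ (+-comm 1 (depth i)) (sym (up-lay (depth i) (in-z i) d≤)) (depth-≤ i))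

  stem-spec : ∀ i {v} → v ∈ stem i → In v × suc ℓ₀ ≤ lay v × v ∈ ball L (z i)
  stem-spec i p with chain-spec (depth i) (in-z i) (≤-trans (n≤1+n _) (depth-≤ i)) p
  ... | t , t≤ , refl = up-in t (in-z i) t≤′ ,
    +-cancelˡ-≤ t _ _ (subst (t + suc ℓ₀ ≤_) (trans (depth-eq i) (sym (up-lay t (in-z i) t≤′))) (+-monoˡ-≤ (suc ℓ₀) t≤)) ,
    ball-mono (≤-trans t≤ (≤-trans (n≤1+n _) (depth-L i))) (up-ball t (in-z i) t≤′)
    where t≤′ = ≤-trans t≤ (≤-trans (n≤1+n _) (depth-≤ i))

  close : ∀ {i j u v} → u ∈ ball L (z i) → v ∈ ball L (z j) → u ~ v → i ≡ j
  close {i} {j} p q e = far (ball-trans (1 + L) L (ball-trans L 1 p (ball-1 e)) (ball-sym L q))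

  apart : ∀ {i j} → start i ~ start j → i ≡ j
  apart {i} {j} = close (start-ball i) (start-ball j)

  -- A stem is cut off at its last contact with S.
  leave : ∀ {S} k {x} → In x → k ≤ lay x → Touch (chain k x) S → up k x ∉ S →
    ∃ λ cs → cs ⊆ chain k x × Conn cs × up k x ∈ cs × Touch cs S × (∀ {v} → v ∈ cs → v ∉ S)
  leave zero {x} i le t x∉ = x ∷ [] , id , chain-conn 0 i z≤n , here refl , t , λ { (here refl) → x∉ }
  leave {S} (suc k) {x} i le t x∉ with touch? (chain k (par x)) S
  ... | yes t′ with leave k (proj₁ (proj₂ (parent i le))) (parent-≤ i le) t′ x∉
  ... | cs , sub , rest = cs , there ∘ sub , rest
  leave {S} (suc k) {x} i le t x∉ | no ¬t = chain (suc k) x , id , chain-conn (suc k) i le , up-∈ {suc k} {suc k} {x} ≤-refl , t , out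
    where
    out : ∀ {v} → v ∈ chain (suc k) x → v ∉ S
    out (here refl) v∈ = ¬t (_ , _ , up-∈ {0} {k} z≤n , v∈ , inj₂ (proj₁ (parent i le)))
    out (there p)   v∈ = ¬t (_ , _ , p , v∈ , inj₁ refl)

  open Pieces Δ deg≤ B start ℓ₀ in-start lay-start apart public

  layers-apart : ∀ {u v} → In u → suc (suc ℓ₀) ≤ lay u → lay v ≤ ℓ₀ → u ~ v → ⊥
  layers-apart i l l′ e = <⇒≱ (≤-trans l (lay-adj (in-adj i e) (~-sym e))) (s≤s l′)

  -- The stem stays above layer `ℓ₀` and the body does not, so the contact is with a start in layer
  -- `ℓ₀`. A start adjacent to the stem of `z i` can only belong to `z i` itself, by `close`.
  stem-piece : ∀ {d} i (p : Piece d) {u v} → u ∈ stem i → v ∈ Piece.body p → u ~ v → start i ∈ Piece.body p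
  stem-piece i p {u} {v} u∈ v∈ e = at-start (Piece.top p v∈ (≤-antisym (Piece.low p v∈)
      (≤-pred (≤-trans (proj₁ (proj₂ su)) (lay-adj (in-adj (proj₁ su) e) (~-sym e))))))
    where
    su = stem-spec i u∈
    at-start : (∃ λ j → v ≡ start j) → start i ∈ Piece.body p
    at-start (j , eq) = subst (_∈ Piece.body p) (trans eq (cong start (sym (close (proj₂ (proj₂ su)) (start-ball j) (subst (u ~_) eq e))))) v∈

  -- These paths will be the rows or the columns of a grid. `touch-z` asks only for contact, since a
  -- spot lies on its row but may be merely next to its column.
  record Paths (N : ℕ) : Set where
    field
      pt      : Fin N → List (V G)
      pt-conn : ∀ a → Conn (pt a)
      pt-far  : ∀ {a b} → Touch (pt a) (pt b) → a ≡ b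
      pt-in   : ∀ {a v} → v ∈ pt a → In v × suc (suc ℓ₀) ≤ lay v
      owner   : I → Fin N
      touch-z : ∀ i → Touch (z i ∷ []) (pt (owner i))
      pt-ne   : ∀ a → ∃ (_∈ pt a)
      others  : ∀ {i a v} → v ∈ pt a → v ∈ ball (1 + L) (z i) → a ≡ owner i

  module Dense {N : ℕ} (P : Paths N) {d : ℕ} (ps : List (Piece d)) (ap : AllPairs NonTouching ps) (1≤d : 1 ≤ d) where
    open Paths P

    abstract
      con : ∀ i → ∃ λ cs → cs ⊆ stem i × Conn cs × foot i ∈ cs × Touch cs (pt (owner i)) × (∀ {v} → v ∈ cs → v ∉ pt (owner i))
      con i = leave (depth i) (in-z i) (≤-trans (n≤1+n _) (depth-≤ i))
        (touch-mono (λ { (here refl) → up-∈ {0} z≤n }) id (touch-z i)) foot∉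
        where
        foot∉ : foot i ∉ pt (owner i)
        foot∉ p = 1+n≰n (subst (suc (suc ℓ₀) ≤_) foot-lay (proj₂ (pt-in p)))
          where
          foot-lay : lay (foot i) ≡ suc ℓ₀
          foot-lay = +-cancelˡ-≡ (depth i) _ _ (trans (up-lay (depth i) (in-z i) (≤-trans (n≤1+n _) (depth-≤ i))) (sym (depth-eq i)))

    M = length ps

    Ix = Fin N ⊎ Fin M

    pc : Fin M → Piece d
    pc = lookup ps

    pc-far : ∀ p q → Touch (Piece.body (pc p)) (Piece.body (pc q)) → p ≡ q
    pc-far = far-at ap
      where
      far-at : ∀ {ps : List (Piece d)} → AllPairs NonTouching ps → ∀ p q →
        Touch (Piece.body (lookup ps p)) (Piece.body (lookup ps q)) → p ≡ q
      far-at (a ∷ ap) fzero    fzero    t = refl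
      far-at (a ∷ ap) fzero    (fsuc q) t = ⊥-elim (All.lookup a (∈-lookup q) t)
      far-at (a ∷ ap) (fsuc p) fzero    t = ⊥-elim (All.lookup a (∈-lookup p) (touch-sym t))
      far-at (a ∷ ap) (fsuc p) (fsuc q) t = cong fsuc (far-at ap p q t)

    joins? : ∀ a p → Dec (Any (λ i → owner i ≡ a) (Piece.ids (pc p)))
    joins? a p = any? (λ i → owner i ≟ a) (Piece.ids (pc p))

    -- Bipartite between paths and pieces: an edge for every pair that some stem connects. One such
    -- stem, cut off at the path, becomes the connector; the others are ignored.
    Q : Ix → Ix → Bool
    Q (inj₁ a) (inj₂ p) = does (joins? a p)
    Q (inj₂ p) (inj₁ a) = does (joins? a p)
    Q _        _        = false

    hub : Ix → List (V G)
    hub (inj₁ a) = pt a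
    hub (inj₂ p) = Piece.body (pc p)

    pick : ∀ {a p} → Dec (Any (λ i → owner i ≡ a) (Piece.ids (pc p))) → List (V G)
    pick (yes w) = proj₁ (con (proj₁ (find w)))
    pick (no _)  = []

    conOf : Fin N → Fin M → List (V G)
    conOf a p = pick {a} {p} (joins? a p)

    cons : Ix → Ix → List (V G)
    cons (inj₁ a) (inj₂ p) = conOf a p
    cons (inj₂ p) (inj₁ a) = conOf a p
    cons _        _        = []

    record Via (a : Fin N) (p : Fin M) : Set where
      constructor via
      field
        i   : I
        i∈  : i ∈ Piece.ids (pc p)
        own : owner i ≡ a
        eq  : conOf a p ≡ proj₁ (con i)

    pick-spec : ∀ {a p} (x : Dec (Any (λ i → owner i ≡ a) (Piece.ids (pc p)))) → does x ≡ true →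
      ∃ λ i → i ∈ Piece.ids (pc p) × owner i ≡ a × pick {a} {p} x ≡ proj₁ (con i)
    pick-spec (yes w) _ = proj₁ (find w) , proj₁ (proj₂ (find w)) , proj₂ (proj₂ (find w)) , refl

    conOf-spec : ∀ {a p} → does (joins? a p) ≡ true → Via a p
    conOf-spec {a} {p} e = let i , i∈ , own , eq = pick-spec {a} {p} (joins? a p) e in via i i∈ own eq

    open CleanStructures G (Sumₚ.≡-dec (_≟_ {N}) (_≟_ {M}))
    open Mader G (Sumₚ.≡-dec (_≟_ {N}) (_≟_ {M}))

    view : ∀ {x y} → Q x y ≡ true → ∃₂ λ a p → SamePair x y (inj₁ a) (inj₂ p) × cons x y ≡ conOf a p × Via a p
    view {inj₁ a} {inj₂ p} e = a , p , inj₁ (refl , refl) , refl , conOf-spec e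
    view {inj₂ p} {inj₁ a} e = a , p , inj₂ (refl , refl) , refl , conOf-spec e

    stem⊆ : ∀ i {v} → v ∈ proj₁ (con i) → v ∈ stem i
    stem⊆ i = proj₁ (proj₂ (con i))

    con-row : ∀ i {b} → Touch (proj₁ (con i)) (pt b) → b ≡ owner i
    con-row i (u , v , u∈ , v∈ , e) = others v∈ (ball-trans L 1 (proj₂ (proj₂ (stem-spec i (stem⊆ i u∈)))) (ball-1 e))

    con-piece : ∀ i {p q} → i ∈ Piece.ids (pc p) → Touch (proj₁ (con i)) (Piece.body (pc q)) → q ≡ p
    con-piece i {p} {q} i∈ (u , v , u∈ , v∈ , e) =
      pc-far q p (start i , start i , stem-piece i (pc q) (stem⊆ i u∈) v∈ e , Piece.ids∈ (pc p) i∈ , inj₁ refl)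

    con-con′ : ∀ {a p a′ p′} → Via a p → Via a′ p′ → Touch (conOf a p) (conOf a′ p′) → a ≡ a′ × p ≡ p′
    con-con′ {a} {p} {a′} {p′} (via i i∈ own eq) (via j j∈ own′ eq′) t = agree (stems-meet (subst₂ Touch eq eq′ t))
      where
      stems-meet : Touch (proj₁ (con i)) (proj₁ (con j)) → i ≡ j
      stems-meet (u , v , u∈ , v∈ , e) = close {i} {j} (proj₂ (proj₂ (stem-spec i (stem⊆ i u∈)))) (proj₂ (proj₂ (stem-spec j (stem⊆ j v∈)))) e
      agree : i ≡ j → a ≡ a′ × p ≡ p′
      agree e = trans (sym own) (trans (cong owner e) own′) ,
        pc-far p p′ (start i , start j , Piece.ids∈ (pc p) i∈ , Piece.ids∈ (pc p′) j∈ , inj₁ (cong start e))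

    touch-hubs : ∀ {a p} → Via a p → Touch (conOf a p) (pt a) × Touch (conOf a p) (Piece.body (pc p))
    touch-hubs {a} {p} (via i i∈ refl eq) = subst (λ c → Touch c (pt a)) (sym eq) (proj₁ (proj₂ (proj₂ (proj₂ (proj₂ (con i)))))) ,
      (foot i , start i , subst (foot i ∈_) (sym eq) (proj₁ (proj₂ (proj₂ (proj₂ (con i))))) , Piece.ids∈ (pc p) i∈ , foot~start i)

    piece-pt : ∀ p → ∃ (_∈ Piece.body (pc p))
    piece-pt p with nonempty (Piece.ids (pc p)) (subst (1 ≤_) (sym (Piece.size (pc p))) 1≤d)
    ... | i , i∈ = _ , Piece.ids∈ (pc p) i∈

    clean : Clean (λ _ → ⊤) Q
    clean = record
      { hub = hub ; con = cons
      ; hub-pt = λ { {inj₁ a} _ → pt-ne a ; {inj₂ p} _ → piece-pt p }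
      ; hub-conn = λ { {inj₁ a} _ → pt-conn a ; {inj₂ p} _ → Piece.conn (pc p) }
      ; hub-far = λ { {inj₁ a} {inj₁ b} _ _ t → cong inj₁ (pt-far t)
                    ; {inj₂ p} {inj₂ q} _ _ t → cong inj₂ (pc-far p q t)
                    ; {inj₁ a} {inj₂ p} _ _ (u , v , u∈ , v∈ , e) → ⊥-elim (mixed {a} {p} u∈ v∈ e)
                    ; {inj₂ p} {inj₁ a} _ _ (u , v , u∈ , v∈ , e) → ⊥-elim (mixed {a} {p} v∈ u∈ (~-sym e)) }
      ; con-conn = λ { {x} {y} (edge _ _ _ q) → let a , p , _ , eq , w = view {x} {y} q in subst Conn (sym (trans eq (Via.eq w))) (proj₁ (proj₂ (proj₂ (con (Via.i w))))) }
      ; con-l = λ { {x} (edge _ _ _ q) → cl x q }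
      ; con-r = λ { {x} (edge _ _ _ q) → cr x q }
      ; con-out = λ { {x} {y} {c} (edge _ _ _ q) _ v∈ → let a , p , _ , eq , w = view {x} {y} q in out w c (subst (_ ∈_) eq v∈) }
      ; con-hub = λ { {x} {y} {c} (edge _ _ _ q) _ t → let a , p , s , eq , w = view {x} {y} q in ch w c s (subst (λ l → Touch l (hub c)) eq t) }
      ; con-con = λ { {x} {y} {x′} {y′} (edge _ _ _ q) (edge _ _ _ q′) t → let a , p , s , eq , w = view {x} {y} q ; a′ , p′ , s′ , eq′ , w′ = view {x′} {y′} q′ in
                      cc s s′ (con-con′ w w′ (subst₂ Touch eq eq′ t)) } }
      where
      mixed : ∀ {a p u v} → u ∈ pt a → v ∈ Piece.body (pc p) → u ~ v → ⊥
      mixed {p = p} u∈ v∈ e = layers-apart (proj₁ (pt-in u∈)) (proj₂ (pt-in u∈)) (Piece.low (pc p) v∈) e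
      cl : ∀ x {y} → Q x y ≡ true → Touch (cons x y) (hub x)
      cl (inj₁ a) {inj₂ p} q = proj₁ (touch-hubs (conOf-spec q))
      cl (inj₂ p) {inj₁ a} q = proj₂ (touch-hubs (conOf-spec q))
      cr : ∀ x {y} → Q x y ≡ true → Touch (cons x y) (hub y)
      cr (inj₁ a) {inj₂ p} q = proj₂ (touch-hubs (conOf-spec q))
      cr (inj₂ p) {inj₁ a} q = proj₁ (touch-hubs (conOf-spec q))
      out : ∀ {a p v} → Via a p → ∀ c → v ∈ conOf a p → v ∉ hub c
      out {v = v} (via i i∈ own eq) (inj₁ b) v∈ v∈b = proj₂ (proj₂ (proj₂ (proj₂ (proj₂ (con i))))) v∈i
          (subst (λ a → v ∈ pt a) (con-row i {b} (v , v , v∈i , v∈b , inj₁ refl)) v∈b)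
        where
        v∈i : v ∈ proj₁ (con i)
        v∈i = subst (v ∈_) eq v∈
      out {v = v} (via i i∈ own eq) (inj₂ q) v∈ v∈q =
        1+n≰n (≤-trans (proj₁ (proj₂ (stem-spec i (stem⊆ i (subst (v ∈_) eq v∈))))) (Piece.low (pc q) v∈q))
      on-row : ∀ {a b : Fin N} {p : Fin M} {x y : Ix} → SamePair x y (inj₁ a) (inj₂ p) → b ≡ a → inj₁ b ≡ x ⊎ inj₁ b ≡ y
      on-row (inj₁ (e , _)) b≡ = inj₁ (trans (cong inj₁ b≡) (sym e))
      on-row (inj₂ (_ , e)) b≡ = inj₂ (trans (cong inj₁ b≡) (sym e))
      on-piece : ∀ {a : Fin N} {p q : Fin M} {x y : Ix} → SamePair x y (inj₁ a) (inj₂ p) → q ≡ p → inj₂ q ≡ x ⊎ inj₂ q ≡ y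
      on-piece (inj₁ (_ , e)) q≡ = inj₂ (trans (cong inj₂ q≡) (sym e))
      on-piece (inj₂ (e , _)) q≡ = inj₁ (trans (cong inj₂ q≡) (sym e))
      ch : ∀ {a p x y} → Via a p → ∀ c → SamePair x y (inj₁ a) (inj₂ p) → Touch (conOf a p) (hub c) → c ≡ x ⊎ c ≡ y
      ch (via i i∈ own eq) (inj₁ b) s t = on-row s (trans (con-row i (subst (λ l → Touch l (pt b)) eq t)) own)
      ch {a} {p} (via i i∈ own eq) (inj₂ q) s t = on-piece s (con-piece i {p} {q} i∈ (subst (λ l → Touch l (Piece.body (pc q))) eq t))
      cc : ∀ {a p a′ p′ x y x′ y′} → SamePair x y (inj₁ a) (inj₂ p) → SamePair x′ y′ (inj₁ a′) (inj₂ p′) →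
        a ≡ a′ × p ≡ p′ → SamePair x y x′ y′
      cc (inj₁ (refl , refl)) (inj₁ (refl , refl)) (refl , refl) = inj₁ (refl , refl)
      cc (inj₁ (refl , refl)) (inj₂ (refl , refl)) (refl , refl) = inj₂ (refl , refl)
      cc (inj₂ (refl , refl)) (inj₁ (refl , refl)) (refl , refl) = inj₂ (refl , refl)
      cc (inj₂ (refl , refl)) (inj₂ (refl , refl)) (refl , refl) = inj₁ (refl , refl)

    al : List Ix
    al = map inj₁ (allFin N) ++ map inj₂ (allFin M)

    al-uq : Unique al
    al-uq = Uniqueₚ.++⁺ (Uniqueₚ.map⁺ Sumₚ.inj₁-injective (Uniqueₚ.allFin⁺ N)) (Uniqueₚ.map⁺ Sumₚ.inj₂-injective (Uniqueₚ.allFin⁺ M)) dis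
      where
      dis : ∀ {x} → ¬ (x ∈ map inj₁ (allFin N) × x ∈ map inj₂ (allFin M))
      dis (p , q) with ∈-map⁻ inj₁ p | ∈-map⁻ inj₂ q
      ... | a , _ , refl | b , _ , ()

    abstract
      state : State [] al Q
      state = record
        { cs = shrink (λ _ → tt) clean
        ; sym-Q = λ { (inj₁ _) (inj₁ _) → refl ; (inj₁ _) (inj₂ _) → refl ; (inj₂ _) (inj₁ _) → refl ; (inj₂ _) (inj₂ _) → refl }
        ; irr-Q = λ { (inj₁ _) → refl ; (inj₂ _) → refl } ; uqk = [] ; uqa = al-uq ; dis = λ () ; kk = λ () ; ka = λ () }

    Rich : ℕ → Piece d → Set
    Rich e p = e ≤ length (deduplicate _≟_ (map owner (Piece.ids p)))

    fromComplete : ∀ H → Complete (order H) → InducedMinorModel H G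
    fromComplete H C = complete⇒model H cs f f-inj f-al f-Q
      where
      open Complete C

    -- The degrees of the pieces alone sum to at least `M * (4 * 2 ^ h)`. Since `N ≤ M`, this is at
    -- least `2 * 2 ^ h * (N + M)`, the density required by `mader`.
    dense⇒model : ∀ (H : Graph) → All (Rich (4 * 2 ^ order H)) ps → N ≤ M → 1 ≤ M → InducedMinorModel H G
    dense⇒model H rich N≤M 1≤M = fromComplete H (subst Complete (+-identityʳ h) (mader h (length al) ≤-refl state
        (≤-trans 1≤M (≤-trans (m≤n+m M N) (≤-reflexive (sym len-al))) , dense)))
      where
      h = order H
      len-al : length al ≡ N + M
      len-al = trans (length-++ (map inj₁ (allFin N))) (cong₂ _+_ (trans (length-map inj₁ (allFin N)) (length-tabulate {n = N} id))
                 (trans (length-map inj₂ (allFin M)) (length-tabulate {n = M} id)))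
      row-≥ : ∀ p → 4 * 2 ^ h ≤ row Q al (inj₂ p)
      row-≥ p = ≤-trans (All.lookup rich (∈-lookup p)) (≤-trans (≤-reflexive (sym (length-map inj₁ owners)))
        (Sm-count (Uniqueₚ.map⁺ Sumₚ.inj₁-injective (deduplicate-! _≟_ (map owner (Piece.ids (pc p))))) λ d∈ → mem d∈))
        where
        owners = deduplicate _≟_ (map owner (Piece.ids (pc p)))
        mem : ∀ {x} → x ∈ map inj₁ owners → x ∈ al × Q (inj₂ p) x ≡ true
        owned : ∀ {a} → a ∈ owners → Any (λ i → owner i ≡ a) (Piece.ids (pc p))
        owned a∈ = let i , i∈ , e = ∈-map⁻ owner (∈-deduplicate⁻ _≟_ (map owner (Piece.ids (pc p))) a∈) in lose i∈ (sym e)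
        joined : ∀ {x} → (∃ λ a → a ∈ owners × x ≡ inj₁ a) → x ∈ al × Q (inj₂ p) x ≡ true
        joined (a , a∈ , refl) = ∈-++⁺ˡ (∈-map⁺ inj₁ (∈-allFin a)) , dec-true (joins? a p) (owned a∈)
        mem x∈ = joined (∈-map⁻ inj₁ x∈)
      dense : 2 * 2 ^ h * length al ≤ degrees Q al
      dense = ≤-trans (*-monoʳ-≤ (2 * 2 ^ h) (≤-trans (≤-reflexive len-al) (+-monoˡ-≤ M N≤M)))
        (≤-trans (≤-reflexive (arith (2 ^ h) M))
          (≤-trans (subst (λ m → m * (4 * 2 ^ h) ≤ Sm (row Q al) (map inj₂ (allFin M))) (trans (length-map inj₂ (allFin M)) (length-tabulate {n = M} id))
              (Sm-const-≤ (4 * 2 ^ h) (map inj₂ (allFin M)) low′))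
            (≤-trans (m≤n+m _ (Sm (row Q al) (map inj₁ (allFin N)))) (≤-reflexive (sym (Sm-++ (row Q al) (map inj₁ (allFin N)) _))))))
        where
        arith : ∀ c m → 2 * c * (m + m) ≡ m * (4 * c)
        arith = solve-∀
        low′ : ∀ {x} → x ∈ map inj₂ (allFin M) → 4 * 2 ^ h ≤ row Q al x
        on-piece : ∀ {x} → (∃ λ p → p ∈ allFin M × x ≡ inj₂ p) → 4 * 2 ^ h ≤ row Q al x
        on-piece (p , _ , refl) = row-≥ p
        low′ x∈ = on-piece (∈-map⁻ inj₂ x∈)

-- Hubs joined by non-touching routes

allPairs-lookup : {A : Set} {R : A → A → Set} {xs : List A} → (∀ {x y} → R x y → R y x) → AllPairs (λ x y → ¬ R x y) xs →
  ∀ {i j} → R (lookup xs i) (lookup xs j) → i ≡ j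
allPairs-lookup s (a ∷ ap) {fzero}  {fzero}  r = refl
allPairs-lookup s (a ∷ ap) {fzero}  {fsuc j} r = ⊥-elim (All.lookup a (∈-lookup j) r)
allPairs-lookup s (a ∷ ap) {fsuc i} {fzero}  r = ⊥-elim (All.lookup a (∈-lookup i) (s r))
allPairs-lookup s (a ∷ ap) {fsuc i} {fsuc j} r = cong fsuc (allPairs-lookup s ap r)

module Sparse {G : Graph} (Δ : ℕ) (deg≤ : MaxDegree≤ G Δ) {r : V G} (B : BFS G r) {I : Set}
              (z : I → V G) (ℓ₀ : ℕ) (in-z : ∀ i → BFS.In B (z i)) (lay-z : ∀ i → BFS.lay B (z i) ≡ suc (suc ℓ₀))
              (far : ∀ {i j} → z j ∈ Sets.ball G 5 (z i) → i ≡ j) where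
  open Sets G
  open BFS B
  open Teeth B
  module S = Spots Δ deg≤ B z ℓ₀ 2 in-z (λ i → ≤-reflexive (sym (lay-z i))) (λ i → ≤-reflexive (lay-z i)) far
  open S

  stem-top : ∀ i {v} → v ∈ stem i → suc (suc ℓ₀) ≤ lay v → v ≡ z i
  stem-top i p le with chain-spec (depth i) (in-z i) (≤-trans (n≤1+n _) (depth-≤ i)) p
  ... | zero  , t≤ , e = e
  ... | suc t , t≤ , refl = ⊥-elim (1+n≰n (≤-trans (s≤s (≤-trans le (m≤n+m _ t))) (≤-reflexive
          (trans (up-lay (suc t) (in-z i) (≤-trans t≤ (≤-trans (n≤1+n _) (depth-≤ i)))) (lay-z i)))))

  foot∈ : ∀ i → foot i ∈ stem i
  foot∈ i = up-∈ {depth i} {depth i} {z i} ≤-refl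

  -- Layer `ℓ₀ + 2` contributes nothing but spots. A stem here reaches up just to that layer, so its
  -- contacts with such a set involve its own spot: either that spot belongs to the set, or it is
  -- the vertex of the stem in contact.
  High : List (V G) → Set
  High vs = ∀ {v} → v ∈ vs → In v × suc (suc ℓ₀) ≤ lay v × (lay v ≡ suc (suc ℓ₀) → ∃ λ k → v ≡ z k)

  record Route {d : ℕ} (p q : Piece d) : Set where
    field
      vs   : List (V G)
      vs-conn : Conn vs
      high : High vs
      i j  : I
      i∈   : i ∈ Piece.ids p
      j∈   : j ∈ Piece.ids q
      zi∈  : z i ∈ vs
      zj∈  : z j ∈ vs

    con : List (V G)
    con = (stem i ++ vs) ++ stem j

    data Part (v : V G) : Set where
      onStem : ∀ k → k ≡ i ⊎ k ≡ j → v ∈ stem k → Part v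
      onPath : v ∈ vs → Part v

    part : ∀ {v} → v ∈ con → Part v
    part p with ∈-++⁻ (stem i ++ vs) p
    ... | inj₂ q = onStem j (inj₂ refl) q
    ... | inj₁ q with ∈-++⁻ (stem i) q
    ... | inj₁ r = onStem i (inj₁ refl) r
    ... | inj₂ r = onPath r

    zk∈ : ∀ {k} → k ≡ i ⊎ k ≡ j → z k ∈ vs
    zk∈ (inj₁ refl) = zi∈
    zk∈ (inj₂ refl) = zj∈

    con-conn : Conn con
    con-conn = conn-++ (conn-++ (stem-conn i) vs-conn (z i , z i , up-∈ {0} z≤n , zi∈ , inj₁ refl)) (stem-conn j)
      (z j , z j , ∈-++⁺ʳ (stem i) zj∈ , up-∈ {0} z≤n , inj₁ refl)
      where
      stem-conn : ∀ k → Conn (stem k)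
      stem-conn k = chain-conn (depth k) (in-z k) (≤-trans (n≤1+n _) (depth-≤ k))

    con-l : Touch con (Piece.body p)
    con-l = foot i , start i , ∈-++⁺ˡ (∈-++⁺ˡ (foot∈ i)) , Piece.ids∈ p i∈ , foot~start i

    con-r : Touch con (Piece.body q)
    con-r = foot j , start j , ∈-++⁺ʳ (stem i ++ vs) (foot∈ j) , Piece.ids∈ q j∈ , foot~start j

    con-high : ∀ {v} → v ∈ con → suc ℓ₀ ≤ lay v
    con-high p with part p
    ... | onStem k _ q = proj₁ (proj₂ (stem-spec k q))
    ... | onPath q     = ≤-trans (n≤1+n _) (proj₁ (proj₂ (high q)))

    con-piece′ : ∀ (s : Piece d) {u v} → Part u → v ∈ Piece.body s → u ~ v →
      Touch (Piece.body s) (Piece.body p) ⊎ Touch (Piece.body s) (Piece.body q)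
    con-piece′ s (onPath u∈) v∈ e = ⊥-elim (layers-apart (proj₁ (high u∈)) (proj₁ (proj₂ (high u∈))) (Piece.low s v∈) e)
    con-piece′ s (onStem k (inj₁ refl) u∈) v∈ e =
      inj₁ (start k , start k , stem-piece k s u∈ v∈ e , Piece.ids∈ p i∈ , inj₁ refl)
    con-piece′ s (onStem k (inj₂ refl) u∈) v∈ e =
      inj₂ (start k , start k , stem-piece k s u∈ v∈ e , Piece.ids∈ q j∈ , inj₁ refl)

    con-piece : ∀ (s : Piece d) → Touch con (Piece.body s) → Touch (Piece.body s) (Piece.body p) ⊎ Touch (Piece.body s) (Piece.body q)
    con-piece s (u , v , u∈ , v∈ , e) = con-piece′ s (part u∈) v∈ e

  open Route using (vs; con)

  stem-path : ∀ {k u v ws} → High ws → u ∈ stem k → v ∈ ws → u ~ v → z k ∈ ws ⊎ u ≡ z k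
  stem-path {k} {u} {v} {ws} hw u∈ v∈ e = decide (lay v ≟ℕ suc (suc ℓ₀))
    where
    at-top : (∃ λ k′ → v ≡ z k′) → z k ∈ ws
    at-top (k′ , eq) = subst (_∈ ws) (trans eq (cong z (sym (close (proj₂ (proj₂ (stem-spec k u∈))) (ball-refl 2) (subst (u ~_) eq e))))) v∈
    decide : Dec (lay v ≡ suc (suc ℓ₀)) → z k ∈ ws ⊎ u ≡ z k
    decide (yes l) = inj₁ (at-top (proj₂ (proj₂ (hw v∈)) l))
    decide (no ne) = inj₂ (stem-top k u∈ (≤-pred (≤-trans (≤∧≢⇒< (proj₁ (proj₂ (hw v∈))) (ne ∘ sym)) (lay-adj (proj₁ (stem-spec k u∈)) e))))

  stem-path-touch : ∀ {k u v ws ws′} → High ws → z k ∈ ws′ → u ∈ stem k → v ∈ ws → u ~ v → Touch ws′ ws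
  stem-path-touch {k} {u} {v} {ws} {ws′} hw zk u∈ v∈ e = cases (stem-path hw u∈ v∈ e)
    where
    cases : z k ∈ ws ⊎ u ≡ z k → Touch ws′ ws
    cases (inj₁ q)  = z k , z k , zk , q , inj₁ refl
    cases (inj₂ eq) = z k , v , zk , v∈ , subst (_~ v) eq e

  -- By `stem-path` a contact on a stem can be moved to the spot on top of it, and this spot lies on
  -- the path. Hence routes inherit the absence of contacts from their paths.
  routes-touch : ∀ {d} {p q p′ q′ : Piece d} (R : Route p q) (R′ : Route p′ q′) → Touch (con R) (con R′) → Touch (vs R) (vs R′)
  routes-touch R R′ (u , v , u∈ , v∈ , e) = parts (Route.part R u∈) (Route.part R′ v∈)
    where
    parts : Route.Part R u → Route.Part R′ v → Touch (vs R) (vs R′)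
    parts (Route.onPath p)      (Route.onPath q)        = u , v , p , q , e
    parts (Route.onStem k kk p) (Route.onPath q)        = stem-path-touch (Route.high R′) (Route.zk∈ R kk) p q e
    parts (Route.onPath p)      (Route.onStem k kk q)   = touch-sym (stem-path-touch (Route.high R) (Route.zk∈ R′ kk) q p (~-sym e))
    parts (Route.onStem k kk p) (Route.onStem k′ kk′ q) = z k , z k′ , Route.zk∈ R kk , Route.zk∈ R′ kk′ ,
      inj₁ (cong z (close (proj₂ (proj₂ (stem-spec k p))) (proj₂ (proj₂ (stem-spec k′ q))) e))

  module Model (H : Graph) {d : ℕ} (1≤d : 1 ≤ d) (pc : V H → Piece d)
               (pc-far : ∀ {x y} → Touch (Piece.body (pc x)) (Piece.body (pc y)) → x ≡ y)
               (route : ∀ {x y} → x <ᶠ y → Route (pc x) (pc y))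
               (route-far : ∀ {x y x′ y′} (l : x <ᶠ y) (l′ : x′ <ᶠ y′) → Touch (vs (route l)) (vs (route l′)) → x ≡ x′ × y ≡ y′) where
    open CleanStructures G (_≟_ {order H})

    Cmp : V H → V H → Set
    Cmp x y = Tri (x <ᶠ y) (x ≡ y) (y <ᶠ x)

    consAt : ∀ {x y} → Cmp x y → List (V G)
    consAt (tri< l _ _) = con (route l)
    consAt (tri≈ _ _ _) = []
    consAt (tri> _ _ g) = con (route g)

    cons : V H → V H → List (V G)
    cons x y = consAt (Finₚ.<-cmp x y)

    record View (x y : V H) : Set where
      constructor mkView
      field
        {a b} : V H
        l     : a <ᶠ b
        same  : SamePair x y a b
        eq    : cons x y ≡ con (route l)

    viewAt : ∀ {x y} → x ≢ y → (c : Cmp x y) → ∃₂ λ a b → Σ (a <ᶠ b) λ l → SamePair x y a b × consAt c ≡ con (route l)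
    viewAt ne (tri< l _ _) = _ , _ , l , inj₁ (refl , refl) , refl
    viewAt ne (tri≈ _ e _) = ⊥-elim (ne e)
    viewAt ne (tri> _ _ g) = _ , _ , g , inj₂ (refl , refl) , refl

    view : ∀ {x y} → x ≢ y → View x y
    view {x} {y} ne = let _ , _ , l , s , e = viewAt ne (Finₚ.<-cmp x y) in mkView l s e

    clean : Clean (λ _ → ⊤) (λ x y → not (does (x ≟ y)))
    clean = record
      { hub = Piece.body ∘ pc ; con = cons
      ; hub-pt = λ {x} _ → let i , i∈ = nonempty (Piece.ids (pc x)) (subst (1 ≤_) (sym (Piece.size (pc x))) 1≤d) in _ , Piece.ids∈ (pc x) i∈
      ; hub-conn = λ {x} _ → Piece.conn (pc x) ; hub-far = λ _ _ → pc-far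
      ; con-conn = λ { (edge _ _ ne _) → let mkView l _ e = view ne in subst Conn (sym e) (Route.con-conn (route l)) }
      ; con-l = λ { (edge _ _ ne _) → cl (view ne) } ; con-r = λ { (edge _ _ ne _) → cr (view ne) }
      ; con-out = λ { {z = c} (edge _ _ ne _) _ v∈ v∈′ → let mkView l _ e = view ne in
          1+n≰n (≤-trans (Route.con-high (route l) (subst (_ ∈_) e v∈)) (Piece.low (pc c) v∈′)) }
      ; con-hub = λ { {z = c} (edge _ _ ne _) _ t → ch c (view ne) t }
      ; con-con = λ { (edge _ _ ne _) (edge _ _ ne′ _) t → cc (view ne) (view ne′) t } }
      where
      cl : ∀ {x y} → View x y → Touch (cons x y) (Piece.body (pc x))
      cl (mkView l (inj₁ (refl , refl)) e) = subst (λ c → Touch c _) (sym e) (Route.con-l (route l))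
      cl (mkView l (inj₂ (refl , refl)) e) = subst (λ c → Touch c _) (sym e) (Route.con-r (route l))
      cr : ∀ {x y} → View x y → Touch (cons x y) (Piece.body (pc y))
      cr (mkView l (inj₁ (refl , refl)) e) = subst (λ c → Touch c _) (sym e) (Route.con-r (route l))
      cr (mkView l (inj₂ (refl , refl)) e) = subst (λ c → Touch c _) (sym e) (Route.con-l (route l))
      ch : ∀ c {x y} → View x y → Touch (cons x y) (Piece.body (pc c)) → c ≡ x ⊎ c ≡ y
      ch c {x} {y} (mkView {a} {b} l s e) t = sides s (Route.con-piece (route l) (pc c) (subst (λ l → Touch l _) e t))
        where
        sides : SamePair x y a b → Touch (Piece.body (pc c)) (Piece.body (pc a)) ⊎ Touch (Piece.body (pc c)) (Piece.body (pc b)) → c ≡ x ⊎ c ≡ y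
        sides (inj₁ (p , q)) (inj₁ t′) = inj₁ (trans (pc-far t′) (sym p))
        sides (inj₁ (p , q)) (inj₂ t′) = inj₂ (trans (pc-far t′) (sym q))
        sides (inj₂ (p , q)) (inj₁ t′) = inj₂ (trans (pc-far t′) (sym q))
        sides (inj₂ (p , q)) (inj₂ t′) = inj₁ (trans (pc-far t′) (sym p))
      pairs : ∀ {x y x′ y′ a b a′ b′ : V H} → SamePair x y a b → SamePair x′ y′ a′ b′ → a ≡ a′ × b ≡ b′ → SamePair x y x′ y′
      pairs (inj₁ (refl , refl)) (inj₁ (refl , refl)) (refl , refl) = inj₁ (refl , refl)
      pairs (inj₁ (refl , refl)) (inj₂ (refl , refl)) (refl , refl) = inj₂ (refl , refl)
      pairs (inj₂ (refl , refl)) (inj₁ (refl , refl)) (refl , refl) = inj₂ (refl , refl)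
      pairs (inj₂ (refl , refl)) (inj₂ (refl , refl)) (refl , refl) = inj₁ (refl , refl)
      cc : ∀ {x y x′ y′} → View x y → View x′ y′ → Touch (cons x y) (cons x′ y′) → SamePair x y x′ y′
      cc (mkView l s e) (mkView l′ s′ e′) t = pairs s s′ (route-far l l′ (routes-touch (route l) (route l′) (subst₂ Touch e e′ t)))

    sparse⇒model : InducedMinorModel H G
    sparse⇒model = complete⇒model H clean id id (λ _ → tt) λ ne → cong not (dec-false (_ ≟ _) ne)

-- Grids of crossings

length-product : {A B : Set} (xs : List A) (ys : List B) → length (cartesianProduct xs ys) ≡ length xs * length ys
length-product []       ys = refl
length-product (x ∷ xs) ys = trans (length-++ (map (x ,_) ys)) (cong₂ _+_ (length-map (x ,_) ys) (length-product xs ys))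

enumerate : {A : Set} (_≟ᴬ_ : DecidableEquality A) {k : ℕ} (xs : List A) → Unique xs → length xs ≡ k →
  ∃ λ (f : Fin k → A) → (∀ {i j} → f i ≡ f j → i ≡ j) × (∀ i → f i ∈ xs)
enumerate _≟ᴬ_ xs uq refl = lookup xs , (λ {i} {j} → Menger.lookup-inj _≟ᴬ_ uq i j) , ∈-lookup

-- With `e = 4 * 2 ^ h`, more than `e * e` crossings occupy at least `e` rows or at least `e`
-- columns, and `e` distinct paths per piece are what `dense⇒model` asks for.
pieceSize : ℕ → ℕ
pieceSize h = suc (suc (4 * 2 ^ h * (4 * 2 ^ h)))

pieceTotal : ℕ → ℕ → ℕ
pieceTotal Δ h = suc (pieceSize h) * (pieceSize h + ballBound Δ 4 * pieceSize h)

abstract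
  -- For this `N` the `N * N` crossings pay for `N + N` pieces. At least `N` of those are then rich
  -- in rows, or at least `N` are rich in columns, which matches the number of paths.
  gridSize : ℕ → ℕ → ℕ
  gridSize Δ h = (pieceTotal Δ h + pieceTotal Δ h) + pieceSize h

  gridSize-def : ∀ Δ h → gridSize Δ h ≡ (pieceTotal Δ h + pieceTotal Δ h) + pieceSize h
  gridSize-def Δ h = refl

1≤gridSize : ∀ Δ h → 1 ≤ gridSize Δ h
1≤gridSize Δ h = subst (1 ≤_) (sym (gridSize-def Δ h)) (≤-trans (s≤s z≤n) (m≤n+m (pieceSize h) (pieceTotal Δ h + pieceTotal Δ h)))

record Family (G : Graph) {r : V G} (B : BFS G r) (ℓ₀ L N : ℕ) : Set where
  open Sets G
  open BFS B
  field
    pt    : Fin N → List (V G)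
    ne    : ∀ a → ∃ (_∈ pt a)
    conn  : ∀ a → Conn (pt a)
    clean : ∀ {a b} → Touch (pt a) (pt b) → a ≡ b
    bound : ∀ {a v} → v ∈ pt a → In v × suc (suc ℓ₀) ≤ lay v × lay v ≤ L + ℓ₀

  select : ∀ {k} (f : Fin k → Fin N) → (∀ {i j} → f i ≡ f j → i ≡ j) → Family G B ℓ₀ L k
  select f inj = record { pt = pt ∘ f ; ne = ne ∘ f ; conn = conn ∘ f ; clean = inj ∘ clean ; bound = bound }

-- The radius in `far-row` and `far-col` is one more than the distance that `Spots` demands, because
-- a crossing may be only next to its column.
module Selected (H G : Graph) (Δ : ℕ) (deg≤ : MaxDegree≤ G Δ) {r : V G} (B : BFS G r) (ℓ₀ L : ℕ)
                (R C : Family G B ℓ₀ L (gridSize Δ (order H)))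
                (z : Fin (gridSize Δ (order H)) → Fin (gridSize Δ (order H)) → V G)
                (z-row : ∀ a b → z a b ∈ Family.pt R a)
                (z-col : ∀ a b → Sets.Touch G (z a b ∷ []) (Family.pt C b))
                (far-row : ∀ {a b a′ v} → v ∈ Family.pt R a′ → v ∈ Sets.ball G (suc (L + (1 + L))) (z a b) → a′ ≡ a)
                (far-col : ∀ {a b b′ v} → v ∈ Family.pt C b′ → v ∈ Sets.ball G (suc (L + (1 + L))) (z a b) → b′ ≡ b) where
  open Sets G
  private
    N = gridSize Δ (order H)
    e = 4 * 2 ^ order H
    d = pieceSize (order H)
    I = Fin N × Fin N

  zz : I → V G
  zz (a , b) = z a b

  zz-bound : ∀ i → BFS.In B (zz i) × suc (suc ℓ₀) ≤ BFS.lay B (zz i) × BFS.lay B (zz i) ≤ L + ℓ₀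
  zz-bound (a , b) = Family.bound R (z-row a b)

  far : ∀ {i j} → zz j ∈ ball (L + (1 + L)) (zz i) → i ≡ j
  far {a , b} {a′ , b′} p = cong₂ _,_ (sym (far-row (z-row a′ b′) (ball-mono (n≤1+n _) p))) (sym (col (z-col a′ b′)))
    where
    col : Touch (zz (a′ , b′) ∷ []) (Family.pt C b′) → b′ ≡ b
    col (_ , v , here refl , v∈ , t) = far-col v∈ (ball-step (L + (1 + L)) p t)

  module S = Spots Δ deg≤ B zz ℓ₀ L (proj₁ ∘ zz-bound) (proj₁ ∘ proj₂ ∘ zz-bound) (proj₂ ∘ proj₂ ∘ zz-bound) far

  1+L≤ : 1 + L ≤ suc (L + (1 + L))
  1+L≤ = s≤s (m≤m+n L (1 + L))

  rowPaths : S.Paths N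
  rowPaths = record
    { pt = Family.pt R ; pt-conn = Family.conn R ; pt-far = Family.clean R
    ; pt-in = λ p → let i , l , _ = Family.bound R p in i , l ; owner = proj₁
    ; touch-z = λ (a , b) → z a b , z a b , here refl , z-row a b , inj₁ refl ; pt-ne = Family.ne R
    ; others = λ p q → far-row p (ball-mono 1+L≤ q) }

  colPaths : S.Paths N
  colPaths = record
    { pt = Family.pt C ; pt-conn = Family.conn C ; pt-far = Family.clean C
    ; pt-in = λ p → let i , l , _ = Family.bound C p in i , l ; owner = proj₂
    ; touch-z = λ (a , b) → z-col a b ; pt-ne = Family.ne C
    ; others = λ p q → far-col p (ball-mono 1+L≤ q) }

  is : List I
  is = cartesianProduct (allFin N) (allFin N)

  enough : (N + N) * S.pieceCost d + d ≤ length is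
  enough = ≤-trans (+-monoʳ-≤ ((N + N) * c) (≤-trans (≤-reflexive (sym (+-identityʳ d))) (*-monoˡ-≤ d (1≤gridSize Δ (order H)))))
    (≤-reflexive (trans (arith N c d) (trans (cong (N *_) (sym (gridSize-def Δ (order H))))
      (sym (trans (length-product (allFin N) (allFin N)) (cong₂ _*_ (length-tabulate {n = N} id) (length-tabulate {n = N} id)))))))
    where
    c = S.pieceCost d
    arith : ∀ n c d → (n + n) * c + n * d ≡ n * ((c + c) + d)
    arith = solve-∀

  found : ∃ λ ps → length ps ≡ N + N × AllPairs S.NonTouching ps × All (S.Inside is {d}) ps
  found = S.pieces (e * e) (N + N) is (Uniqueₚ.cartesianProduct⁺ (Uniqueₚ.allFin⁺ N) (Uniqueₚ.allFin⁺ N)) enough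

  owners₁ owners₂ : S.Piece d → List (Fin N)
  owners₁ p = deduplicate _≟_ (map proj₁ (S.Piece.ids p))
  owners₂ p = deduplicate _≟_ (map proj₂ (S.Piece.ids p))

  rich? : ∀ p → Dec (e ≤ length (owners₁ p))
  rich? p = e ≤? length (owners₁ p)

  other-rich : ∀ p → ¬ (e ≤ length (owners₁ p)) → e ≤ length (owners₂ p)
  other-rich p ¬r = ≮⇒≥ λ lt → <⇒≱ {e * e} (n≤1+n (suc (e * e))) (≤-trans (≤-reflexive (sym (S.Piece.size p)))
    (≤-trans (uniq-length (S.Piece.uniq p) cover)
      (≤-trans (≤-reflexive (length-product (owners₁ p) (owners₂ p)))
        (*-mono-≤ (≰⇒≥ ¬r) (≤-trans (n≤1+n _) lt)))))
    where
    cover : S.Piece.ids p ⊆ cartesianProduct (owners₁ p) (owners₂ p)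
    cover i∈ = ∈-cartesianProduct⁺ (∈-deduplicate⁺ _≟_ (∈-map⁺ proj₁ i∈)) (∈-deduplicate⁺ _≟_ (∈-map⁺ proj₂ i∈))

  1≤N : 1 ≤ N
  1≤N = 1≤gridSize Δ (order H)

  conclude : ∀ ps → length ps ≡ N + N → AllPairs S.NonTouching ps → InducedMinorModel H G
  conclude ps len ap = choose (N ≤? length A)
    where
    A = filter rich? ps
    A′ = filter (¬? ∘ rich?) ps
    choose : Dec (N ≤ length A) → InducedMinorModel H G
    choose (yes le) = S.Dense.dense⇒model rowPaths A (AllPairsₚ.filter⁺ rich? ap) (s≤s z≤n) H
      (Allₚ.all-filter rich? ps) le (≤-trans 1≤N le)
    choose (no ¬le) = S.Dense.dense⇒model colPaths A′ (AllPairsₚ.filter⁺ (¬? ∘ rich?) ap) (s≤s z≤n) H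
      (All.map (λ {p} → other-rich p) (Allₚ.all-filter (¬? ∘ rich?) ps)) le′ (≤-trans 1≤N le′)
      where
      le′ : N ≤ length A′
      le′ = +-cancelˡ-≤ N _ _ (≤-trans (≤-reflexive (trans (sym len) (filter-split rich? ps))) (+-monoˡ-≤ (length A′) (≰⇒≥ ¬le)))

  selected⇒model : InducedMinorModel H G
  selected⇒model = let ps , len , ap , _ = found in conclude ps len ap

nearBound : ℕ → ℕ → ℕ
nearBound Δ L = ballBound Δ (suc (L + (1 + L)))

cleanCols : ℕ → ℕ → ℕ → ℕ
cleanCols Δ h L = gridSize Δ h * suc (gridSize Δ h * nearBound Δ L + gridSize Δ h * nearBound Δ L)

-- Whether a row passes near the crossing of another row with a column depends on three indices.
-- Homogenising the columns for all pairs of rows removes the dependence on the column, so the rows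
-- can be thinned with respect to one column `b₀`, and then the columns with respect to the selected
-- rows.
module Select (H G : Graph) (Δ : ℕ) (deg≤ : MaxDegree≤ G Δ) {r : V G} (B : BFS G r) (ℓ₀ L : ℕ) (n n₂ : ℕ)
              (n-big : gridSize Δ (order H) * suc (nearBound Δ L + nearBound Δ L) ≤ n)
              (n₂-big : 2 ^ (n * n) * cleanCols Δ (order H) L ≤ n₂)
              (R : Family G B ℓ₀ L n) (C : Family G B ℓ₀ L n₂)
              (meet : ∀ a b → Sets.Touch G (Family.pt R a) (Family.pt C b)) where
  open Sets G
  open Degree G Δ deg≤
  private
    h = order H
    N = gridSize Δ h
    ρ = suc (L + (1 + L))

  z : Fin n → Fin n₂ → V G
  z a b = proj₁ (meet a b)

  z-row : ∀ a b → z a b ∈ Family.pt R a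
  z-row a b = proj₁ (proj₂ (proj₂ (meet a b)))

  z-col : ∀ a b → Touch (z a b ∷ []) (Family.pt C b)
  z-col a b = let u , v , _ , v∈ , e = meet a b in u , v , here refl , v∈ , e

  Near : Fin n → Fin n₂ → List (V G) → Set
  Near a b vs = Any (_∈ ball ρ (z a b)) vs

  near? : ∀ a b vs → Dec (Near a b vs)
  near? a b vs = any? (_∈? ball ρ (z a b)) vs

  NearRow : Fin n₂ → Fin n → Fin n → Set
  NearRow b a a′ = Near a b (Family.pt R a′)

  preds : List (Fin n₂ → Bool)
  preds = map (λ (a , a′) b → does (near? a b (Family.pt R a′))) (cartesianProduct (allFin n) (allFin n))

  length-preds : length preds ≡ n * n
  length-preds = trans (length-map _ (cartesianProduct (allFin n) (allFin n)))
    (trans (length-product (allFin n) (allFin n)) (cong₂ _*_ (length-tabulate {n = n} id) (length-tabulate {n = n} id)))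

  hom : ∃ λ bs → bs ⊆ allFin n₂ × Unique bs × cleanCols Δ h L ≤ length bs ×
    (∀ {b b′ a a′} → b ∈ bs → b′ ∈ bs → NearRow b a a′ → NearRow b′ a a′)
  hom with homogenise preds (allFin n₂) (Uniqueₚ.allFin⁺ n₂)
  ... | bs , sub , uq , len , const = bs , sub , uq ,
      *-cancelˡ-≤ (2 ^ (n * n)) {{m^n≢0 2 (n * n)}} (≤-trans (≤-trans n₂-big (≤-reflexive (sym (length-tabulate {n = n₂} id))))
        (subst (λ m → length (allFin n₂) ≤ 2 ^ m * length bs) length-preds len)) , transfer
    where
    from-does : ∀ {P : Set} (x : Dec P) → does x ≡ true → P
    from-does (yes p) _ = p
    transfer : ∀ {b b′ a a′} → b ∈ bs → b′ ∈ bs → NearRow b a a′ → NearRow b′ a a′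
    transfer {b} {b′} {a} {a′} p q nr = cases (const (∈-map⁺ (λ (a , a′) b → does (near? a b (Family.pt R a′))) {x = a , a′}
        (∈-cartesianProduct⁺ (∈-allFin a) (∈-allFin a′))))
      where
      cases : (∀ {y} → y ∈ bs → does (near? a y (Family.pt R a′)) ≡ true) ⊎ (∀ {y} → y ∈ bs → does (near? a y (Family.pt R a′)) ≡ false) →
        NearRow b′ a a′
      cases (inj₁ t) = from-does (near? a b′ (Family.pt R a′)) (t q)
      cases (inj₂ f) = ⊥-elim (absurd (trans (sym (dec-true (near? a b (Family.pt R a′)) nr)) (f p)))
        where
        absurd : true ≢ false
        absurd ()

  module WithCols (bs : List (Fin n₂)) (uqb : Unique bs) (len-b : cleanCols Δ h L ≤ length bs)
                  (transfer : ∀ {b b′ a a′} → b ∈ bs → b′ ∈ bs → NearRow b a a′ → NearRow b′ a a′) where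

    b₀ : ∃ (_∈ bs)
    b₀ = nonempty bs (≤-trans (*-mono-≤ (1≤gridSize Δ h) (s≤s z≤n)) len-b)

    rows : ∃ λ as → as ⊆ allFin n × Unique as × length as ≡ N × (∀ {a a′} → a ∈ as → a′ ∈ as → NearRow (proj₁ b₀) a a′ → a ≡ a′)
    rows = independent (λ a a′ → near? a (proj₁ b₀) (Family.pt R a′)) _≟_ (nearBound Δ L) N (allFin n) (Uniqueₚ.allFin⁺ n) out
      (≤-trans n-big (≤-reflexive (sym (length-tabulate {n = n} id))))
      where
      out : ∀ {a} ys → Unique ys → a ∈ allFin n → (∀ {y} → y ∈ ys → y ∈ allFin n × NearRow (proj₁ b₀) a y) → length ys ≤ nearBound Δ L
      out {a} ys uq _ f = ≤-trans (inj-length (λ y v → v ∈ Family.pt R y) uq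
        (λ y∈ → let v , v∈ , p = find (proj₂ (f y∈)) in v , p , v∈)
        (λ _ _ p q → Family.clean R (_ , _ , p , q , inj₁ refl))) (ball-≤ ρ (z a (proj₁ b₀)))

    module WithRows (as : List (Fin n)) (uqa : Unique as) (len-a : length as ≡ N)
                    (ind : ∀ {a a′} → a ∈ as → a′ ∈ as → NearRow (proj₁ b₀) a a′ → a ≡ a′) where

      NearCol : Fin n₂ → Fin n₂ → Set
      NearCol b b′ = Any (λ a → Near a b (Family.pt C b′)) as

      cols : ∃ λ cs → cs ⊆ bs × Unique cs × length cs ≡ N × (∀ {b b′} → b ∈ cs → b′ ∈ cs → NearCol b b′ → b ≡ b′)
      cols = independent (λ b b′ → any? (λ a → near? a b (Family.pt C b′)) as) _≟_ (N * nearBound Δ L) N bs uqb out len-b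
        where
        out : ∀ {b} ys → Unique ys → b ∈ bs → (∀ {y} → y ∈ ys → y ∈ bs × NearCol b y) → length ys ≤ N * nearBound Δ L
        out {b} ys uq _ f = ≤-trans (inj-length (λ y v → v ∈ Family.pt C y) uq wit
            (λ _ _ p q → Family.clean C (_ , _ , p , q , inj₁ refl)))
            (subst (λ m → length (concatMap (λ a → ball ρ (z a b)) as) ≤ m * nearBound Δ L) len-a
              (length-concatMap-≤ (λ a → ball ρ (z a b)) (nearBound Δ L) as (λ _ → ball-≤ ρ _)))
          where
          wit : ∀ {y} → y ∈ ys → ∃ λ v → v ∈ concatMap (λ a → ball ρ (z a b)) as × v ∈ Family.pt C y
          wit y∈ = let a , a∈ , p = find (proj₂ (f y∈)) ; v , v∈ , q = find p in v , ∈-concatMap (λ a → ball ρ (z a b)) a∈ q , v∈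

      module Final (cs : List (Fin n₂)) (cs⊆ : cs ⊆ bs) (uqc : Unique cs) (len-c : length cs ≡ N)
                   (ind′ : ∀ {b b′} → b ∈ cs → b′ ∈ cs → NearCol b b′ → b ≡ b′) where
        fa = enumerate _≟_ as uqa len-a
        fb = enumerate _≟_ cs uqc len-c

        model : InducedMinorModel H G
        model = Selected.selected⇒model H G Δ deg≤ B ℓ₀ L
          (Family.select R (proj₁ fa) (proj₁ (proj₂ fa))) (Family.select C (proj₁ fb) (proj₁ (proj₂ fb)))
          (λ a b → z (proj₁ fa a) (proj₁ fb b)) (λ a b → z-row _ _) (λ a b → z-col _ _)
          (λ {a} {b} {a′} v∈ p → sym (proj₁ (proj₂ fa) (ind (proj₂ (proj₂ fa) a) (proj₂ (proj₂ fa) a′)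
             (transfer (cs⊆ (proj₂ (proj₂ fb) b)) (proj₂ b₀) (lose v∈ p)))))
          (λ {a} {b} {b′} v∈ p → sym (proj₁ (proj₂ fb) (ind′ (proj₂ (proj₂ fb) b) (proj₂ (proj₂ fb) b′)
             (lose (proj₂ (proj₂ fa) a) (lose v∈ p)))))

      model : InducedMinorModel H G
      model = let cs , sub , uq , len , ind′ = cols in Final.model cs sub uq len ind′

    model : InducedMinorModel H G
    model = let as , _ , uq , len , ind = rows in WithRows.model as uq len ind

  grid⇒model : InducedMinorModel H G
  grid⇒model = let bs , _ , uq , len , transfer = hom in WithCols.model bs uq len transfer

-- Separators of windows

collect : ∀ {k} {P : Fin k → Set} {Q : Set} → (∀ i → P i ⊎ Q) → (∀ i → P i) ⊎ Q
collect {zero}  f = inj₁ λ ()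
collect {suc k} f with f fzero | collect (f ∘ fsuc)
... | inj₂ q | _      = inj₂ q
... | inj₁ _ | inj₂ q = inj₂ q
... | inj₁ p | inj₁ g = inj₁ λ { fzero → p ; (fsuc i) → g i }

orderedPairs : ∀ h → List (Fin h × Fin h)
orderedPairs h = filter (λ (x , y) → x Finₚ.<? y) (cartesianProduct (allFin h) (allFin h))

∈-orderedPairs : ∀ {h} {x y : Fin h} → x <ᶠ y → (x , y) ∈ orderedPairs h
∈-orderedPairs {h} {x} {y} lt = ∈-filter⁺ (λ (x , y) → x Finₚ.<? y) (∈-cartesianProduct⁺ (∈-allFin x) (∈-allFin y)) lt

-- `closed` makes `P` one side of the separator `Z` within `X`; `S₁` and `S₂` are large parts of `S`
-- on the two sides.
record Splitting (G : Graph) (X : V G → Set) (S : List (V G)) (k m : ℕ) : Set where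
  field
    Z P    : List (V G)
    Z-≤    : length Z ≤ k
    closed : ∀ {u v} → u ∈ P → X v → adj G u v ≡ true → v ∉ Z → v ∈ P
    avoid  : ∀ {v} → v ∈ P → v ∉ Z
    S₁ S₂  : List (V G)
    uq₁    : Unique S₁
    uq₂    : Unique S₂
    sub₁   : ∀ {v} → v ∈ S₁ → v ∈ S × v ∈ P
    sub₂   : ∀ {v} → v ∈ S₂ → v ∈ S × v ∉ P × v ∉ Z
    big₁   : m ≤ length S₁
    big₂   : m ≤ length S₂

module Structure (H G : Graph) (Δ : ℕ) (deg≤ : MaxDegree≤ G Δ) {r : V G} (B : BFS G r) (ℓ₀ w : ℕ)
                 (n n₂ K : ℕ) (n-big : gridSize Δ (order H) * suc (nearBound Δ (3 + w) + nearBound Δ (3 + w)) ≤ n)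
                 (n₂-big : 2 ^ (n * n) * cleanCols Δ (order H) (3 + w) ≤ n₂)
                 (K-big : familySize n n₂ (length (orderedPairs (order H))) ≤ K) where
  open Sets G
  open Degree G Δ deg≤
  open BFS B
  open Teeth B
  open CleanMenger G Δ deg≤

  -- The ancestors in layer `ℓ₀ + 2` are within `suc w` of their vertices; two such detours and the
  -- distance 5 that `Sparse` needs between ancestors add up to `ρ`.
  ρ : ℕ
  ρ = suc w + (5 + suc w)

  -- The layers under the window have fixed duties: `ℓ₀ + 2` holds the ends of the paths, `ℓ₀ + 1`
  -- the feet of the stems, and the pieces stay in layers up to `ℓ₀`.
  InX : V G → Set
  InX v = In v × 3 + ℓ₀ ≤ lay v × lay v ≤ (3 + w) + ℓ₀

  inX? : ∀ v → Dec (InX v)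
  inX? v = In? v ×-dec ((3 + ℓ₀ ≤? lay v) ×-dec (lay v ≤? (3 + w) + ℓ₀))

  X : List (V G)
  X = filter inX? (allFin (order G))

  ∈-X : ∀ {v} → InX v → v ∈ X
  ∈-X {v} = ∈-filter⁺ inX? (∈-allFin v)

  ∈-X⁻ : ∀ {v} → v ∈ X → InX v
  ∈-X⁻ p = proj₂ (∈-filter⁻ inX? {xs = allFin (order G)} p)

  module FarSet (ys : List (V G)) (ys-X : ∀ {v} → v ∈ ys → InX v)
                (ys-far : AllPairs (λ x y → ¬ (y ∈ ball ρ x)) ys) where

    I = Fin (length ys)

    sv : I → V G
    sv = lookup ys

    svX : ∀ i → InX (sv i)
    svX i = ys-X (∈-lookup i)

    sv-far : ∀ {i j} → sv j ∈ ball ρ (sv i) → i ≡ j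
    sv-far = allPairs-lookup {R = λ x y → y ∈ ball ρ x} (ball-sym ρ) ys-far

    dep : I → ℕ
    dep i = lay (sv i) ∸ (2 + ℓ₀)

    dep-eq : ∀ i → dep i + (2 + ℓ₀) ≡ lay (sv i)
    dep-eq i = m∸n+n≡m (≤-trans (n≤1+n _) (proj₁ (proj₂ (svX i))))

    dep-≤ : ∀ i → dep i ≤ lay (sv i)
    dep-≤ i = subst (dep i ≤_) (dep-eq i) (m≤m+n (dep i) (2 + ℓ₀))

    dep-w : ∀ i → dep i ≤ suc w
    dep-w i = +-cancelʳ-≤ (2 + ℓ₀) _ _ (subst₂ _≤_ (sym (dep-eq i)) (shift w ℓ₀) (proj₂ (proj₂ (svX i))))
      where
      shift : ∀ w l → (3 + w) + l ≡ suc w + (2 + l)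
      shift = solve-∀

    u : I → V G
    u i = up (dep i) (sv i)

    tooth : I → List (V G)
    tooth i = chain (dep i) (sv i)

    in-u : ∀ i → In (u i)
    in-u i = up-in (dep i) (proj₁ (svX i)) (dep-≤ i)

    lay-u : ∀ i → lay (u i) ≡ 2 + ℓ₀
    lay-u i = +-cancelˡ-≡ (dep i) _ _ (trans (up-lay (dep i) (proj₁ (svX i)) (dep-≤ i)) (sym (dep-eq i)))

    tooth-spec : ∀ i {v} → v ∈ tooth i → v ∈ ball (suc w) (sv i) × (v ≡ u i ⊎ InX v)
    tooth-spec i {v} p = from (chain-spec (dep i) (proj₁ (svX i)) (dep-≤ i) p)
      where
      from : (∃ λ t → t ≤ dep i × v ≡ up t (sv i)) → v ∈ ball (suc w) (sv i) × (v ≡ u i ⊎ InX v)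
      from (t , t≤ , refl) = ball-mono (≤-trans t≤ (dep-w i)) (up-ball t (proj₁ (svX i)) t≤′) , side (t ≟ℕ dep i)
        where
        t≤′ = ≤-trans t≤ (dep-≤ i)
        eq = up-lay t (proj₁ (svX i)) t≤′
        side : Dec (t ≡ dep i) → up t (sv i) ≡ u i ⊎ InX (up t (sv i))
        side (yes e) = inj₁ (cong (λ k → up k (sv i)) e)
        side (no ne) = inj₂ (up-in t (proj₁ (svX i)) t≤′ ,
          +-cancelˡ-≤ t _ _ (≤-trans (≤-reflexive (+-suc t (2 + ℓ₀))) (≤-trans (+-monoˡ-≤ (2 + ℓ₀) (≤∧≢⇒< t≤ ne)) (≤-reflexive (trans (dep-eq i) (sym eq))))) ,
          ≤-trans (≤-trans (m≤n+m _ t) (≤-reflexive eq)) (proj₂ (proj₂ (svX i))))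

    u-ball : ∀ i → u i ∈ ball (suc w) (sv i)
    u-ball i = proj₁ (tooth-spec i (up-∈ {dep i} {dep i} {sv i} ≤-refl))

    meet : ∀ {i j a b} → a ∈ ball (suc w) (sv i) → b ∈ ball (suc w) (sv j) → b ∈ ball 5 a → i ≡ j
    meet {i} {j} p q e = sv-far (ball-trans (5 + suc w) (suc w) (ball-trans (suc w) 5 p e) (ball-sym (suc w) q))

    u-far : ∀ {i j} → u j ∈ ball 5 (u i) → i ≡ j
    u-far {i} {j} = meet (u-ball i) (u-ball j)

    module SP = Sparse Δ deg≤ B u ℓ₀ in-u lay-u u-far
    open SP.S using (Piece)

    U : List (V G)
    U = X ++ map u (allFin (length ys))

    u∈U : ∀ i → u i ∈ U
    u∈U i = ∈-++⁺ʳ X (∈-map⁺ u (∈-allFin i))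

    U-spec : ∀ {v} → v ∈ U → InX v ⊎ (∃ λ k → v ≡ u k)
    U-spec p = [ (λ q → inj₁ (∈-X⁻ q)) , (λ q → inj₂ (let k , _ , e = ∈-map⁻ u q in k , e)) ]′ (∈-++⁻ X p)

    U-bound : ∀ {v} → v ∈ U → In v × 2 + ℓ₀ ≤ lay v × lay v ≤ (3 + w) + ℓ₀
    U-bound p = cases (U-spec p)
      where
      cases : ∀ {v} → InX v ⊎ (∃ λ k → v ≡ u k) → In v × 2 + ℓ₀ ≤ lay v × lay v ≤ (3 + w) + ℓ₀
      cases (inj₁ (i , l , l′)) = i , ≤-trans (n≤1+n _) l , l′
      cases (inj₂ (k , refl)) = in-u k , ≤-reflexive (sym (lay-u k)) ,
        ≤-trans (≤-reflexive (lay-u k)) (+-monoˡ-≤ ℓ₀ (s≤s (s≤s z≤n)))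

    U-high : ∀ {vs} → vs ⊆ U → SP.High vs
    U-high sub p = proj₁ (U-bound (sub p)) , proj₁ (proj₂ (U-bound (sub p))) , λ l → cases l (U-spec (sub p))
      where
      cases : ∀ {v} → lay v ≡ 2 + ℓ₀ → InX v ⊎ (∃ λ k → v ≡ u k) → ∃ λ k → v ≡ u k
      cases l (inj₁ (_ , l′ , _)) = ⊥-elim (1+n≰n (subst (3 + ℓ₀ ≤_) l l′))
      cases l (inj₂ q) = q

    ends : List I → List (V G)
    ends = map u

    ends⊆U : ∀ {is} → ends is ⊆ U
    ends⊆U p = let k , _ , e = ∈-map⁻ u p in subst (_∈ U) (sym e) (u∈U k)

    ends-indep : ∀ {is js a a′} → a ∈ ends is ++ ends js → a′ ∈ ends is ++ ends js → adj G a a′ ≢ true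
    ends-indep {is} {js} p q e = distinct (isU p) (isU q)
      where
      isU : ∀ {a} → a ∈ ends is ++ ends js → ∃ λ k → a ≡ u k
      isU p = [ (λ q → let k , _ , e = ∈-map⁻ u q in k , e) , (λ q → let k , _ , e = ∈-map⁻ u q in k , e) ]′ (∈-++⁻ (ends is) p)
      distinct : (∃ λ k → _ ≡ u k) → (∃ λ k → _ ≡ u k) → ⊥
      distinct (k , refl) (k′ , refl) = adj-≢ e (cong u (u-far (ball-mono {1} (s≤s z≤n) (ball-1 (inj₂ e)))))

    module Separated {is js : List I} (uqi : Unique is) (uqj : Unique js) (Z : List (V G)) (hits : Hits (edges U) (ends is) (ends js) Z) where
      open Components (_≟_ {order G})

      W : List (V G)
      W = filter (λ v → ¬? (v ∈? Z)) U

      ∈-W : ∀ {v} → v ∈ U → v ∉ Z → v ∈ W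
      ∈-W = ∈-filter⁺ (λ v → ¬? (v ∈? Z))

      ∈-W⁻ : ∀ {v} → v ∈ W → v ∈ U × v ∉ Z
      ∈-W⁻ = ∈-filter⁻ (λ v → ¬? (v ∈? Z)) {xs = U}

      κ : V G → V G
      κ = comp (edges W)

      κ-adj : ∀ {a b} → a ∈ W → b ∈ W → adj G a b ≡ true → κ a ≡ κ b
      κ-adj p q e = comp-edge (∈-edges p q e)

      InP : V G → Set
      InP v = v ∈ W × Any (λ a → a ∈ W × κ a ≡ κ v) (ends is)

      inP? : ∀ v → Dec (InP v)
      inP? v = (v ∈? W) ×-dec any? (λ a → (a ∈? W) ×-dec (κ a ≟ κ v)) (ends is)

      P : List (V G)
      P = filter inP? X

      Good : I → Set
      Good i = All (_∉ Z) (tooth i)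

      good? : ∀ i → Dec (Good i)
      good? i = all? (λ v → ¬? (v ∈? Z)) (tooth i)

      tooth⊆U : ∀ i → tooth i ⊆ U
      tooth⊆U i p = [ (λ e → subst (_∈ U) (sym e) (u∈U i)) , (λ q → ∈-++⁺ˡ (∈-X q)) ]′ (proj₂ (tooth-spec i p))

      tooth-κ : ∀ i → Good i → κ (sv i) ≡ κ (u i)
      tooth-κ i g = along (dep i) (proj₁ (svX i)) (dep-≤ i) (λ p → ∈-W (tooth⊆U i p) (All.lookup g p))
        where
        along : ∀ k {x} → In x → k ≤ lay x → chain k x ⊆ W → κ x ≡ κ (up k x)
        along zero    _ _ _ = refl
        along (suc k) i le sub = trans (κ-adj (sub (here refl)) (sub (there (up-∈ {0} {k} z≤n))) (adj-symm (proj₁ (parent i le))))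
          (along k (proj₁ (proj₂ (parent i le))) (parent-≤ i le) (sub ∘ there))

      sv∈ : ∀ i → sv i ∈ tooth i
      sv∈ i = up-∈ {0} {dep i} z≤n

      u∈ : ∀ i → u i ∈ tooth i
      u∈ i = up-∈ {dep i} {dep i} {sv i} ≤-refl

      goodOnes : List I → List I
      goodOnes = filter good?

      many : ∀ {ks} → Unique ks → length ks ≤ length Z + length (goodOnes ks)
      many {ks} uq = ≤-trans (≤-reflexive (trans (filter-split good? ks) (+-comm (length (goodOnes ks)) _)))
        (+-monoˡ-≤ (length (goodOnes ks)) (inj-length (λ i v → v ∈ tooth i) (Uniqueₚ.filter⁺ (¬? ∘ good?) uq) wit
          (λ {i} {j} _ _ p q → meet (proj₁ (tooth-spec i p)) (proj₁ (tooth-spec j q)) (ball-refl 5))))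
        where
        wit : ∀ {i} → i ∈ filter (¬? ∘ good?) ks → ∃ λ v → v ∈ Z × v ∈ tooth i
        wit {i} i∈ with any? (_∈? Z) (tooth i)
        ... | yes p = let v , v∈ , q = find p in v , q , v∈
        ... | no ¬p = ⊥-elim (proj₂ (∈-filter⁻ (¬? ∘ good?) {xs = ks} i∈) (Allₚ.¬Any⇒All¬ _ ¬p))

      sv-inj : ∀ {i j} → sv i ≡ sv j → i ≡ j
      sv-inj {i} {j} e = sv-far (subst (_∈ ball ρ (sv i)) e (ball-refl ρ))

      -- Teeth are disjoint, so `Z` spoils at most `length Z` of them. An unspoilt tooth joins its
      -- vertex to its end without meeting `Z`; as `Z` separates the ends of `is` from those of
      -- `js`, it also separates the vertices.
      splitting : ∀ {S k m} → ys ⊆ S → length Z ≤ k → m + length Z ≤ length is → m + length Z ≤ length js → Splitting G InX S k m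
      splitting {S} {k} {m} sub Z≤ bi bj = record
        { Z = Z ; P = P ; Z-≤ = Z≤
        ; closed = λ p xv e v∉ → closed (∈-filter⁻ inP? {xs = X} p) xv e v∉
        ; avoid = λ p → proj₂ (∈-W⁻ (proj₁ (proj₂ (∈-filter⁻ inP? {xs = X} p))))
        ; S₁ = map sv (goodOnes is) ; S₂ = map sv (goodOnes js)
        ; uq₁ = Uniqueₚ.map⁺ sv-inj (Uniqueₚ.filter⁺ good? uqi) ; uq₂ = Uniqueₚ.map⁺ sv-inj (Uniqueₚ.filter⁺ good? uqj)
        ; sub₁ = λ p → left (∈-map⁻ sv p) ; sub₂ = λ p → right (∈-map⁻ sv p)
        ; big₁ = big uqi bi ; big₂ = big uqj bj }
        where
        closed : ∀ {a b} → a ∈ X × InP a → InX b → adj G a b ≡ true → b ∉ Z → b ∈ P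
        closed (_ , a∈W , any) xb e b∉ = ∈-filter⁺ inP? (∈-X xb) (b∈W ,
            (let c , c∈ , c∈W , eq = find any in lose c∈ (c∈W , trans eq (κ-adj a∈W b∈W e))))
          where b∈W = ∈-W (∈-++⁺ˡ (∈-X xb)) b∉
        svW : ∀ {i} → Good i → sv i ∈ W
        svW {i} g = ∈-W (tooth⊆U i (sv∈ i)) (All.lookup g (sv∈ i))
        uW : ∀ {i} → Good i → u i ∈ W
        uW {i} g = ∈-W (u∈U i) (All.lookup g (u∈ i))
        left : ∀ {v} → (∃ λ i → i ∈ goodOnes is × v ≡ sv i) → v ∈ S × v ∈ P
        left (i , i∈ , refl) = sub (∈-lookup i) , ∈-filter⁺ inP? (∈-X (svX i)) (svW g ,
            lose (∈-map⁺ u (proj₁ (∈-filter⁻ good? {xs = is} i∈))) (uW g , sym (tooth-κ i g)))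
          where g = proj₂ (∈-filter⁻ good? {xs = is} i∈)
        right : ∀ {v} → (∃ λ i → i ∈ goodOnes js × v ≡ sv i) → v ∈ S × v ∉ P × v ∉ Z
        right (j , j∈ , refl) = sub (∈-lookup j) , (λ p → cross (proj₂ (proj₂ (∈-filter⁻ inP? {xs = X} p)))) , All.lookup g (sv∈ j)
          where
          g = proj₂ (∈-filter⁻ good? {xs = js} j∈)
          cross : Any (λ a → a ∈ W × κ a ≡ κ (sv j)) (ends is) → ⊥
          cross any = contradict (find any)
            where
            contradict : (∃ λ a → a ∈ ends is × a ∈ W × κ a ≡ κ (sv j)) → ⊥
            contradict (a , a∈ , a∈W , eq) = clash (hits a∈ (∈-map⁺ u (proj₁ (∈-filter⁻ good? {xs = js} j∈))) walk′)
              where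
              walk : Walk (edges W) a (u j)
              walk = comp-walk edges-sym (edges W) id (trans eq (tooth-κ j g))
              widen : edges W ⊆ edges U
              widen p = let x , y , e = ∈-edges⁻ p in ∈-edges (proj₁ (∈-W⁻ x)) (proj₁ (∈-W⁻ y)) e
              walk′ = weaken widen walk
              clash : (∃ λ v → v ∈ verts walk′ × v ∈ Z) → ⊥
              clash (v , v∈ , v∈Z) = proj₂ (∈-W⁻ (verts-⊆ walk a∈W (subst (v ∈_) (verts-weaken widen walk) v∈))) v∈Z
        big : ∀ {ks} → Unique ks → m + length Z ≤ length ks → m ≤ length (map sv (goodOnes ks))
        big {ks} uq le = subst (m ≤_) (sym (length-map sv (goodOnes ks))) (+-cancelˡ-≤ (length Z) _ _
          (≤-trans (≤-reflexive (+-comm (length Z) m)) (≤-trans le (many uq))))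

fromList : {A : Set} {R : A → A → Set} → (∀ {x y} → R x y → R y x) → ∀ {k} (xs : List A) → length xs ≡ k →
  AllPairs (λ x y → ¬ R x y) xs → Σ (Fin k → A) λ f → ∀ {i j} → R (f i) (f j) → i ≡ j
fromList s xs refl ap = lookup xs , allPairs-lookup s ap

module Linking (H G : Graph) (Δ : ℕ) (deg≤ : MaxDegree≤ G Δ) {r : V G} (B : BFS G r) (ℓ₀ w : ℕ)
               (n n₂ K : ℕ) (n-big : gridSize Δ (order H) * suc (nearBound Δ (3 + w) + nearBound Δ (3 + w)) ≤ n)
               (n₂-big : 2 ^ (n * n) * cleanCols Δ (order H) (3 + w) ≤ n₂)
               (K-big : familySize n n₂ (length (orderedPairs (order H))) ≤ K)
               (ys : List (V G)) (ys-X : ∀ {v} → v ∈ ys → Structure.InX H G Δ deg≤ B ℓ₀ w n n₂ K n-big n₂-big K-big v)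
               (ys-far : AllPairs (λ x y → ¬ (y ∈ Sets.ball G (Structure.ρ H G Δ deg≤ B ℓ₀ w n n₂ K n-big n₂-big K-big) x)) ys) where
  open Sets G
  open BFS B
  open CleanMenger G Δ deg≤
  open Structure H G Δ deg≤ B ℓ₀ w n n₂ K n-big n₂-big K-big
  open FarSet ys ys-X ys-far
  open SP.S using (Piece)

  separatorSize : ℕ
  separatorSize = K * suc Δ ^ suc (ballBound Δ 2)

  module WithHubs {d : ℕ} (1≤d : 1 ≤ d) (pc : V H → Piece d)
                  (pc-far : ∀ {x y} → Touch (Piece.body (pc x)) (Piece.body (pc y)) → x ≡ y) where

    src : V H → List (V G)
    src x = ends (Piece.ids (pc x))

    link : ∀ {S m} → ys ⊆ S → m + separatorSize ≤ d → ∀ x y → CleanLinkage U (src x) (src y) K ⊎ Splitting G InX S separatorSize m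
    link {S} {m} sub le x y = [ inj₁ , (λ (Z , lt , hits) → inj₂ (Separated.splitting (Piece.uniq (pc x)) (Piece.uniq (pc y)) Z hits sub
        (≤-trans (n≤1+n _) lt) (bound (pc x) {Z} lt) (bound (pc y) {Z} lt))) ]′ (cleanMenger ends⊆U (ends-indep {Piece.ids (pc x)}) K)
      where
      bound : ∀ (p : Piece d) {Z : List (V G)} → length Z < separatorSize → m + length Z ≤ length (Piece.ids p)
      bound p {Z} lt = ≤-trans (+-monoʳ-≤ m (≤-trans (n≤1+n _) lt)) (≤-trans le (≤-reflexive (sym (Piece.size p))))

    module Linked (link′ : ∀ x y → CleanLinkage U (src x) (src y) K) where

      Key = V H × V H

      vs : Key → Fin K → List (V G)
      vs (x , y) a = verts (CleanLinkage.path (link′ x y) a)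

      start∈ : ∀ k a → CleanLinkage.src (link′ (proj₁ k) (proj₂ k)) a ∈ U
      start∈ (x , y) a = ends⊆U (CleanLinkage.src∈ (link′ x y) a)

      vs⊆U : ∀ k a → vs k a ⊆ U
      vs⊆U k a = verts-⊆ (CleanLinkage.path (link′ (proj₁ k) (proj₂ k)) a) (start∈ k a)

      T : Key → Fin K → Key → Fin K → Set
      T k a k′ b = Touch (vs k a) (vs k′ b)

      open Transversal {A = Fin K} {Key} _≟_ T (λ k a k′ b → touch? (vs k a) (vs k′ b)) n n₂

      family : Key → Family G B ℓ₀ (3 + w) K
      family k = record
        { pt = vs k ; ne = λ a → _ , source∈ (CleanLinkage.path (link′ (proj₁ k) (proj₂ k)) a)
        ; conn = λ a → walk-conn (CleanLinkage.path (link′ (proj₁ k) (proj₂ k)) a)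
        ; clean = CleanLinkage.clean (link′ (proj₁ k) (proj₂ k)) ; bound = λ {a} p → U-bound (vs⊆U k a p) }

      dense : Biclique → InducedMinorModel H G
      dense b = Select.grid⇒model H G Δ deg≤ B ℓ₀ (3 + w) n n₂ n-big n₂-big
        (Family.select (family k) (proj₁ fr) (proj₁ (proj₂ fr))) (Family.select (family k′) (proj₁ fc) (proj₁ (proj₂ fc)))
        (λ a c → meet′ (proj₂ (proj₂ fr) a) (proj₂ (proj₂ fc) c))
        where
        open Biclique b renaming (meet to meet′)
        fr = enumerate _≟_ rows uqr len-r
        fc = enumerate _≟_ cols uqc len-c

      fs : List (Key × List (Fin K))
      fs = map (_, allFin K) (orderedPairs (order H))

      keys : map proj₁ fs ≡ orderedPairs (order H)
      keys = strip (orderedPairs (order H))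
        where
        strip : ∀ (ks : List Key) → map proj₁ (map (_, allFin K) ks) ≡ ks
        strip []       = refl
        strip (k ∷ ks) = cong (k ∷_) (strip ks)

      module SparseCase (gs : List (Key × Fin K)) (gs-keys : map proj₁ gs ≡ map proj₁ fs) (ap : AllPairs NonT gs) where

        choice : ∀ {x y : V H} → x <ᶠ y → ∃ λ a → ((x , y) , a) ∈ gs
        choice l = let (k , a) , p , e = ∈-map⁻ proj₁ (subst (_ ∈_) (sym (trans gs-keys keys)) (∈-orderedPairs l)) in
          a , subst (λ k → (k , a) ∈ gs) (sym e) p

        route : ∀ {x y} → x <ᶠ y → SP.Route (pc x) (pc y)
        route {x} {y} l = record
          { vs = vs (x , y) a ; vs-conn = walk-conn path ; high = U-high (vs⊆U (x , y) a)
          ; i = proj₁ si ; j = proj₁ sj ; i∈ = proj₁ (proj₂ si) ; j∈ = proj₁ (proj₂ sj)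
          ; zi∈ = subst (_∈ verts path) (proj₂ (proj₂ si)) (source∈ path)
          ; zj∈ = subst (_∈ verts path) (proj₂ (proj₂ sj)) (target∈ path) }
          where
          a = proj₁ (choice l)
          path = CleanLinkage.path (link′ x y) a
          si = ∈-map⁻ u (CleanLinkage.src∈ (link′ x y) a)
          sj = ∈-map⁻ u (CleanLinkage.dst∈ (link′ x y) a)

        route-far : ∀ {x y x′ y′} (l : x <ᶠ y) (l′ : x′ <ᶠ y′) →
          Touch (vs (x , y) (proj₁ (choice l))) (vs (x′ , y′) (proj₁ (choice l′))) → x ≡ x′ × y ≡ y′
        route-far {x} {y} {x′} {y′} l l′ t = decide (Prodₚ.≡-dec _≟_ _≟_ (x , y) (x′ , y′))
          where
          decide : Dec ((x , y) ≡ (x′ , y′)) → x ≡ x′ × y ≡ y′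
          decide (yes e) = cong proj₁ e , cong proj₂ e
          decide (no ne) = ⊥-elim (∈-allPairs {R = NonT} (λ f t → f (touch-sym t)) ap (proj₂ (choice l)) (proj₂ (choice l′)) (ne ∘ cong proj₁) t)

        model : InducedMinorModel H G
        model = SP.Model.sparse⇒model H 1≤d pc pc-far route route-far

      linked⇒model : InducedMinorModel H G
      linked⇒model = [ dense , (λ (gs , e , ap , _) → SparseCase.model gs e ap) ]′
        (transversal (length (orderedPairs (order H))) fs (length-map (_, allFin K) (orderedPairs (order H)))
          (All.tabulate λ p → sized (∈-map⁻ (_, allFin K) p)))
        where
        sized : ∀ {f : Key × List (Fin K)} → (∃ λ k → k ∈ orderedPairs (order H) × f ≡ (k , allFin K)) →
          Unique (proj₂ f) × familySize n n₂ (length (orderedPairs (order H))) ≤ length (proj₂ f)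
        sized (k , _ , refl) = Uniqueₚ.allFin⁺ K , ≤-trans K-big (≤-reflexive (sym (length-tabulate {n = K} id)))

    outcome : ∀ {S m} → ys ⊆ S → m + separatorSize ≤ d → Splitting G InX S separatorSize m ⊎ InducedMinorModel H G
    outcome {S} {m} sub le = [ (λ l → inj₂ (Linked.linked⇒model l)) , inj₁ ]′ (collect λ x → collect λ y → link {S} {m} sub le x y)

  structure : ∀ d₀ {S m} → ys ⊆ S → m + separatorSize ≤ suc (suc d₀) →
    order H * (suc (suc (suc d₀)) * (suc (suc d₀) + ballBound Δ 4 * suc (suc d₀))) + suc (suc d₀) ≤ length ys →
    Splitting G InX S separatorSize m ⊎ InducedMinorModel H G
  structure d₀ {S} {m} sub le enough = hubs (SP.S.pieces d₀ (order H) (allFin (length ys)) (Uniqueₚ.allFin⁺ _)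
      (≤-trans enough (≤-reflexive (sym (length-tabulate {n = length ys} id)))))
    where
    hubs : (∃ λ ps → length ps ≡ order H × AllPairs SP.S.NonTouching ps × All (SP.S.Inside (allFin (length ys)) {suc (suc d₀)}) ps) →
      Splitting G InX S separatorSize m ⊎ InducedMinorModel H G
    hubs (ps , len , ap , _) = WithHubs.outcome (s≤s z≤n) (proj₁ f) (proj₂ f) {S} {m} sub le
      where f = fromList {R = λ p q → Touch (Piece.body p) (Piece.body q)} touch-sym ps len ap

-- Two-colourings from separators

-- `Splitting` for an arbitrary relation `E`, which will be "at distance at most `D`".
record Split {A : Set} (X : A → Set) (E : A → A → Set) (S : List A) (k m : ℕ) : Set where
  field
    Z P    : List A
    Z-≤    : length Z ≤ k
    closed : ∀ {u v} → u ∈ P → X v → E u v → v ∉ Z → v ∈ P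
    avoid  : ∀ {v} → v ∈ P → v ∉ Z
    S₁ S₂  : List A
    uq₁    : Unique S₁
    uq₂    : Unique S₂
    sub₁   : ∀ {v} → v ∈ S₁ → v ∈ S × v ∈ P
    sub₂   : ∀ {v} → v ∈ S₂ → v ∈ S × v ∉ P × v ∉ Z
    big₁   : m ≤ length S₁
    big₂   : m ≤ length S₂

filter-shorter : {A : Set} {P : A → Set} (P? : Decidable P) {xs : List A} {x : A} → x ∈ xs → ¬ P x →
  length (filter P? xs) < length xs
filter-shorter P? {xs} x∈ ¬p = subst (length (filter P? xs) <_) (sym (filter-split P? xs))
  (≤-trans (≤-reflexive (+-comm 1 _)) (+-monoʳ-≤ (length (filter P? xs)) (∈-length (∈-filter⁺ (¬? ∘ P?) x∈ ¬p))))

≢-not : ∀ {b} → b ≢ not b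
≢-not {true}  ()
≢-not {false} ()

module TwoColouring {A : Set} (_≟ᴬ_ : DecidableEquality A) (X : A → Set) (E : A → A → Set) (E-sym : ∀ {u v} → E u v → E v u)
                    (nbE : A → List A) (b : ℕ) (nb-≤ : ∀ u → length (nbE u) ≤ b) (∈-nbE : ∀ {u v} → E u v → v ∈ nbE u)
                    (k s : ℕ)
                    (split : ∀ S → Unique S → (∀ {v} → v ∈ S → X v) → s ≤ length S → Split X E S k (suc (4 * k))) where
  open DecMem _≟ᴬ_ using (_∈?_)

  -- A set `S` of at least `s₀` vertices satisfies `R-≤` with `R` equal to `S`. Peeling prescribes
  -- at most `s * b + s₀` vertices, and a root cluster grows to at most twice the prescribed set;
  -- hence `W`.
  s₀ W : ℕ
  s₀ = suc (4 * k)
  W = 2 * (s * b + s₀)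

  -- Induction hypothesis of the recursion: `R` is the root cluster, still open, around the
  -- prescribed set `S`; outside it the clusters are finished and named by `rep`. The slack `4 * k`
  -- in `R-≤` is what permits gluing.
  record Colouring (U S : List A) (c : Bool) : Set where
    field
      col   : A → Bool
      rep   : A → A
      R     : List A
      S⊆R   : S ⊆ R
      R⊆U   : R ⊆ U
      R-≤   : length R + 4 * k ≤ 2 * length S
      red   : ∀ {v} → v ∈ R → col v ≡ c
      rim   : ∀ {u v} → u ∈ R → v ∈ U → v ∉ R → E u v → col v ≡ not c
      same  : ∀ {u v} → u ∈ U → v ∈ U → u ∉ R → v ∉ R → E u v → col u ≡ col v → rep u ≡ rep v
      rep∈  : ∀ {u} → u ∈ U → u ∉ R → rep u ∈ U × rep u ∉ R
      small : ∀ x → ∃ λ ms → length ms ≤ W × (∀ {u} → u ∈ U → u ∉ R → rep u ≡ x → u ∈ ms)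

  record Clustering (U : List A) : Set where
    field
      col   : A → Bool
      rep   : A → A
      same  : ∀ {u v} → u ∈ U → v ∈ U → E u v → col u ≡ col v → rep u ≡ rep v
      rep∈  : ∀ {u} → u ∈ U → rep u ∈ U
      small : ∀ x → ∃ λ ms → length ms ≤ W × (∀ {u} → u ∈ U → rep u ≡ x → u ∈ ms)

  -- The rim of `R` has the other colour, so `R` can be closed into one cluster, named by a vertex
  -- of `S`.
  seal : ∀ {U S c x} → x ∈ S → length S ≤ s * b + s₀ → (C : Colouring U S c) →
    Σ (Clustering U) λ D → ∀ v → Clustering.col D v ≡ Colouring.col C v
  seal {U} {S} {c} {x} x∈ S≤ C = record { col = col ; rep = rep* ; same = same* ; rep∈ = rep∈* ; small = small* } , λ _ → refl
    where
    open Colouring C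
    pickRep : ∀ {v} → Dec (v ∈ R) → A
    pickRep     (yes _) = x
    pickRep {v} (no _)  = rep v
    rep* : A → A
    rep* v = pickRep (v ∈? R)
    mixed : ∀ {u v} → u ∈ R → v ∈ U → v ∉ R → E u v → col u ≡ col v → ⊥
    mixed u∈ v∈ v∉ e q = ≢-not (trans (sym (red u∈)) (trans q (rim u∈ v∈ v∉ e)))
    same-at : ∀ {u v} (p : Dec (u ∈ R)) (q : Dec (v ∈ R)) → u ∈ U → v ∈ U → E u v → col u ≡ col v → pickRep p ≡ pickRep q
    same-at (yes _) (yes _) _ _ _ _ = refl
    same-at (no p)  (no q)  u∈ v∈ e c = same u∈ v∈ p q e c
    same-at (yes p) (no q)  u∈ v∈ e c = ⊥-elim (mixed p v∈ q e c)
    same-at (no p)  (yes q) u∈ v∈ e c = ⊥-elim (mixed q u∈ p (E-sym e) (sym c))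
    same* : ∀ {u v} → u ∈ U → v ∈ U → E u v → col u ≡ col v → rep* u ≡ rep* v
    same* {u} {v} = same-at (u ∈? R) (v ∈? R)
    rep∈-at : ∀ {u} (p : Dec (u ∈ R)) → u ∈ U → pickRep p ∈ U
    rep∈-at (yes _) _ = R⊆U (S⊆R x∈)
    rep∈-at (no p) u∈ = proj₁ (rep∈ u∈ p)
    rep∈* : ∀ {u} → u ∈ U → rep* u ∈ U
    rep∈* {u} = rep∈-at (u ∈? R)
    small* : ∀ y → ∃ λ ms → length ms ≤ W × (∀ {u} → u ∈ U → rep* u ≡ y → u ∈ ms)
    small* y with y ∈? R
    ... | yes y∈ = R , ≤-trans (m≤m+n _ (4 * k)) (≤-trans R-≤ (*-monoʳ-≤ 2 S≤)) , λ {u} → in-R (u ∈? R)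
      where
      in-R : ∀ {u} (p : Dec (u ∈ R)) → u ∈ U → pickRep p ≡ y → u ∈ R
      in-R (yes p) _ _ = p
      in-R (no p) u∈ e = ⊥-elim (proj₂ (rep∈ u∈ p) (subst (_∈ R) (sym e) y∈))
    ... | no y∉ = let ms , len , f = small y in ms , len , λ {u} → out-R f (u ∈? R)
      where
      out-R : ∀ {u ms} → (∀ {u} → u ∈ U → u ∉ R → rep u ≡ y → u ∈ ms) → (p : Dec (u ∈ R)) → u ∈ U → pickRep p ≡ y → u ∈ ms
      out-R f (yes _) _ e = ⊥-elim (y∉ (subst (_∈ R) e (S⊆R x∈)))
      out-R f (no p) u∈ e = f u∈ p e

  s₀≤W : s₀ ≤ W
  s₀≤W = ≤-trans (m≤n+m s₀ (s * b)) (m≤m+n _ _)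

  -- A small `S` becomes the root cluster itself. Its neighbours, padded to at least `s₀` vertices
  -- so that the recursion applies, form the set prescribed to have the other colour in the rest.
  module Peel {U S : List A} (c : Bool) (uqS : Unique S) (S⊆U : S ⊆ U) (s₀≤ : s₀ ≤ length S) (S≤ : length S ≤ s) where
    U′ : List A
    U′ = filter (λ v → ¬? (v ∈? S)) U

    ∈-U′ : ∀ {v} → v ∈ U → v ∉ S → v ∈ U′
    ∈-U′ = ∈-filter⁺ (λ v → ¬? (v ∈? S))

    ∈-U′⁻ : ∀ {v} → v ∈ U′ → v ∈ U × v ∉ S
    ∈-U′⁻ = ∈-filter⁻ (λ v → ¬? (v ∈? S)) {xs = U}

    nbs : List A
    nbs = filter (_∈? U′) (concatMap nbE S)

    nbs-≤ : length nbs ≤ s * b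
    nbs-≤ = ≤-trans (length-filter (_∈? U′) (concatMap nbE S)) (≤-trans (length-concatMap-≤ nbE b S (λ _ → nb-≤ _)) (*-monoˡ-≤ b S≤))

    shorter : length U′ < length U
    shorter = let x , x∈ = nonempty S (≤-trans (s≤s z≤n) s₀≤) in filter-shorter (λ v → ¬? (v ∈? S)) (S⊆U x∈) (λ f → f x∈)

    build : (D : Clustering U′) → (∀ {v} → v ∈ nbs → Clustering.col D v ≡ not c) → Colouring U S c
    build D D-nbs = record
      { col = col ; rep = rep ; R = S ; S⊆R = id ; R⊆U = S⊆U ; R-≤ = R-≤
      ; red = λ {v} v∈ → red (v ∈? S) v∈
      ; rim = λ {u} {v} u∈ v∈ v∉ e → rim (v ∈? S) u∈ v∈ v∉ e
      ; same = λ {u} {v} u∈ v∈ u∉ v∉ e q → D.same (∈-U′ u∈ u∉) (∈-U′ v∈ v∉) e (trans (sym (out (u ∈? S) u∉)) (trans q (out (v ∈? S) v∉)))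
      ; rep∈ = λ u∈ u∉ → ∈-U′⁻ (D.rep∈ (∈-U′ u∈ u∉))
      ; small = λ x → let ms , len , f = D.small x in ms , len , λ u∈ u∉ → f (∈-U′ u∈ u∉) }
      where
      module D = Clustering D
      rep = D.rep
      pickCol : ∀ {v} → Dec (v ∈ S) → Bool
      pickCol     (yes _) = c
      pickCol {v} (no _)  = D.col v
      col : A → Bool
      col v = pickCol (v ∈? S)
      out : ∀ {v} (p : Dec (v ∈ S)) → v ∉ S → pickCol p ≡ D.col v
      out (yes p) v∉ = ⊥-elim (v∉ p)
      out (no _)  v∉ = refl
      red : ∀ {v} (p : Dec (v ∈ S)) → v ∈ S → pickCol p ≡ c
      red (yes _) _ = refl
      red (no ¬p) p = ⊥-elim (¬p p)
      rim : ∀ {u v} (p : Dec (v ∈ S)) → u ∈ S → v ∈ U → v ∉ S → E u v → pickCol p ≡ not c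
      rim p u∈ v∈ v∉ e = trans (out p v∉) (D-nbs (∈-filter⁺ (_∈? U′) (∈-concatMap nbE u∈ (∈-nbE e)) (∈-U′ v∈ v∉)))
      R-≤ : length S + 4 * k ≤ 2 * length S
      R-≤ = ≤-trans (+-monoʳ-≤ (length S) (≤-trans (n≤1+n _) s₀≤)) (≤-reflexive (cong (length S +_) (sym (+-identityʳ _))))

    S″ : List A
    S″ = deduplicate _≟ᴬ_ (nbs ++ take s₀ (deduplicate _≟ᴬ_ U′))

    module Deep (big : s₀ ≤ length (deduplicate _≟ᴬ_ U′)) where
      S″⊆ : S″ ⊆ U′
      S″⊆ p with ∈-++⁻ nbs (∈-deduplicate⁻ _≟ᴬ_ (nbs ++ take s₀ (deduplicate _≟ᴬ_ U′)) p)
      ... | inj₁ q = proj₂ (∈-filter⁻ (_∈? U′) {xs = concatMap nbE S} q)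
      ... | inj₂ q = ∈-deduplicate⁻ _≟ᴬ_ U′ (take-⊆ s₀ q)

      S″-≥ : s₀ ≤ length S″
      S″-≥ = ≤-trans (≤-reflexive (sym (length-take-≤ s₀ {deduplicate _≟ᴬ_ U′} big))) (uniq-length (Uniqueₚ.take⁺ s₀ (deduplicate-! _≟ᴬ_ U′))
        (λ p → ∈-deduplicate⁺ _≟ᴬ_ (∈-++⁺ʳ nbs p)))

      S″-≤ : length S″ ≤ s * b + s₀
      S″-≤ = ≤-trans (length-deduplicate _≟ᴬ_ (nbs ++ take s₀ (deduplicate _≟ᴬ_ U′)))
        (≤-trans (≤-reflexive (length-++ nbs)) (+-mono-≤ nbs-≤ (≤-reflexive (length-take-≤ s₀ {deduplicate _≟ᴬ_ U′} big))))

      grow : Colouring U′ S″ (not c) → Colouring U S c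
      grow C = build (proj₁ D) λ v∈ → trans (proj₂ D _) (Colouring.red C (Colouring.S⊆R C (∈-deduplicate⁺ _≟ᴬ_ (∈-++⁺ˡ v∈))))
        where
        x = nonempty S″ (≤-trans (s≤s z≤n) S″-≥)
        D = seal (proj₂ x) S″-≤ C

    -- Too few vertices are left for padding; together they form one cluster of the other colour.
    leaf : length (deduplicate _≟ᴬ_ U′) ≤ s₀ → Colouring U S c
    leaf le = build (flat (deduplicate _≟ᴬ_ U′) refl) λ _ → flat-col (deduplicate _≟ᴬ_ U′) refl
      where
      flat : ∀ xs → deduplicate _≟ᴬ_ U′ ≡ xs → Clustering U′
      flat [] e = record { col = λ _ → not c ; rep = id ; same = λ p → none p ; rep∈ = id ; small = λ _ → [] , z≤n , λ p → none p }
        where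
        none : ∀ {v} {Q : Set} → v ∈ U′ → Q
        none {v} p with subst (v ∈_) e (∈-deduplicate⁺ _≟ᴬ_ p)
        ... | ()
      flat (x ∷ xs) e = record { col = λ _ → not c ; rep = λ _ → x ; same = λ _ _ _ _ → refl ; rep∈ = λ _ → x∈
                               ; small = λ _ → deduplicate _≟ᴬ_ U′ , ≤-trans le s₀≤W , λ p _ → ∈-deduplicate⁺ _≟ᴬ_ p }
        where
        x∈ : x ∈ U′
        x∈ = ∈-deduplicate⁻ _≟ᴬ_ U′ (subst (x ∈_) (sym e) (here refl))
      flat-col : ∀ xs (e : deduplicate _≟ᴬ_ U′ ≡ xs) {v} → Clustering.col (flat xs e) v ≡ not c
      flat-col [] e = refl
      flat-col (x ∷ xs) e = refl

  -- Both sides get the separator as part of their prescribed sets, so it joins the root cluster of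
  -- each and both colour it `c`. Outside `R` there are no edges between the two sides.
  module Glue {U S : List A} (c : Bool) (U-X : ∀ {v} → v ∈ U → X v) (uqS : Unique S) (S⊆U : S ⊆ U) (sp : Split X E S k s₀) where
    open Split sp

    U₁ U₂ ZU : List A
    U₁ = filter (λ v → (v ∈? P) ⊎-dec (v ∈? Z)) U
    U₂ = filter (λ v → ¬? (v ∈? P)) U
    ZU = filter (_∈? U) Z

    S¹ S² : List A
    S¹ = deduplicate _≟ᴬ_ (filter (_∈? P) S ++ ZU)
    S² = deduplicate _≟ᴬ_ (filter (λ v → ¬? (v ∈? P)) S ++ ZU)

    ∈-U₁ : ∀ {v} → v ∈ U → v ∈ P ⊎ v ∈ Z → v ∈ U₁
    ∈-U₁ = ∈-filter⁺ (λ v → (v ∈? P) ⊎-dec (v ∈? Z))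
    ∈-U₁⁻ : ∀ {v} → v ∈ U₁ → v ∈ U × (v ∈ P ⊎ v ∈ Z)
    ∈-U₁⁻ = ∈-filter⁻ (λ v → (v ∈? P) ⊎-dec (v ∈? Z)) {xs = U}
    ∈-U₂ : ∀ {v} → v ∈ U → v ∉ P → v ∈ U₂
    ∈-U₂ = ∈-filter⁺ (λ v → ¬? (v ∈? P))
    ∈-U₂⁻ : ∀ {v} → v ∈ U₂ → v ∈ U × v ∉ P
    ∈-U₂⁻ = ∈-filter⁻ (λ v → ¬? (v ∈? P)) {xs = U}
    ∈-ZU : ∀ {v} → v ∈ Z → v ∈ U → v ∈ ZU
    ∈-ZU = ∈-filter⁺ (_∈? U)
    ∈-ZU⁻ : ∀ {v} → v ∈ ZU → v ∈ Z × v ∈ U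
    ∈-ZU⁻ = ∈-filter⁻ (_∈? U) {xs = Z}

    Z⊆S¹ : ∀ {v} → v ∈ Z → v ∈ U → v ∈ S¹
    Z⊆S¹ p q = ∈-deduplicate⁺ _≟ᴬ_ (∈-++⁺ʳ (filter (_∈? P) S) (∈-ZU p q))
    Z⊆S² : ∀ {v} → v ∈ Z → v ∈ U → v ∈ S²
    Z⊆S² p q = ∈-deduplicate⁺ _≟ᴬ_ (∈-++⁺ʳ (filter (λ v → ¬? (v ∈? P)) S) (∈-ZU p q))

    S⊆ : ∀ {v} → v ∈ S → v ∈ S¹ ⊎ v ∈ S²
    S⊆ {v} p with v ∈? P
    ... | yes q = inj₁ (∈-deduplicate⁺ _≟ᴬ_ (∈-++⁺ˡ (∈-filter⁺ (_∈? P) p q)))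
    ... | no q  = inj₂ (∈-deduplicate⁺ _≟ᴬ_ (∈-++⁺ˡ (∈-filter⁺ (λ v → ¬? (v ∈? P)) p q)))

    S¹⊆U₁ : S¹ ⊆ U₁
    S¹⊆U₁ p with ∈-++⁻ (filter (_∈? P) S) (∈-deduplicate⁻ _≟ᴬ_ (filter (_∈? P) S ++ ZU) p)
    ... | inj₁ q = let a , b = ∈-filter⁻ (_∈? P) {xs = S} q in ∈-U₁ (S⊆U a) (inj₁ b)
    ... | inj₂ q = let a , b = ∈-ZU⁻ q in ∈-U₁ b (inj₂ a)

    S²⊆U₂ : S² ⊆ U₂
    S²⊆U₂ p with ∈-++⁻ (filter (λ v → ¬? (v ∈? P)) S) (∈-deduplicate⁻ _≟ᴬ_ (filter (λ v → ¬? (v ∈? P)) S ++ ZU) p)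
    ... | inj₁ q = let a , b = ∈-filter⁻ (λ v → ¬? (v ∈? P)) {xs = S} q in ∈-U₂ (S⊆U a) b
    ... | inj₂ q = let a , b = ∈-ZU⁻ q in ∈-U₂ b (λ r → avoid r a)

    S¹-≥ : s₀ ≤ length S¹
    S¹-≥ = ≤-trans big₁ (uniq-length uq₁ λ p → let a , b = sub₁ p in ∈-deduplicate⁺ _≟ᴬ_ (∈-++⁺ˡ (∈-filter⁺ (_∈? P) a b)))
    S²-≥ : s₀ ≤ length S²
    S²-≥ = ≤-trans big₂ (uniq-length uq₂ λ p → let a , b , _ = sub₂ p in ∈-deduplicate⁺ _≟ᴬ_ (∈-++⁺ˡ (∈-filter⁺ (λ v → ¬? (v ∈? P)) a b)))

    sizes : length S¹ + length S² ≤ length S + (k + k)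
    sizes = ≤-trans (+-mono-≤ (part (filter (_∈? P) S)) (part (filter (λ v → ¬? (v ∈? P)) S)))
      (≤-trans (≤-reflexive (shuffle (length (filter (_∈? P) S)) k (length (filter (λ v → ¬? (v ∈? P)) S))))
        (+-monoˡ-≤ (k + k) (≤-reflexive (sym (filter-split (_∈? P) S)))))
      where
      part : ∀ xs → length (deduplicate _≟ᴬ_ (xs ++ ZU)) ≤ length xs + k
      part xs = ≤-trans (length-deduplicate _≟ᴬ_ (xs ++ ZU)) (≤-trans (≤-reflexive (length-++ xs))
        (+-monoʳ-≤ (length xs) (≤-trans (length-filter (_∈? U) Z) Z-≤)))
      shuffle : ∀ a b c → (a + b) + (c + b) ≡ (a + c) + (b + b)
      shuffle = solve-∀

    shorter₁ : length U₁ < length U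
    shorter₁ = let y , y∈ = nonempty S₂ (≤-trans (s≤s z≤n) big₂) ; a , b , c = sub₂ y∈ in
      filter-shorter (λ v → (v ∈? P) ⊎-dec (v ∈? Z)) (S⊆U a) λ { (inj₁ p) → b p ; (inj₂ p) → c p }

    shorter₂ : length U₂ < length U
    shorter₂ = let y , y∈ = nonempty S₁ (≤-trans (s≤s z≤n) big₁) ; a , b = sub₁ y∈ in
      filter-shorter (λ v → ¬? (v ∈? P)) (S⊆U a) (λ f → f b)

    glue : Colouring U₁ S¹ c → Colouring U₂ S² c → Colouring U S c
    glue C₁ C₂ = record
      { col = col ; rep = rep ; R = C₁.R ++ C₂.R
      ; S⊆R = λ p → [ (λ q → ∈-++⁺ˡ (C₁.S⊆R q)) , (λ q → ∈-++⁺ʳ C₁.R (C₂.S⊆R q)) ]′ (S⊆ p)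
      ; R⊆U = λ p → R⊆U p
      ; R-≤ = R-≤
      ; red = λ {v} p → red-at (v ∈? P) p
      ; rim = λ {u} {v} p q r e → rim-at (v ∈? P) p q r e
      ; same = λ {u} {v} p q p′ q′ e → same-at (u ∈? P) (v ∈? P) p q p′ q′ e
      ; rep∈ = λ {u} p q → rep∈-at (u ∈? P) p q
      ; small = small }
      where
      module C₁ = Colouring C₁
      module C₂ = Colouring C₂
      R = C₁.R ++ C₂.R
      pickCol : ∀ {v} → Dec (v ∈ P) → Bool
      pickCol {v} (yes _) = C₁.col v
      pickCol {v} (no _)  = C₂.col v
      pickRep : ∀ {v} → Dec (v ∈ P) → A
      pickRep {v} (yes _) = C₁.rep v
      pickRep {v} (no _)  = C₂.rep v
      col : A → Bool
      col v = pickCol (v ∈? P)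
      rep : A → A
      rep v = pickRep (v ∈? P)
      R⊆U : R ⊆ U
      R⊆U p = [ (λ q → proj₁ (∈-U₁⁻ (C₁.R⊆U q))) , (λ q → proj₁ (∈-U₂⁻ (C₂.R⊆U q))) ]′ (∈-++⁻ C₁.R p)
      inR₁ : ∀ {v} → v ∈ R → v ∈ P → v ∈ C₁.R
      inR₁ p v∈P = [ id , (λ q → ⊥-elim (proj₂ (∈-U₂⁻ (C₂.R⊆U q)) v∈P)) ]′ (∈-++⁻ C₁.R p)
      inR₂ : ∀ {v} → v ∈ R → v ∉ P → v ∈ C₂.R
      inR₂ p v∉P = [ (λ q → let a , b = ∈-U₁⁻ (C₁.R⊆U q) in [ (λ r → ⊥-elim (v∉P r)) , (λ r → C₂.S⊆R (Z⊆S² r a)) ]′ b) , id ]′ (∈-++⁻ C₁.R p)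
      noZ : ∀ {v} → v ∈ U → v ∉ R → v ∉ Z
      noZ v∈ v∉ z = v∉ (∈-++⁺ˡ (C₁.S⊆R (Z⊆S¹ z v∈)))
      out₁ : ∀ {v} → v ∉ R → v ∉ C₁.R
      out₁ v∉ p = v∉ (∈-++⁺ˡ p)
      out₂ : ∀ {v} → v ∉ R → v ∉ C₂.R
      out₂ v∉ p = v∉ (∈-++⁺ʳ C₁.R p)
      -- Counting `Z` on both sides adds at most `2 * k` to the prescribed sets, doubled to `4 * k`.
      -- The hypotheses provide this slack twice: one pays, the other remains.
      R-≤ : length R + 4 * k ≤ 2 * length S
      R-≤ = subst (λ m → m + 4 * k ≤ 2 * length S) (sym (length-++ C₁.R)) (+-cancelʳ-≤ (4 * k) _ _
        (≤-trans (≤-reflexive (shuffle (length C₁.R) (length C₂.R) (4 * k)))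
          (≤-trans (+-mono-≤ C₁.R-≤ C₂.R-≤) (≤-trans (≤-reflexive (sym (*-distribˡ-+ 2 (length S¹) (length S²))))
            (≤-trans (*-monoʳ-≤ 2 sizes) (≤-reflexive (expand (length S) k)))))))
        where
        shuffle : ∀ a b c → ((a + b) + c) + c ≡ (a + c) + (b + c)
        shuffle = solve-∀
        expand : ∀ a k → 2 * (a + (k + k)) ≡ 2 * a + 4 * k
        expand = solve-∀
      red-at : ∀ {v} (d : Dec (v ∈ P)) → v ∈ R → pickCol d ≡ c
      red-at (yes p) v∈ = C₁.red (inR₁ v∈ p)
      red-at (no p)  v∈ = C₂.red (inR₂ v∈ p)
      rim-at : ∀ {u v} (d : Dec (v ∈ P)) → u ∈ R → v ∈ U → v ∉ R → E u v → pickCol d ≡ not c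
      rim-at {u} {v} (yes v∈P) u∈ v∈ v∉ e = C₁.rim u∈R₁ (∈-U₁ v∈ (inj₁ v∈P)) (out₁ v∉) e
        where
        u∈R₁ : u ∈ C₁.R
        u∈R₁ with u ∈? Z
        ... | yes z = C₁.S⊆R (Z⊆S¹ z (R⊆U u∈))
        ... | no ¬z = inR₁ u∈ (closed v∈P (U-X (R⊆U u∈)) (E-sym e) ¬z)
      rim-at {u} {v} (no v∉P) u∈ v∈ v∉ e =
        C₂.rim (inR₂ u∈ λ u∈P → v∉P (closed u∈P (U-X v∈) e (noZ v∈ v∉))) (∈-U₂ v∈ v∉P) (out₂ v∉) e
      same-at : ∀ {u v} (d : Dec (u ∈ P)) (d′ : Dec (v ∈ P)) → u ∈ U → v ∈ U → u ∉ R → v ∉ R → E u v → pickCol d ≡ pickCol d′ → pickRep d ≡ pickRep d′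
      same-at (yes p) (yes q) u∈ v∈ u∉ v∉ e = C₁.same (∈-U₁ u∈ (inj₁ p)) (∈-U₁ v∈ (inj₁ q)) (out₁ u∉) (out₁ v∉) e
      same-at (no p)  (no q)  u∈ v∈ u∉ v∉ e = C₂.same (∈-U₂ u∈ p) (∈-U₂ v∈ q) (out₂ u∉) (out₂ v∉) e
      same-at (yes p) (no q)  u∈ v∈ u∉ v∉ e _ = ⊥-elim (q (closed p (U-X v∈) e (noZ v∈ v∉)))
      same-at (no p)  (yes q) u∈ v∈ u∉ v∉ e _ = ⊥-elim (p (closed q (U-X u∈) (E-sym e) (noZ u∈ u∉)))
      rep₁ : ∀ {u} → u ∈ P → u ∈ U → u ∉ R → C₁.rep u ∈ U × C₁.rep u ∉ R × C₁.rep u ∈ P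
      rep₁ p u∈ u∉ with C₁.rep∈ (∈-U₁ u∈ (inj₁ p)) (out₁ u∉)
      ... | a , b with ∈-U₁⁻ a
      ... | a′ , inj₁ q = a′ , (λ r → b (inR₁ r q)) , q
      ... | a′ , inj₂ z = ⊥-elim (b (C₁.S⊆R (Z⊆S¹ z a′)))
      rep₂ : ∀ {u} → u ∉ P → u ∈ U → u ∉ R → C₂.rep u ∈ U × C₂.rep u ∉ R × C₂.rep u ∉ P
      rep₂ p u∈ u∉ with C₂.rep∈ (∈-U₂ u∈ p) (out₂ u∉)
      ... | a , b with ∈-U₂⁻ a
      ... | a′ , q = a′ , (λ r → b (inR₂ r q)) , q
      rep∈-at : ∀ {u} (d : Dec (u ∈ P)) → u ∈ U → u ∉ R → pickRep d ∈ U × pickRep d ∉ R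
      rep∈-at (yes p) u∈ u∉ = let a , b , _ = rep₁ p u∈ u∉ in a , b
      rep∈-at (no p)  u∈ u∉ = let a , b , _ = rep₂ p u∈ u∉ in a , b
      small : ∀ x → ∃ λ ms → length ms ≤ W × (∀ {u} → u ∈ U → u ∉ R → rep u ≡ x → u ∈ ms)
      small x with x ∈? P
      ... | yes x∈ = let ms , len , f = C₁.small x in ms , len , λ {u} → at f (u ∈? P)
        where
        at : ∀ {u ms} → (∀ {u} → u ∈ U₁ → u ∉ C₁.R → C₁.rep u ≡ x → u ∈ ms) → (d : Dec (u ∈ P)) → u ∈ U → u ∉ R → pickRep d ≡ x → u ∈ ms
        at f (yes p) u∈ u∉ e = f (∈-U₁ u∈ (inj₁ p)) (out₁ u∉) e
        at f (no p)  u∈ u∉ e = ⊥-elim (proj₂ (proj₂ (rep₂ p u∈ u∉)) (subst (_∈ P) (sym e) x∈))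
      ... | no x∉ = let ms , len , f = C₂.small x in ms , len , λ {u} → at f (u ∈? P)
        where
        at : ∀ {u ms} → (∀ {u} → u ∈ U₂ → u ∉ C₂.R → C₂.rep u ≡ x → u ∈ ms) → (d : Dec (u ∈ P)) → u ∈ U → u ∉ R → pickRep d ≡ x → u ∈ ms
        at f (no p)  u∈ u∉ e = f (∈-U₂ u∈ p) (out₂ u∉) e
        at f (yes p) u∈ u∉ e = ⊥-elim (x∉ (subst (_∈ P) e (proj₂ (proj₂ (rep₁ p u∈ u∉)))))

  colour : ∀ fuel U S c → length U ≤ fuel → (∀ {v} → v ∈ U → X v) → Unique S → S ⊆ U → s₀ ≤ length S → Colouring U S c
  colour zero U S c le U-X uqS S⊆U s₀≤ with nonempty S (≤-trans (s≤s z≤n) s₀≤)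
  ... | x , x∈ = ⊥-elim (<⇒≱ (∈-length (S⊆U x∈)) le)
  colour (suc fuel) U S c le U-X uqS S⊆U s₀≤ with length S ≤? s
  ... | no S≰ = Gl.glue
        (colour fuel Gl.U₁ Gl.S¹ c (≤-pred (≤-trans Gl.shorter₁ le)) (λ p → U-X (proj₁ (Gl.∈-U₁⁻ p))) (deduplicate-! _≟ᴬ_ _) Gl.S¹⊆U₁ Gl.S¹-≥)
        (colour fuel Gl.U₂ Gl.S² c (≤-pred (≤-trans Gl.shorter₂ le)) (λ p → U-X (proj₁ (Gl.∈-U₂⁻ p))) (deduplicate-! _≟ᴬ_ _) Gl.S²⊆U₂ Gl.S²-≥)
    where
    module Gl = Glue {U} c U-X uqS S⊆U (split S uqS (λ p → U-X (S⊆U p)) (≰⇒≥ S≰))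
  ... | yes S≤ with s₀ ≤? length (deduplicate _≟ᴬ_ (filter (λ v → ¬? (v ∈? S)) U))
  ... | no ¬big = Peel.leaf c uqS S⊆U s₀≤ S≤ (≰⇒≥ ¬big)
  ... | yes big = De.grow
        (colour fuel Pe.U′ Pe.S″ (not c) (≤-pred (≤-trans Pe.shorter le)) (λ p → U-X (proj₁ (Pe.∈-U′⁻ p))) (deduplicate-! _≟ᴬ_ _) De.S″⊆ De.S″-≥)
    where
    module Pe = Peel c uqS S⊆U s₀≤ S≤
    module De = Pe.Deep big

  twoColour : ∀ U → Unique U → (∀ {v} → v ∈ U → X v) → Clustering U
  twoColour U uq U-X with s₀ ≤? length U
  ... | yes le = proj₁ (seal {x = proj₁ x} (proj₂ x) (≤-trans (≤-reflexive (length-take-≤ s₀ {U} le)) (m≤n+m s₀ (s * b)))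
          (colour (length U) U (take s₀ U) true ≤-refl U-X (Uniqueₚ.take⁺ s₀ uq) (take-⊆ s₀) (≤-reflexive (sym (length-take-≤ s₀ {U} le)))))
    where x = nonempty (take s₀ U) (≤-trans (s≤s z≤n) (≤-reflexive (sym (length-take-≤ s₀ {U} le))))
  ... | no ¬le = flat U refl
    where
    flat : ∀ xs → U ≡ xs → Clustering U
    flat [] refl = record { col = λ _ → true ; rep = id ; same = λ () ; rep∈ = id ; small = λ _ → [] , z≤n , λ () }
    flat (x ∷ xs) refl = record { col = λ _ → true ; rep = λ _ → x ; same = λ _ _ _ _ → refl ; rep∈ = λ _ → here refl
                                ; small = λ _ → x ∷ xs , ≤-trans (≰⇒≥ ¬le) s₀≤W , λ p _ → p }

-- Windows of layers and their powers

module Window {G : Graph} {r : V G} (B : BFS G r) where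
  open Sets G
  open BFS B

  Win : ℕ → ℕ → V G → Set
  Win i w v = In v × i ≤ lay v × lay v ≤ w + i

  win? : ∀ i w v → Dec (Win i w v)
  win? i w v = In? v ×-dec ((i ≤? lay v) ×-dec (lay v ≤? w + i))

  lay-ball : ∀ t {u v} → In u → v ∈ ball t u → In v × lay v ≤ t + lay u
  lay-ball zero    i v∈ rewrite ball-0⁻ v∈ = i , ≤-refl
  lay-ball (suc t) {u} {v} i v∈ = next (ball-step⁻ t v∈)
    where
    next : (∃ λ x → x ∈ ball t u × x ~ v) → In v × lay v ≤ suc t + lay u
    next (x , x∈ , e) = let ix , l = lay-ball t i x∈ in in-adj ix e , ≤-trans (lay-adj ix e) (s≤s l)

rowsFor colsFor linksFor : Graph → ℕ → ℕ → ℕ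
rowsFor H Δ w = gridSize Δ (order H) * suc (nearBound Δ (3 + w) + nearBound Δ (3 + w))
colsFor H Δ w = 2 ^ (rowsFor H Δ w * rowsFor H Δ w) * cleanCols Δ (order H) (3 + w)
linksFor H Δ w = familySize (rowsFor H Δ w) (colsFor H Δ w) (length (orderedPairs (order H)))

hubsFor : Graph → ℕ → ℕ → ℕ
hubsFor H Δ d = order H * (suc d * (d + ballBound Δ 4 * d)) + d

abstract
  sepSize : Graph → ℕ → ℕ → ℕ
  sepSize H Δ w = linksFor H Δ w * suc Δ ^ suc (ballBound Δ 2)

  -- The first summand lets `thin` find enough vertices pairwise further apart than the radius. The
  -- second exceeds a ball of radius `w + 2` about the root, so the window cannot start in the first
  -- three layers and there is room below it.
  setSize : Graph → ℕ → ℕ → ℕ → ℕ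
  setSize H Δ w m = hubsFor H Δ (suc (suc (m + sepSize H Δ w))) * suc (ballBound Δ (suc w + (5 + suc w))) + suc (ballBound Δ (w + 2))

  splitWindow : ∀ H Δ w m G (deg≤ : MaxDegree≤ G Δ) → ¬ IsInducedMinor H G → ∀ {r} (B : BFS G r) i S → Unique S →
    (∀ {v} → v ∈ S → Window.Win B i w v) → setSize H Δ w m ≤ length S → Splitting G (Window.Win B i w) S (sepSize H Δ w) m
  splitWindow H Δ w m G deg≤ ¬H {r} B i S uq S-win le = byLayer i refl
    where
    open Sets G
    open Degree G Δ deg≤
    open BFS B
    open Window B
    ρ : ℕ
    ρ = suc w + (5 + suc w)
    d₀ : ℕ
    d₀ = m + sepSize H Δ w
    near-root : ∀ i′ → i′ ≤ 2 → i ≡ i′ → ⊥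
    near-root i′ i≤ refl = <⇒≱ (≤-trans (m≤n+m _ (hubsFor H Δ (suc (suc d₀)) * suc (ballBound Δ ρ))) le)
      (≤-trans (uniq-length uq (λ p → let iv , _ , l = S-win p in ball-mono (≤-trans l (+-monoʳ-≤ w i≤)) (in-ball iv))) (ball-≤ (w + 2) r))
    deep : ∀ ℓ₀ → i ≡ 3 + ℓ₀ → Splitting G (Win i w) S (sepSize H Δ w) m
    deep ℓ₀ refl = fromThin (thin (λ x y → y ∈ ball ρ x) (λ x y → y ∈? ball ρ x) (ball ρ) (ballBound Δ ρ) (ball-≤ ρ) id
        (hubsFor H Δ (suc (suc d₀))) uq (≤-trans (m≤m+n _ _) le))
      where
      shift : ∀ w l → w + (3 + l) ≡ (3 + w) + l
      shift = solve-∀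
      toX : ∀ {v} → Win (3 + ℓ₀) w v → In v × 3 + ℓ₀ ≤ lay v × lay v ≤ (3 + w) + ℓ₀
      toX (iv , l , l′) = iv , l , ≤-trans l′ (≤-reflexive (shift w ℓ₀))
      fromThin : (∃ λ ys → ys ⊆ S × AllPairs (λ x y → ¬ (y ∈ ball ρ x)) ys × length ys ≡ hubsFor H Δ (suc (suc d₀))) →
        Splitting G (Win (3 + ℓ₀) w) S (sepSize H Δ w) m
      fromThin (ys , sub , far , len) = [ transport , (λ model → ⊥-elim (¬H model)) ]′
          (Linking.structure H G Δ deg≤ B ℓ₀ w (rowsFor H Δ w) (colsFor H Δ w) (linksFor H Δ w) ≤-refl ≤-refl ≤-refl
            ys (λ p → toX (S-win (sub p))) far d₀ {S} {m} sub (≤-trans (n≤1+n _) (n≤1+n _)) (≤-reflexive (sym len)))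
        where
        transport : Splitting G (λ v → In v × 3 + ℓ₀ ≤ lay v × lay v ≤ (3 + w) + ℓ₀) S (sepSize H Δ w) m →
          Splitting G (Win (3 + ℓ₀) w) S (sepSize H Δ w) m
        transport s = record
          { Z = Z ; P = P ; Z-≤ = Z-≤ ; closed = λ p x → closed p (toX x) ; avoid = avoid ; S₁ = S₁ ; S₂ = S₂ ; uq₁ = uq₁ ; uq₂ = uq₂
          ; sub₁ = sub₁ ; sub₂ = sub₂ ; big₁ = big₁ ; big₂ = big₂ }
          where
          open Splitting s
    byLayer : ∀ i′ → i ≡ i′ → Splitting G (Win i w) S (sepSize H Δ w) m
    byLayer 0 e = ⊥-elim (near-root 0 z≤n e)
    byLayer 1 e = ⊥-elim (near-root 1 (s≤s z≤n) e)
    byLayer 2 e = ⊥-elim (near-root 2 (s≤s (s≤s z≤n)) e)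
    byLayer (suc (suc (suc ℓ₀))) e = deep ℓ₀ e

-- To separate at distance `D`, a separator in `G` is thickened to balls of radius `D`; the window
-- is widened by `D` on either side so that paths of length at most `D` between its vertices stay
-- inside.
powerSep : Graph → ℕ → ℕ → ℕ → ℕ
powerSep H Δ w D = sepSize H Δ (w + D + D) * ballBound Δ D

module Power (H : Graph) (Δ w D : ℕ) (G : Graph) (deg≤ : MaxDegree≤ G Δ) (¬H : ¬ IsInducedMinor H G) {r : V G} (B : BFS G r) (i : ℕ) where
  open Sets G
  open Degree G Δ deg≤
  open BFS B
  open Window B

  w′ i′ k : ℕ
  w′ = w + D + D
  -- Truncated subtraction: near the root the widened window simply starts at layer 0.
  i′ = i ∸ D
  k = powerSep H Δ w D

  widen : ∀ {t u v} → t ≤ D → Win i w u → v ∈ ball t u → Win i′ w′ v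
  widen {t} {u} {v} t≤ (iu , l , l′) v∈ = proj₁ here′ , low , high
    where
    here′ = lay-ball t iu v∈
    back = lay-ball t (proj₁ here′) (ball-sym t v∈)
    low : i ∸ D ≤ lay v
    low = m≤n+o⇒m∸n≤o i D (≤-trans l (≤-trans (proj₂ back) (+-monoˡ-≤ (lay v) t≤)))
    high : lay v ≤ w′ + i′
    high = ≤-trans (proj₂ here′) (≤-trans (+-mono-≤ t≤ (≤-trans l′ (+-monoʳ-≤ w (≤-trans (m≤n+m∸n i D) ≤-refl))))
      (≤-reflexive (shuffle D w (i ∸ D))))
      where
      shuffle : ∀ d w j → d + (w + (d + j)) ≡ w + d + d + j
      shuffle = solve-∀

  -- Each side is asked for `k` vertices too many, which makes up for those swallowed by the
  -- thickened separator.
  split : ∀ S → Unique S → (∀ {v} → v ∈ S → Win i w v) → setSize H Δ w′ (suc (4 * k) + k) ≤ length S →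
    Split (Win i w) (λ u v → v ∈ ball D u) S k (suc (4 * k))
  split S uq S-win le = convert (splitWindow H Δ w′ (suc (4 * k) + k) G deg≤ ¬H B i′ S uq (λ p → widen z≤n (S-win p) ball-0) le)
    where
    convert : Splitting G (Win i′ w′) S (sepSize H Δ w′) (suc (4 * k) + k) → Split (Win i w) (λ u v → v ∈ ball D u) S k (suc (4 * k))
    convert s = record
      { Z = Z′ ; P = P′ ; Z-≤ = Z′-≤ ; closed = closed′ ; avoid = λ p → proj₁ (proj₂ (∈-P′⁻ p))
      ; S₁ = filter keep? S₁ ; S₂ = filter keep? S₂ ; uq₁ = Uniqueₚ.filter⁺ keep? uq₁ ; uq₂ = Uniqueₚ.filter⁺ keep? uq₂
      ; sub₁ = λ p → let q , n = ∈-filter⁻ keep? {xs = S₁} p ; a , b = sub₁ q in a , ∈-filter⁺ core? b (n , S-win a)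
      ; sub₂ = λ p → let q , n = ∈-filter⁻ keep? {xs = S₂} p ; a , b , _ = sub₂ q in a , (λ r → b (proj₁ (∈-P′⁻ r))) , n
      ; big₁ = big uq₁ big₁ ; big₂ = big uq₂ big₂ }
      where
      open Splitting s
      Z′ P′ : List (V G)
      Z′ = concatMap (ball D) Z
      keep? : ∀ v → Dec (v ∉ Z′)
      keep? v = ¬? (v ∈? Z′)
      core? : ∀ v → Dec (v ∉ Z′ × Win i w v)
      core? v = keep? v ×-dec win? i w v
      P′ = filter core? P
      ∈-P′⁻ : ∀ {v} → v ∈ P′ → v ∈ P × v ∉ Z′ × Win i w v
      ∈-P′⁻ = ∈-filter⁻ core? {xs = P}
      Z′-≤ : length Z′ ≤ k
      Z′-≤ = ≤-trans (length-concatMap-≤ (ball D) (ballBound Δ D) Z (λ _ → ball-≤ D _)) (*-monoˡ-≤ (ballBound Δ D) Z-≤)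
      -- A path of length at most `D` that starts outside `Z′` never meets `Z`.
      along : ∀ t {u v} → t ≤ D → u ∈ P → u ∉ Z′ → Win i w u → v ∈ ball t u → v ∈ P
      along zero    t≤ p n x v∈ rewrite ball-0⁻ v∈ = p
      along (suc t) {u} {v} t≤ p n x v∈ = next (ball-step⁻ t v∈)
        where
        v∉Z : v ∉ Z
        v∉Z z = n (∈-concatMap (ball D) z (ball-sym D (ball-mono t≤ v∈)))
        next : (∃ λ y → y ∈ ball t u × y ~ v) → v ∈ P
        next (y , y∈ , inj₁ refl) = along t (≤-trans (n≤1+n t) t≤) p n x y∈
        next (y , y∈ , inj₂ e)    = closed (along t (≤-trans (n≤1+n t) t≤) p n x y∈) (widen t≤ x v∈) e v∉Z
      closed′ : ∀ {u v} → u ∈ P′ → Win i w v → v ∈ ball D u → v ∉ Z′ → v ∈ P′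
      closed′ p x v∈ v∉ = let a , b , c = ∈-P′⁻ p in ∈-filter⁺ core? (along D ≤-refl a b c v∈) (v∉ , x)
      big : ∀ {T} → Unique T → suc (4 * k) + k ≤ length T → suc (4 * k) ≤ length (filter keep? T)
      big {T} uqT le = +-cancelʳ-≤ k _ _ (≤-trans le (≤-trans (≤-reflexive (filter-split keep? T))
        (+-monoʳ-≤ (length (filter keep? T)) (≤-trans (uniq-length (Uniqueₚ.filter⁺ (¬? ∘ keep?) uqT)
          (λ {v} q → decidable-stable (v ∈? Z′) (proj₂ (∈-filter⁻ (¬? ∘ keep?) {xs = T} q)))) Z′-≤))))

record WindowColouring (G : Graph) (X : V G → Set) (D c : ℕ) : Set where
  open Sets G
  field
    col   : V G → Bool
    rep   : V G → V G
    same  : ∀ {u v} → X u → X v → v ∈ ball D u → col u ≡ col v → rep u ≡ rep v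
    small : ∀ x → ∃ λ ms → length ms ≤ c × (∀ {u} → X u → rep u ≡ x → u ∈ ms)

abstract
  clusterSize : Graph → ℕ → ℕ → ℕ → ℕ
  clusterSize H Δ w D = 2 * (setSize H Δ (w + D + D) (suc (4 * powerSep H Δ w D) + powerSep H Δ w D) * ballBound Δ D + suc (4 * powerSep H Δ w D))

  colourWindow : ∀ H Δ w D G (deg≤ : MaxDegree≤ G Δ) → ¬ IsInducedMinor H G → ∀ {r} (B : BFS G r) i →
    WindowColouring G (Window.Win B i w) D (clusterSize H Δ w D)
  colourWindow H Δ w D G deg≤ ¬H B i = record
    { col = C.col ; rep = C.rep ; same = λ p q → C.same (∈-U p) (∈-U q)
    ; small = λ x → let ms , len , f = C.small x in ms , len , λ p → f (∈-U p) }
    where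
    open Sets G
    open Degree G Δ deg≤
    open Window B
    module T = TwoColouring (_≟_ {order G}) (Win i w) (λ u v → v ∈ ball D u) (ball-sym D) (ball D) (ballBound Δ D) (ball-≤ D) id
                 (powerSep H Δ w D) (setSize H Δ (w + D + D) (suc (4 * powerSep H Δ w D) + powerSep H Δ w D))
                 (Power.split H Δ w D G deg≤ ¬H B i)
    U : List (V G)
    U = filter (win? i w) (allFin (order G))
    ∈-U : ∀ {v} → Win i w v → v ∈ U
    ∈-U {v} = ∈-filter⁺ (win? i w) (∈-allFin v)
    module C = T.Clustering (T.twoColour U (Uniqueₚ.filter⁺ (win? i w) (Uniqueₚ.allFin⁺ _)) (λ p → proj₂ (∈-filter⁻ (win? i w) {xs = allFin (order G)} p)))

-- Three-colourings

simple-suffix : ∀ {A : Set} {E : List (A × A)} {a b v} (w : Walk E a b) → Unique (verts w) → v ∈ verts w →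
  Σ (Walk E v b) λ w′ → Unique (verts w′) × verts w′ ⊆ verts w
simple-suffix w@(stop a)   uq (here refl) = w , uq , id
simple-suffix w@(go _ _ _) uq (here refl) = w , uq , id
simple-suffix (go a e w) (_ ∷ uq) (there p) = let w′ , uq′ , s = simple-suffix w uq p in w′ , uq′ , there ∘ s

simplify : ∀ {A : Set} (_≟ᴬ_ : DecidableEquality A) {E : List (A × A)} {a b} (w : Walk E a b) →
  Σ (Walk E a b) λ w′ → Unique (verts w′) × verts w′ ⊆ verts w
simplify _≟ᴬ_ (stop a) = stop a , [] ∷ [] , id
simplify _≟ᴬ_ (go a e w) with simplify _≟ᴬ_ w
... | w′ , uq , s with DecMem._∈?_ _≟ᴬ_ a (verts w′)
... | yes a∈ = let w″ , uq″ , s″ = simple-suffix w′ uq a∈ in w″ , uq″ , there ∘ s ∘ s″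
... | no a∉ = go a e w′ , All.tabulate (λ p → λ { refl → a∉ p }) ∷ uq , λ { (here p) → here p ; (there p) → there (s p) }

-- Layers are written as phase plus six times block. From phase `p`, a rise by `t` that falls short
-- of phase `q` in the next block cannot increase the block.
block-≤ : ∀ {p q j j′} t → q + j′ * 6 ≤ t + (p + j * 6) → t + p < 6 + q → j′ ≤ j
block-≤ {p} {q} {j} {j′} t le lt = ≮⇒≥ λ j<j′ → <⇒≱ (+-monoˡ-< (j * 6) lt) (≤-trans (≤-reflexive (shuffle q (j * 6)))
    (≤-trans (+-monoʳ-≤ q (*-monoˡ-≤ 6 j<j′)) (≤-trans le (≤-reflexive (sym (+-assoc t p (j * 6)))))))
  where
  shuffle : ∀ q m → (6 + q) + m ≡ q + (6 + m)
  shuffle = solve-∀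

-- The order of the constants matters: a cluster of gaps has at most `tClusters` vertices and steps
-- of length at most 5, so it spans at most `pieceSpan`; only then is the distance `powerOf` for the
-- layers in between fixed, exceeding that span by 4.
tClusters rClusters pieceSpan powerOf pathSize totalSize : Graph → ℕ → ℕ
tClusters H Δ = clusterSize H Δ 0 5
pieceSpan H Δ = 5 * tClusters H Δ
powerOf H Δ = pieceSpan H Δ + 4
rClusters H Δ = clusterSize H Δ 4 (powerOf H Δ)
pathSize H Δ = rClusters H Δ + rClusters H Δ * ballBound Δ (pieceSpan H Δ + 3)
totalSize H Δ = (tClusters H Δ + rClusters H Δ) + (pathSize H Δ + (ballBound Δ (pieceSpan H Δ + 2) + ballBound Δ (pieceSpan H Δ + 3) * pathSize H Δ))

module ThreeColouring (H : Graph) (Δ : ℕ) (G : Graph) (deg≤ : MaxDegree≤ G Δ) {r : V G} (B : BFS G r)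
    (colT : ∀ j → WindowColouring G (Window.Win B (j * 6) 0) 5 (tClusters H Δ))
    (colR : ∀ j → WindowColouring G (Window.Win B (suc (j * 6)) 4) (powerOf H Δ) (rClusters H Δ)) where
  open Sets G
  open Degree G Δ deg≤
  open BFS B
  open Window B
  private
    cT = tClusters H Δ
    cR = rClusters H Δ
    span = pieceSpan H Δ

  blk phase : V G → ℕ
  blk v = lay v / 6
  phase v = lay v % 6

  lay-eq : ∀ v → lay v ≡ phase v + blk v * 6
  lay-eq v = m≡m%n+[m/n]*n (lay v) 6

  InT InR : V G → Set
  InT v = In v × phase v ≡ 0
  InR v = In v × phase v ≢ 0

  t-layer : ∀ {v} → InT v → lay v ≡ blk v * 6
  t-layer {v} (_ , e) = trans (lay-eq v) (cong (_+ blk v * 6) e)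

  winT : ∀ {v} → InT v → Win (blk v * 6) 0 v
  winT {v} t = proj₁ t , ≤-reflexive (sym (t-layer t)) , ≤-reflexive (t-layer t)

  winR : ∀ {v} → InR v → Win (suc (blk v * 6)) 4 v
  winR {v} (i , ne) = i , subst (suc (blk v * 6) ≤_) (sym (lay-eq v)) (+-monoˡ-≤ (blk v * 6) (n≢0⇒n>0 ne)) ,
    subst₂ _≤_ (sym (lay-eq v)) (sym (+-suc 4 (blk v * 6))) (+-monoˡ-≤ (blk v * 6) (≤-pred (m%n<n (lay v) 6)))

  -- Distance 5 is too short to reach another T-layer, six layers away.
  block-T : ∀ {u v} → InT u → InT v → v ∈ ball 5 u → blk u ≡ blk v
  block-T {u} {v} tu tv v∈ = ≤-antisym (below (proj₁ tv) tv tu (ball-sym 5 v∈)) (below (proj₁ tu) tu tv v∈)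
    where
    below : ∀ {u v} → In u → InT u → InT v → v ∈ ball 5 u → blk v ≤ blk u
    below i tu tv v∈ = block-≤ {0} {0} 5 (subst₂ (λ a b → a ≤ 5 + b) (t-layer tv) (t-layer tu) (proj₂ (lay-ball 5 i v∈))) (s≤s (s≤s (s≤s (s≤s (s≤s (s≤s z≤n))))))

  block-R : ∀ {u v} → InR u → InR v → u ~ v → blk u ≡ blk v
  block-R {u} {v} ru rv e = ≤-antisym (below rv ru (~-sym e)) (below ru rv e)
    where
    below : ∀ {u v} → InR u → InR v → u ~ v → blk v ≤ blk u
    below {u} {v} (i , _) (_ , ne) e = block-≤ {phase u} {phase v} 1 (subst₂ (λ a b → a ≤ 1 + b) (lay-eq v) (lay-eq u) (lay-adj i e))
      (≤-trans (s≤s (m%n<n (lay u) 6)) (+-monoʳ-≤ 6 (n≢0⇒n>0 ne)))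

  cT-of : V G → Bool
  cT-of v = WindowColouring.col (colT (blk v)) v
  rT : V G → V G
  rT v = WindowColouring.rep (colT (blk v)) v
  cR-of : V G → Bool
  cR-of v = WindowColouring.col (colR (blk v)) v
  rR : V G → V G
  rR v = WindowColouring.rep (colR (blk v)) v

  same-T : ∀ {u v} → InT u → InT v → v ∈ ball 5 u → cT-of u ≡ cT-of v → rT u ≡ rT v
  same-T {u} {v} tu tv v∈ e = aux (block-T tu tv v∈) e
    where
    aux : blk u ≡ blk v → cT-of u ≡ cT-of v → rT u ≡ rT v
    aux b e rewrite b = WindowColouring.same (colT (blk v)) (subst (λ j → Win (j * 6) 0 u) b (winT tu)) (winT tv) v∈ e

  same-R : ∀ {u v} → InR u → InR v → blk u ≡ blk v → v ∈ ball (powerOf H Δ) u → cR-of u ≡ cR-of v → rR u ≡ rR v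
  same-R {u} {v} ru rv b v∈ e = aux b e
    where
    aux : blk u ≡ blk v → cR-of u ≡ cR-of v → rR u ≡ rR v
    aux b e rewrite b = WindowColouring.same (colR (blk v)) (subst (λ j → Win (suc (j * 6)) 4 u) b (winR ru)) (winR rv) v∈ e

  classT : V G → List (V G)
  classT u = proj₁ (WindowColouring.small (colT (blk u)) (rT u))
  classR : V G → List (V G)
  classR u = proj₁ (WindowColouring.small (colR (blk u)) (rR u))

  ∈-classT : ∀ {u v} → InT v → blk v ≡ blk u → rT v ≡ rT u → v ∈ classT u
  ∈-classT {u} {v} tv b e = proj₂ (proj₂ (WindowColouring.small (colT (blk u)) (rT u)))
    (subst (λ j → Win (j * 6) 0 v) b (winT tv)) (subst (λ j → WindowColouring.rep (colT j) v ≡ rT u) b e)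

  ∈-classR : ∀ {u v} → InR v → blk v ≡ blk u → rR v ≡ rR u → v ∈ classR u
  ∈-classR {u} {v} rv b e = proj₂ (proj₂ (WindowColouring.small (colR (blk u)) (rR u)))
    (subst (λ j → Win (suc (j * 6)) 4 v) b (winR rv)) (subst (λ j → WindowColouring.rep (colR j) v ≡ rR u) b e)

  -- The T-layers get colour 2 except for small gaps of colour 0; the R-vertices next to
  -- a gap get colour 1, so that no monochromatic component passes through a gap.
  Gap : V G → Set
  Gap v = InT v × cT-of v ≡ true

  gap? : ∀ v → Dec (Gap v)
  gap? v = (In? v ×-dec (phase v ≟ℕ 0)) ×-dec (cT-of v Boolₚ.≟ true)

  Beside : V G → Set
  Beside v = Any Gap (nb⁺ v)

  beside? : ∀ v → Dec (Beside v)
  beside? v = any? gap? (nb⁺ v)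

  beside : ∀ {v g} → v ~ g → Gap g → Beside v
  beside e g = lose (∈-nb⁺ e) g

  choose : ∀ {v} → Dec (phase v ≡ 0) → Bool → Dec (Beside v) → Bool → Fin 3
  choose (yes _) true  _       _     = fzero
  choose (yes _) false _       _     = fsuc (fsuc fzero)
  choose (no _)  _     (yes _) _     = fsuc fzero
  choose (no _)  _     (no _)  true  = fzero
  choose (no _)  _     (no _)  false = fsuc fzero

  col : V G → Fin 3
  col v = choose {v} (phase v ≟ℕ 0) (cT-of v) (beside? v) (cR-of v)

  data Kind (v : V G) : Fin 3 → Set where
    wall : InT v → cT-of v ≡ false → Kind v (fsuc (fsuc fzero))
    gap  : Gap v → Kind v fzero
    side : InR v → Beside v → Kind v (fsuc fzero)
    one  : InR v → ¬ Beside v → cR-of v ≡ true → Kind v fzero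
    two  : InR v → ¬ Beside v → cR-of v ≡ false → Kind v (fsuc fzero)

  kind : ∀ {v} → In v → Kind v (col v)
  kind {v} i = aux (phase v ≟ℕ 0) (cT-of v) refl (beside? v) (cR-of v) refl
    where
    aux : (p : Dec (phase v ≡ 0)) (b : Bool) → cT-of v ≡ b → (q : Dec (Beside v)) (c : Bool) → cR-of v ≡ c → Kind v (choose {v} p b q c)
    aux (yes p) true  e _       _     _  = gap ((i , p) , e)
    aux (yes p) false e _       _     _  = wall (i , p) e
    aux (no p)  _     _ (yes q) _     _  = side (i , p) q
    aux (no p)  _     _ (no q)  true  e′ = one (i , p) q e′
    aux (no p)  _     _ (no q)  false e′ = two (i , p) q e′

  -- Gaps next to equal or adjacent vertices are at distance at most 3 and are therefore joined
  -- here; along such walks the cluster of the gap does not change.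
  gapEdges : List (V G × V G)
  gapEdges = filter (λ (x , y) → (gap? x ×-dec gap? y) ×-dec (y ∈? ball 5 x)) (cartesianProduct (allFin (order G)) (allFin (order G)))

  ∈-gapEdges : ∀ {x y} → Gap x → Gap y → y ∈ ball 5 x → (x , y) ∈ gapEdges
  ∈-gapEdges {x} {y} gx gy e = ∈-filter⁺ (λ (x , y) → (gap? x ×-dec gap? y) ×-dec (y ∈? ball 5 x)) (∈-cartesianProduct⁺ (∈-allFin x) (∈-allFin y)) ((gx , gy) , e)

  ∈-gapEdges⁻ : ∀ {x y} → (x , y) ∈ gapEdges → (Gap x × Gap y) × y ∈ ball 5 x
  ∈-gapEdges⁻ p = proj₂ (∈-filter⁻ (λ (x , y) → (gap? x ×-dec gap? y) ×-dec (y ∈? ball 5 x)) {xs = cartesianProduct (allFin (order G)) (allFin (order G))} p)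

  gap-class : ∀ {x y} (w : Walk gapEdges x y) → Gap x → ∀ {v} → v ∈ verts w → Gap v × blk v ≡ blk x × rT v ≡ rT x
  gap-class (stop x) g (here refl) = g , refl , refl
  gap-class (go x e w) g (here refl) = g , refl , refl
  gap-class (go x e w) g (there p) with ∈-gapEdges⁻ e
  ... | (gx , gy) , b with gap-class w gy p
  ... | gv , bl , re = gv , trans bl (sym (block-T (proj₁ gx) (proj₁ gy) b)) ,
          trans re (sym (same-T (proj₁ gx) (proj₁ gy) b (trans (proj₂ gx) (sym (proj₂ gy)))))

  walk-ball : ∀ {x y} (w : Walk gapEdges x y) → y ∈ ball (5 * length (verts w)) x
  walk-ball (stop x) = ball-refl 5
  walk-ball {y = y} (go x e w) = subst (λ m → y ∈ ball m x) (trans (+-comm (5 * length (verts w)) 5) (sym (*-suc 5 (length (verts w)))))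
    (ball-trans 5 (5 * length (verts w)) (proj₂ (∈-gapEdges⁻ e)) (walk-ball w))

  -- A simple walk visits each vertex of its bounded cluster at most once, in steps of length at
  -- most 5.
  walk-span : ∀ {x y} → Gap x → Walk gapEdges x y → y ∈ ball span x
  walk-span {x} g w = let w′ , uq , _ = simplify _≟_ w in ball-mono (*-monoʳ-≤ 5 (≤-trans
      (uniq-length uq (λ p → let gv , b , e = gap-class w′ g p in ∈-classT (proj₁ gv) b e))
      (proj₁ (proj₂ (WindowColouring.small (colT (blk x)) (rT x)))))) (walk-ball w′)

  -- Together these make up colour 1. They may overlap, since `Two` does not ask whether the vertex
  -- is beside a gap.
  Two Side : V G → Set
  Two v = InR v × cR-of v ≡ false
  Side v = InR v × Beside v

  gap-of : ∀ {v} → Beside v → ∃ λ g → v ~ g × Gap g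
  gap-of b = let g , g∈ , gg = find b in g , ∈-nb⁺⁻ g∈ , gg

  -- `v` lies on a run of `Side` vertices that left the cluster of `x` at `x′`; the run is shadowed
  -- by a walk of gaps from `g′`, close to `x′`, to `g`, next to `v`.
  record Near (x v : V G) : Set where
    field
      {x′ g g′} : V G
      x′-two : Two x′
      x′-blk : blk x′ ≡ blk x
      x′-rep : rR x′ ≡ rR x
      v-side : Side v
      v-blk  : blk v ≡ blk x
      gg′    : Gap g′
      gg     : Gap g
      close  : g′ ∈ ball 2 x′
      walk   : Walk gapEdges g′ g
      touch  : v ~ g

    near-x′ : v ∈ ball (span + 3) x′
    near-x′ = subst (λ m → v ∈ ball m x′) (shuffle span) (ball-trans (span + 2) 1 (ball-trans 2 span close (walk-span gg′ walk)) (ball-1 (~-sym touch)))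
      where
      shuffle : ∀ s → 1 + (s + 2) ≡ s + 3
      shuffle = solve-∀

  InvX : V G → V G → Set
  InvX x v = (Two v × blk v ≡ blk x × rR v ≡ rR x) ⊎ Near x v

  DR≥1 : 1 ≤ powerOf H Δ
  DR≥1 = ≤-trans (s≤s z≤n) (m≤n+m 4 span)

  -- A run beside gaps stays within `span + 3` of `x′`. The `Two` vertex at which it ends is thus
  -- within `span + 4`, that is `powerOf`, of `x′` and belongs to the same cluster again.
  invX-step : ∀ {x v v′} → InvX x v → v ~ v′ → Two v′ ⊎ Side v′ → InvX x v′
  invX-step (inj₁ ((rv , cv) , b , e)) a (inj₁ (rv′ , cv′)) = inj₁ ((rv′ , cv′) , trans (sym bb) b ,
      trans (sym (same-R rv rv′ bb (ball-mono DR≥1 (ball-1 a)) (trans cv (sym cv′)))) e)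
    where bb = block-R rv rv′ a
  invX-step (inj₁ (tv , b , e)) a (inj₂ (rv′ , bs)) = let g , t , gg = gap-of bs in
    inj₂ record { x′-two = tv ; x′-blk = b ; x′-rep = e ; v-side = rv′ , bs ; v-blk = trans (sym (block-R (proj₁ tv) rv′ a)) b
                ; gg′ = gg ; gg = gg ; close = ball-trans 1 1 (ball-1 a) (ball-1 t) ; walk = stop g ; touch = t }
  invX-step {x} {v} {v′} (inj₂ n) a (inj₂ (rv′ , bs)) = let g₂ , t₂ , gg₂ = gap-of bs in
    inj₂ record { x′-two = x′-two ; x′-blk = x′-blk ; x′-rep = x′-rep ; v-side = rv′ , bs
                ; v-blk = trans (sym (block-R (proj₁ v-side) rv′ a)) v-blk ; gg′ = gg′ ; gg = gg₂ ; close = close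
                ; walk = walk ++ʷ go _ (∈-gapEdges gg gg₂ (ball-mono {3} (s≤s (s≤s (s≤s z≤n))) (ball-trans 2 1 (ball-trans 1 1 (ball-1 (~-sym touch)) (ball-1 a)) (ball-1 t₂)))) (stop g₂)
                ; touch = t₂ }
    where
    open Near n
  invX-step {x} {v} {v′} (inj₂ n) a (inj₁ (rv′ , cv′)) = inj₁ ((rv′ , cv′) , bl ,
      trans (sym (same-R (proj₁ x′-two) rv′ (trans x′-blk (sym bl)) (subst (λ m → v′ ∈ ball m x′) (shuffle span) (ball-trans (span + 3) 1 near-x′ (ball-1 a)))
        (trans (proj₂ x′-two) (sym cv′)))) x′-rep)
    where
    open Near n
    bl : blk v′ ≡ blk x
    bl = trans (sym (block-R (proj₁ v-side) rv′ a)) v-blk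
    shuffle : ∀ s → 1 + (s + 3) ≡ s + 4
    shuffle = solve-∀

  listX : V G → List (V G)
  listX x = classR x ++ concatMap (ball (span + 3)) (classR x)

  classR-≤ : ∀ x → length (classR x) ≤ cR
  classR-≤ x = proj₁ (proj₂ (WindowColouring.small (colR (blk x)) (rR x)))

  listX-≤ : ∀ x → length (listX x) ≤ pathSize H Δ
  listX-≤ x = subst (_≤ pathSize H Δ) (sym (length-++ (classR x))) (+-mono-≤ (classR-≤ x)
    (≤-trans (length-concatMap-≤ (ball (span + 3)) (ballBound Δ (span + 3)) (classR x) (λ _ → ball-≤ (span + 3) _)) (*-monoˡ-≤ (ballBound Δ (span + 3)) (classR-≤ x))))

  ∈-listX : ∀ {x v} → InvX x v → v ∈ listX x
  ∈-listX (inj₁ (tv , b , e)) = ∈-++⁺ˡ (∈-classR (proj₁ tv) b e)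
  ∈-listX {x} (inj₂ n) = ∈-++⁺ʳ (classR x) (∈-concatMap (ball (span + 3)) (∈-classR (proj₁ x′-two) x′-blk x′-rep) near-x′)
    where
    open Near n

  record Along (u g₀ v : V G) : Set where
    field
      {g}    : V G
      v-side : Side v
      gg     : Gap g
      walk   : Walk gapEdges g₀ g
      touch  : v ~ g

  -- A component explored from a `Side` vertex follows the gaps near `u` until it meets a first
  -- `Two` vertex `x`; from there on the invariant of `x` takes over.
  module FromSide {u g₀ : V G} (u~g₀ : u ~ g₀) (gg₀ : Gap g₀) where
    InvU : V G → Set
    InvU v = Along u g₀ v ⊎ (∃ λ x → x ∈ ball (span + 3) u × InvX x v)

    along-ball : ∀ {v} → Along u g₀ v → v ∈ ball (span + 2) u
    along-ball {v} a = subst (λ m → v ∈ ball m u) (shuffle span) (ball-trans (span + 1) 1 (ball-trans 1 span (ball-1 u~g₀) (walk-span gg₀ walk)) (ball-1 (~-sym touch)))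
      where
      open Along a
      shuffle : ∀ s → 1 + (s + 1) ≡ s + 2
      shuffle = solve-∀

    step-U : ∀ {v v′} → InvU v → v ~ v′ → Two v′ ⊎ Side v′ → InvU v′
    step-U (inj₂ (x , x∈ , i)) a k = inj₂ (x , x∈ , invX-step i a k)
    step-U {v} {v′} (inj₁ al) a (inj₁ tv′) = inj₂ (v′ , subst (λ m → v′ ∈ ball m u) (shuffle span) (ball-trans (span + 2) 1 (along-ball al) (ball-1 a)) , inj₁ (tv′ , refl , refl))
      where
      shuffle : ∀ s → 1 + (s + 2) ≡ s + 3
      shuffle = solve-∀
    step-U (inj₁ al) a (inj₂ (rv′ , bs)) = let g₂ , t₂ , gg₂ = gap-of bs in
      inj₁ record { v-side = rv′ , bs ; gg = gg₂ ; touch = t₂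
                  ; walk = walk ++ʷ go _ (∈-gapEdges gg gg₂ (ball-mono {3} (s≤s (s≤s (s≤s z≤n))) (ball-trans 2 1 (ball-trans 1 1 (ball-1 (~-sym touch)) (ball-1 a)) (ball-1 t₂)))) (stop g₂) }
      where
      open Along al

    listU : List (V G)
    listU = ball (span + 2) u ++ concatMap listX (ball (span + 3) u)

    ∈-listU : ∀ {v} → InvU v → v ∈ listU
    ∈-listU (inj₁ al) = ∈-++⁺ˡ (along-ball al)
    ∈-listU (inj₂ (x , x∈ , i)) = ∈-++⁺ʳ (ball (span + 2) u) (∈-concatMap listX x∈ (∈-listX i))

    listU-≤ : length listU ≤ ballBound Δ (span + 2) + ballBound Δ (span + 3) * pathSize H Δ
    listU-≤ = subst (_≤ ballBound Δ (span + 2) + ballBound Δ (span + 3) * pathSize H Δ) (sym (length-++ (ball (span + 2) u)))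
      (+-mono-≤ (ball-≤ (span + 2) u) (≤-trans (length-concatMap-≤ listX (pathSize H Δ) (ball (span + 3) u) (λ _ → listX-≤ _))
        (*-monoˡ-≤ (pathSize H Δ) (ball-≤ (span + 3) u))))

  Bounded : V G → Set
  Bounded u = ∃ λ ms → length ms ≤ totalSize H Δ × (∀ {v} → Reach G (λ x → col x ≡ col u) u v → v ∈ ms)

  by-invariant : ∀ {u c} → In u → col u ≡ c → (Inv : V G → Set) → Inv u →
    (∀ {v v′} → Inv v → v ~ v′ → Kind v′ c → Inv v′) →
    ∀ {v} → Reach G (λ x → col x ≡ col u) u v → In v × Inv v
  by-invariant iu e Inv base next (here _) = iu , base
  by-invariant iu e Inv base next (step {v = v} r a p) =
    let iw , iv = by-invariant iu e Inv base next r ; i = in-adj iw (inj₂ a) in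
    i , next iv (inj₂ a) (subst (Kind v) (trans p e) (kind i))

  sideOrTwo : ∀ {v} → Kind v (fsuc fzero) → Two v ⊎ Side v
  sideOrTwo (side r b)  = inj₂ (r , b)
  sideOrTwo (two r _ e) = inj₁ (r , e)

  boundedBy : ∀ {u c} → Kind u c → col u ≡ c → In u → Bounded u
  boundedBy {u} (wall t e) q iu = classT u , ≤-trans (proj₁ (proj₂ (WindowColouring.small (colT (blk u)) (rT u)))) (≤-trans (m≤m+n cT cR) (m≤m+n _ _)) ,
      λ r → let tv , _ , b , re = proj₂ (by-invariant iu q Inv (t , e , refl , refl) next r) in ∈-classT tv b re
    where
    Inv : V G → Set
    Inv v = InT v × cT-of v ≡ false × blk v ≡ blk u × rT v ≡ rT u
    next : ∀ {v v′} → Inv v → v ~ v′ → Kind v′ (fsuc (fsuc fzero)) → Inv v′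
    next (tv , ev , b , re) a (wall tv′ ev′) = tv′ , ev′ , trans (sym (block-T tv tv′ near)) b , trans (sym (same-T tv tv′ near (trans ev (sym ev′)))) re
      where near = ball-mono {1} (s≤s z≤n) (ball-1 a)
  boundedBy {u} (gap (t , e)) q iu = classT u , ≤-trans (proj₁ (proj₂ (WindowColouring.small (colT (blk u)) (rT u)))) (≤-trans (m≤m+n cT cR) (m≤m+n _ _)) ,
      λ r → let (tv , _) , b , re = proj₂ (by-invariant iu q Inv ((t , e) , refl , refl) next r) in ∈-classT tv b re
    where
    Inv : V G → Set
    Inv v = Gap v × blk v ≡ blk u × rT v ≡ rT u
    next : ∀ {v v′} → Inv v → v ~ v′ → Kind v′ fzero → Inv v′
    next ((tv , ev) , b , re) a (gap (tv′ , ev′)) = (tv′ , ev′) , trans (sym (block-T tv tv′ near)) b , trans (sym (same-T tv tv′ near (trans ev (sym ev′)))) re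
      where near = ball-mono {1} (s≤s z≤n) (ball-1 a)
    next (g , _) a (one _ nb _) = ⊥-elim (nb (beside (~-sym a) g))
  boundedBy {u} (one t nb e) q iu = classR u , ≤-trans (classR-≤ u) (≤-trans (m≤n+m cR cT) (m≤m+n _ _)) ,
      λ r → let tv , _ , _ , b , re = proj₂ (by-invariant iu q Inv (t , nb , e , refl , refl) next r) in ∈-classR tv b re
    where
    Inv : V G → Set
    Inv v = InR v × ¬ Beside v × cR-of v ≡ true × blk v ≡ blk u × rR v ≡ rR u
    next : ∀ {v v′} → Inv v → v ~ v′ → Kind v′ fzero → Inv v′
    next (_ , nb , _) a (gap g) = ⊥-elim (nb (beside a g))
    next (tv , _ , ev , b , re) a (one tv′ nb′ ev′) = tv′ , nb′ , ev′ , trans (sym bb) b ,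
        trans (sym (same-R tv tv′ bb (ball-mono DR≥1 (ball-1 a)) (trans ev (sym ev′)))) re
      where bb = block-R tv tv′ a
  boundedBy {u} (two t nb e) q iu = listX u , ≤-trans (listX-≤ u) (≤-trans (m≤m+n _ _) (m≤n+m _ (cT + cR))) ,
    λ r → ∈-listX (proj₂ (by-invariant iu q (InvX u) (inj₁ ((t , e) , refl , refl)) (λ i a k → invX-step i a (sideOrTwo k)) r))
  boundedBy {u} (side t b) q iu = let g , ug , gg = gap-of b in fromSide g ug gg
    where
    fromSide : ∀ g → u ~ g → Gap g → Bounded u
    fromSide g ug gg = listU , ≤-trans listU-≤ (≤-trans (m≤n+m _ (pathSize H Δ)) (m≤n+m _ (cT + cR))) ,
        λ r → ∈-listU (proj₂ (by-invariant iu q InvU (inj₁ record { v-side = t , b ; gg = gg ; walk = stop g ; touch = ug }) (λ i a k → step-U i a (sideOrTwo k)) r))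
      where
      open FromSide ug gg

  bounded : ∀ {u} → In u → Bounded u
  bounded iu = boundedBy (kind iu) refl iu

-- Combining the components

module Roots (G : Graph) where
  open Sets G
  open Components (_≟_ {order G})

  abstract
    -- The representative of a class lies in that class, so it can serve as the root of the search
    -- for the whole component.
    comp-idem : ∀ F v → comp F (comp F v) ≡ comp F v
    comp-idem [] v = refl
    comp-idem ((x , y) ∷ F) v with comp F v ≟ comp F x
    ... | yes _ with comp F (comp F y) ≟ comp F x
    ...   | yes _ = refl
    ...   | no _  = comp-idem F y
    comp-idem ((x , y) ∷ F) v | no ne with comp F (comp F v) ≟ comp F x
    ...   | yes e = ⊥-elim (ne (trans (sym (comp-idem F v)) e))
    ...   | no _  = comp-idem F v

  root : V G → V G
  root = comp (edges (allFin (order G)))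

  root-adj : ∀ {u v} → adj G u v ≡ true → root u ≡ root v
  root-adj e = comp-edge (∈-edges (∈-allFin _) (∈-allFin _) e)

  root-in : ∀ v {r} → r ≡ root v → (B : BFS G r) → BFS.In B v
  root-in v refl B = along (comp-walk edges-sym (edges (allFin (order G))) id (comp-idem (edges (allFin (order G))) v)) (BFS.in-root B)
    where
    along : ∀ {a b} → Walk (edges (allFin (order G))) a b → BFS.In B a → BFS.In B b
    along (stop a)   i = i
    along (go a e w) i = along w (BFS.in-adj B i (inj₂ (proj₂ (proj₂ (∈-edges⁻ e)))))

module Final (H : Graph) (Δ : ℕ) (G : Graph) (deg≤ : MaxDegree≤ G Δ) (¬H : ¬ IsInducedMinor H G) where
  open Roots G

  module At (r : V G) = ThreeColouring H Δ G deg≤ (bfs G r)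
    (λ j → colourWindow H Δ 0 5 G deg≤ ¬H (bfs G r) (j * 6)) (λ j → colourWindow H Δ 4 (powerOf H Δ) G deg≤ ¬H (bfs G r) (suc (j * 6)))

  colouring : V G → Fin 3
  colouring v = At.col (root v) v

  same-root : ∀ {u v} → Reach G (λ x → colouring x ≡ colouring u) u v → root v ≡ root u
  same-root (here _)     = refl
  same-root (step r e _) = trans (sym (root-adj e)) (same-root r)

  localise : ∀ {u v} → Reach G (λ x → colouring x ≡ colouring u) u v → Reach G (λ x → At.col (root u) x ≡ At.col (root u) u) u v
  localise (here p)                = here p
  localise {u} (step {v = v} r e p) = step (localise r) e (subst (λ s → At.col s v ≡ At.col (root u) u) (same-root (step r e p)) p)

  clustered : ClusteredBy G colouring (totalSize H Δ)
  clustered u f f-inj all = let ms , len , mem = At.bounded (root u) (root-in u refl (bfs G (root u))) in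
    <⇒≱ {totalSize H Δ} (≤-reflexive (sym (length-tabulate {n = suc (totalSize H Δ)} id))) (≤-trans
      (inj-length (λ i v → f i ≡ v) (Uniqueₚ.allFin⁺ (suc (totalSize H Δ))) (λ {i} _ → f i , mem (localise (all i)) , refl)
        (λ _ _ p q → f-inj (trans p (sym q)))) len)

theorem9 : (H : Graph) (Δ : ℕ) → ∃ λ (c : ℕ) →
    ∀ (G : Graph) → MaxDegree≤ G Δ → ¬ IsInducedMinor H G →
    ∃ λ (col : V G → Fin 3) → ClusteredBy G col c
theorem9 H Δ = totalSize H Δ , λ G deg≤ ¬H → Final.colouring H Δ G deg≤ ¬H , Final.clustered H Δ G deg≤ ¬H
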